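{- Consider the problem of finding, in a $k$-uniform hypergraph $G=(V,E)$ with vertex capacities and with an additional matroid constraint $\mathcal{M}=(E,\mathcal{I})$ of rank $r_{\mathcal{M}}$ on the edges, a $b$-matching $M$ that is independent in $\mathcal{M}$ and maximizes $f(M)$, in the semi-streaming model. Let $M_{max}$ denote a maximum cardinality $b$-matching. (a) To maximize linear functions $f(M)=\sum_{e\in M}w(e)$ with $w:E\to\mathbb{R}_+$, for $\varepsilon>0$, there is a $(k+1+\varepsilon)$-approximation algorithm using $O\left(\log_{1+\varepsilon}(W/\varepsilon)\cdot\min\{|M_{max}|,r_{\mathcal{M}}\}\right)$ variables in memory, where $W$ denotes the maximum ratio between two non-zero weights. (b) To maximize non-negative submodular functions, there is an algorithm with approximation ratio $k+2\sqrt{k+1}+2$ for monotone functions and $k+2\sqrt{k+2}+3$ for non-monotone functions, using $O\left(\log_{1+\varepsilon}(W/\varepsilon)\cdot\min\{|M_{max}|,r_{\mathcal{M}}\}\right)$ variables in memory, where $W$ denotes the maximum quotient $\frac{f(e\,|\,Y)}{f(e'\,|\,X)}$ for $X\subseteq Y\subseteq E$, $e,e'\in E$, such that $f(e'\,|\,X)>0$, and where $\varepsilon$ is the parameter of the algorithm, namely $\varepsilon=\frac{1}{\sqrt{k+1}}$ in the monotone case and $\varepsilon=\frac{\sqrt{k+2}}{k+1}$ in the non-monotone case.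
   Context: In a $k$-uniform hypergraph $G=(V,E)$, each edge $e\in E$ contains $k$ vertices. Each vertex $v$ has a capacity $b_v\in\mathbb{Z}_{+}$, and a $b$-matching is a set $M\subseteq E$ such that each vertex $v$ belongs to at most $b_v$ edges of $M$. A solution is feasible if it is a $b$-matching and belongs to $\mathcal{I}$; the rank $r_{\mathcal{M}}$ is the maximum size of a set in $\mathcal{I}$. A function $f:2^E\to\mathbb{R}_+$ is submodular if $f(X\cup\{e\})-f(X)\ge f(Y\cup\{e\})-f(Y)$ for all $X\subseteq Y\subsetneq E$ and $e\in E\setminus Y$; it is monotone if $f(X)\le f(Y)$ whenever $X\subseteq Y\subseteq E$, and non-monotone otherwise. Notation: $f(e\,|\,X)=f(X\cup\{e\})-f(X)$. An algorithm has approximation ratio $\alpha$ if it outputs a feasible $M$ with $\alpha f(M)\ge f(M^{opt})$, where $M^{opt}$ is an optimal feasible solution; in the non-monotone case the algorithm is randomized and $f(M)$ is replaced by $\mathbb{E}[f(M)]$. In the semi-streaming model, the edges of $E$ arrive one by one over time and the algorithm has only limited memory, so it cannot store all of $E$; memory is counted as the number of variables used.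
   Formalization: The logarithm in the memory bounds is rounded up and read as at least 1 (for ε ≥ W it would be zero or negative, leaving no memory); the constant in O(·) may depend on k; the reals may be any Archimedean ordered field with square roots and exact comparisons. -}

module Defs where

open import Level using (0ℓ)
open import Algebra.Bundles using (CommutativeRing; Semiring)
import Algebra.Definitions.RawMonoid as RawMonoidDefs
import Algebra.Definitions.RawSemiring as RawSemiringDefs
open import Data.Bool using (Bool)
open import Data.Nat as ℕ using (ℕ; suc)
open import Data.Fin using (Fin; zero; suc)
open import Data.Fin.Subset
  using (Subset; inside; outside; ⊥; ⁅_⁆; _∪_; _∩_; _∈_; _∉_; _⊆_; ∣_∣)
open import Data.Vec as Vec using ([]; _∷_)
open import Data.List as List using (List; []; _∷_)
open import Data.Product using (Σ-syntax; ∃-syntax; _×_; _,_)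
open import Function using (_∘_)
open import Relation.Binary.Core using (Rel)
open import Relation.Binary.PropositionalEquality using (_≡_)
open import Relation.Binary.Structures using (IsDecTotalOrder)
open import Relation.Nullary using (does)
open import Relation.Unary using (Pred; Decidable)

-- The real numbers enter only through these axioms.  The order is decidable
-- because the algorithms branch on exact comparisons of reals.  Classical ℝ is
-- a model; so is the field of real constructible numbers.

record EuclideanField : Set₁ where
  infix  4 _≤_ _<_
  infixl 7 _/_
  field
    commutativeRing : CommutativeRing 0ℓ 0ℓ
  open CommutativeRing commutativeRing public hiding (zero)
  open RawMonoidDefs +-rawMonoid using () renaming (_×_ to _·ℕ_)
  open RawSemiringDefs (Semiring.rawSemiring semiring) public using (_^_)
  field
    _≤_             : Rel Carrier 0ℓ
    isDecTotalOrder : IsDecTotalOrder _≈_ _≤_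
    +-monoˡ-≤       : ∀ {x y} z → x ≤ y → x + z ≤ y + z
    *-nonNegative   : ∀ {x y} → 0# ≤ x → 0# ≤ y → 0# ≤ x * y
    0≉1             : 0# ≉ 1#
    -- Nothing is assumed about 0# ⁻¹, nor about √ x for x < 0#.
    _⁻¹             : Carrier → Carrier
    *-inverseʳ      : ∀ x → x ≉ 0# → x * x ⁻¹ ≈ 1#
    √               : Carrier → Carrier
    √-nonNegative   : ∀ x → 0# ≤ x → 0# ≤ √ x
    √-square        : ∀ x → 0# ≤ x → √ x * √ x ≈ x
    archimedean     : ∀ x → ∃[ n ] x ≤ n ·ℕ 1#
  fromℕ : ℕ → Carrier
  fromℕ n = n ·ℕ 1#
  _<_ : Rel Carrier 0ℓ
  x < y = x ≤ y × x ≉ y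
  _/_ : Carrier → Carrier → Carrier
  x / y = x * y ⁻¹

IsGreatest : ∀ {a p ℓ} {A : Set a} → Rel A ℓ → Pred A p → Pred A _
IsGreatest _≼_ P x = P x × (∀ y → P y → y ≼ x)

record Matroid (m : ℕ) : Set₁ where
  field
    Indep      : Subset m → Set
    indep?     : Decidable Indep
    ⊥-indep    : Indep ⊥
    hereditary : ∀ {X Y} → X ⊆ Y → Indep Y → Indep X
    augment    : ∀ {X Y} → Indep X → Indep Y → ∣ X ∣ ℕ.< ∣ Y ∣ →
                 ∃[ e ] e ∈ Y × e ∉ X × Indep (X ∪ ⁅ e ⁆)

  IsRank : Pred ℕ _
  IsRank = IsGreatest ℕ._≤_ (λ r → ∃[ X ] Indep X × ∣ X ∣ ≡ r)

-- Parallel edges are allowed.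
record Problem (k : ℕ) : Set₁ where
  field
    n m      : ℕ
    vertices : Fin m → Subset n
    uniform  : ∀ e → ∣ vertices e ∣ ≡ k
    capacity : Fin n → ℕ
    matroid  : Matroid m
  open Matroid matroid public

  incident : Fin n → Subset m
  incident v = Vec.tabulate (λ e → Vec.lookup (vertices e) v)

  IsBMatching : Pred (Subset m) _
  IsBMatching M = ∀ v → ∣ M ∩ incident v ∣ ℕ.≤ capacity v

  IsMaximumBMatching : Pred (Subset m) _
  IsMaximumBMatching = IsGreatest (λ X Y → ∣ X ∣ ℕ.≤ ∣ Y ∣) IsBMatching

  Feasible : Pred (Subset m) _
  Feasible M = IsBMatching M × Indep M

image : ∀ {s m} → (Fin s → Fin m) → Subset s → Subset m
image g []            = ⊥
image g (inside  ∷ X) = ⁅ g zero ⁆ ∪ image (g ∘ suc) X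
image g (outside ∷ X) = image (g ∘ suc) X

data Mode : Set where
  deterministic randomized : Mode

module Streaming (R : EuclideanField) where
  open EuclideanField R

  -- ⌈ log_β x ⌉, truncated below at 0.
  IsCeilLog : Carrier → Carrier → Pred ℕ _
  IsCeilLog β x L = x ≤ β ^ L × (∀ j → x ≤ β ^ j → L ℕ.≤ j)

  linear : ∀ {m} → (Fin m → Carrier) → Subset m → Carrier
  linear w []            = 0#
  linear w (inside  ∷ X) = w zero + linear (w ∘ suc) X
  linear w (outside ∷ X) = linear (w ∘ suc) X

  module _ {m : ℕ} where

    marginal : (Subset m → Carrier) → Fin m → Subset m → Carrier
    marginal f e X = f (X ∪ ⁅ e ⁆) - f X

    NonNegative : (Subset m → Carrier) → Set
    NonNegative f = ∀ X → 0# ≤ f X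

    Submodular : (Subset m → Carrier) → Set
    Submodular f = ∀ {X Y} → X ⊆ Y → ∀ {e} → e ∉ Y →
                   marginal f e Y ≤ marginal f e X

    Monotone : (Subset m → Carrier) → Set
    Monotone f = ∀ {X Y} → X ⊆ Y → f X ≤ f Y

    IsMaxWeightRatio : (Fin m → Carrier) → Pred Carrier _
    IsMaxWeightRatio w = IsGreatest _≤_ λ q →
      ∃[ e ] ∃[ e′ ] w e ≉ 0# × w e′ ≉ 0# × q ≈ w e / w e′

    IsMaxMarginalRatio : (Subset m → Carrier) → Pred Carrier _
    IsMaxMarginalRatio f = IsGreatest _≤_ λ q →
      ∃[ X ] ∃[ Y ] ∃[ e ] ∃[ e′ ]
        X ⊆ Y × 0# < marginal f e′ X × q ≈ marginal f e Y / marginal f e′ X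

  -- Finite probability trees: flip p goes left with probability p.
  data Outcome {a} (A : Set a) : Mode → Set a where
    pure : ∀ {μ} → A → Outcome A μ
    flip : ∀ (p : Carrier) → 0# ≤ p → p ≤ 1# →
           Outcome A randomized → Outcome A randomized → Outcome A randomized

  module _ {a} {A : Set a} where

    infixl 1 _>>=_
    _>>=_ : ∀ {μ b} {B : Set b} → Outcome A μ → (A → Outcome B μ) → Outcome B μ
    pure x             >>= k = k x
    flip p 0≤p p≤1 s t >>= k = flip p 0≤p p≤1 (s >>= k) (t >>= k)

    𝔼 : ∀ {μ} → (A → Carrier) → Outcome A μ → Carrier
    𝔼 f (pure x)         = f x
    𝔼 f (flip p _ _ s t) = p * 𝔼 f s + (1# - p) * 𝔼 f t

    Always : ∀ {μ p} → Pred A p → Outcome A μ → Set p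
    Always P (pure x)         = P x
    Always P (flip _ _ _ s t) = Always P s × Always P t

  -- All that an algorithm can see of the instance: s edges, known only by
  -- their positions Fin s, and the two oracles restricted to sets of them.
  -- An edge that has been dropped can be neither queried nor recovered.
  record View (n s : ℕ) : Set where
    field
      vertices : Fin s → Subset n
      capacity : ∀ i {v} → v ∈ vertices i → ℕ
      value    : Subset s → Carrier
      indep    : Subset s → Bool

  -- The variables of an algorithm are the stored edges and a list of real
  -- registers; both are initially empty.  On an arrival, step sees the new
  -- edge at position zero, followed by the stored ones, and selects by
  -- position the edges to be stored next.  The answer is selected from the
  -- edges stored at the end of the stream.
  record Algorithm (μ : Mode) : Set where
    field
      step   : ∀ {n s} → View n (suc s) → List Carrier →
               Outcome (List (Fin (suc s)) × List Carrier) μ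
      output : ∀ {n s} → View n s → List Carrier → Outcome (Subset s) μ

  record Memory (m : ℕ) : Set where
    constructor memory
    field
      edges     : List (Fin m)
      registers : List Carrier

  size : ∀ {m} → Memory m → ℕ
  size (memory es rs) = List.length es ℕ.+ List.length rs

  module Execution {μ} (A : Algorithm μ) {k} (P : Problem k)
                   (f : Subset (Problem.m P) → Carrier) where
    open Problem P

    view : ∀ {s} → (Fin s → Fin m) → View n s
    view g = record
      { vertices = vertices ∘ g
      ; capacity = λ _ {v} _ → capacity v
      ; value    = f ∘ image g
      ; indep    = λ X → does (indep? (image g X))
      }

    process : Memory m → Fin m → Outcome (Memory m) μ
    process (memory es rs) e =
      Algorithm.step A (view (List.lookup (e ∷ es))) rs >>= λ (is , rs′) →
      pure (memory (List.map (List.lookup (e ∷ es)) is) rs′)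

    runFrom : Memory m → List (Fin m) → Outcome (Memory m) μ
    runFrom c []       = pure c
    runFrom c (e ∷ es) = process c e >>= λ c′ → runFrom c′ es

    run : List (Fin m) → Outcome (Memory m) μ
    run = runFrom (memory [] [])

    answer : Memory m → Outcome (Subset m) μ
    answer (memory es rs) =
      Algorithm.output A (view (List.lookup es)) rs >>= λ X →
      pure (image (List.lookup es) X)

    solve : List (Fin m) → Outcome (Subset m) μ
    solve stream = run stream >>= answer

  module _ {k} (P : Problem k) where
    open Problem P
    open import Data.List.Relation.Binary.Permutation.Propositional using (_↭_)

    IsOptimal : (Subset m → Carrier) → Pred (Subset m) _
    IsOptimal f = IsGreatest (λ X Y → f X ≤ f Y) Feasible

    -- The stream lists every edge exactly once, in arbitrary order.
    Approximates : ∀ {μ} → Algorithm μ → (Subset m → Carrier) → Carrier → Set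
    Approximates A f α =
      ∀ stream → stream ↭ List.allFin m →
      Always Feasible (solve stream) ×
      (∀ Mopt → IsOptimal f Mopt → f Mopt ≤ α * 𝔼 f (solve stream))
      where open Execution A P f

    UsesAtMost : ∀ {μ} → Algorithm μ → (Subset m → Carrier) → ℕ → Set
    UsesAtMost A f N =
      ∀ stream → stream ↭ List.allFin m →
      ∀ t → Always (λ c → size c ℕ.≤ N) (run (List.take t stream))
      where open Execution A P f

    -- At most C · log_{1+ε}(W/ε) · min {|M_max|, r} variables, where W is
    -- specified by IsW.  The logarithm is rounded up, and replaced by 1 when
    -- it is smaller than 1 (for large ε it can be zero or negative).
    MemoryBound : ∀ {μ} → Algorithm μ → (Subset m → Carrier) →
                  Pred Carrier 0ℓ → Carrier → ℕ → Set
    MemoryBound A f IsW ε C =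
      ∀ {W L Mmax r} → IsW W → IsCeilLog (1# + ε) (W / ε) L →
      IsMaximumBMatching Mmax → IsRank r →
      UsesAtMost A f (C ℕ.* (1 ℕ.⊔ L) ℕ.* (∣ Mmax ∣ ℕ.⊓ r))

module Submission where

-- A local-ratio algorithm with k + 1 matroids per edge: the given one, and for
-- each vertex of the edge a uniform matroid on the edges at that vertex.  The
-- memory holds a stack S of accepted edges, from which everything else is
-- recomputed.  When e arrives, each of its matroids i charges star i e, the
-- largest t such that the stacked edges of i-weight at least t span e; e is
-- accepted when f (e | S) exceeds α times the sum of its stars (in the
-- non-monotone case with probability q only).  It then has gain
-- g (e) = f (e | S) − Σ star i e and i-weight star i e + g (e).
--
-- At every level t the rank of the stacked edges of i-weight at least t grows
-- exactly when star i e < t ≤ weight i e.  Integrating such counts over t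
-- turns rank inequalities into inequalities between sums of weights.  In this
-- way an optimal solution is charged to (k + 1) Σ g, and a solution worth Σ g
-- is found in the stack by scanning it backwards: an edge is rejected when
-- some matroid i has it spanned by the edges taken so far together with the
-- older edges of at least its weight, and the gains of the edges rejected by i
-- are paid for by the i-stars of those taken.  The output is the best feasible
-- subset of the stack.

open import Defs
open import Level using (0ℓ)
open import Algebra.Solver.Ring.AlmostCommutativeRing
  using (fromCommutativeRing; _-Raw-AlmostCommutative⟶_)
import Algebra.Solver.Ring
import Algebra.Properties.Ring
import Algebra.Properties.Semiring.Mult.TCOptimised
open import Data.Bool using (Bool; true; false; if_then_else_; _∧_; _∨_; not)
open import Data.Bool.ListAction using (all; and)
import Data.Bool.Properties as Boolₚ
open import Data.Empty using (⊥-elim)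
open import Data.Fin using (Fin; zero; suc)
import Data.Fin.Properties as Finₚ
open import Data.Fin.Subset using (Subset; inside; outside; ⊥; ⁅_⁆; _∪_; _∩_; _∈_; _∉_; _⊆_; ∣_∣)
import Data.Fin.Subset.Properties as Subsetₚ
open import Data.Integer as ℤ using (ℤ; +_; -[1+_]; _⊖_)
import Data.Integer.Properties as ℤₚ
open import Data.List using (List; []; _∷_; _++_; map; filter; length; allFin; tabulate; lookup; concatMap)
open import Data.List.Membership.Propositional using (find; lose) renaming (_∈_ to _∈ˡ_; _∉_ to _∉ˡ_)
import Data.List.Membership.Propositional.Properties as ∈ₚ
import Data.List.Membership.DecPropositional
import Data.List.Properties as Listₚ
open import Data.List.Relation.Binary.Permutation.Propositional using (_↭_; ↭-sym; ↭-refl; ↭-trans; prep; swap; ↭⇒↭ₛ)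
import Data.List.Relation.Binary.Permutation.Propositional.Properties as ↭ₚ
import Data.List.Relation.Binary.Permutation.Setoid.Properties
open import Data.List.Relation.Binary.Subset.Propositional using () renaming (_⊆_ to _⊆ˡ_)
import Data.List.Relation.Binary.Subset.Propositional.Properties as ⊆ₚ
open import Data.List.Relation.Unary.All as All using (All; []; _∷_)
import Data.List.Relation.Unary.All.Properties as Allₚ
open import Data.List.Relation.Unary.AllPairs using ([]; _∷_)
open import Data.List.Relation.Unary.Any using (here; there)
open import Data.List.Relation.Unary.Unique.Propositional using (Unique)
import Data.List.Relation.Unary.Unique.Propositional.Properties as Uniqueₚ
open import Data.Maybe using (Maybe; just; nothing)
open import Data.Nat as ℕ using (ℕ; zero; suc)
import Data.Nat.Properties as ℕₚ
open import Data.Nat.ListAction using (sum)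
open import Data.Nat.Solver using (module +-*-Solver)
open import Data.Product using (Σ-syntax; ∃-syntax; _×_; _,_; proj₁; proj₂)
open import Data.Sum using (_⊎_; inj₁; inj₂)
open import Data.Vec as Vec using (Vec; []; _∷_)
import Data.Vec.Properties as Vecₚ
open import Function using (_∘_; id; case_of_)
open import Relation.Binary.Bundles using (Poset)
import Relation.Binary.Reasoning.PartialOrder
open import Relation.Binary.PropositionalEquality as ≡ using (_≡_; _≢_; refl; cong; cong₂; subst)
open import Relation.Binary.Structures using (IsDecTotalOrder)
open import Relation.Nullary using (¬_; Dec; yes; no; does)
open import Relation.Nullary.Decidable using (_×-dec_; ¬?; dec-true; dec-false; decidable-stable)

-- Two costs compete in `α = 1 + a`. Let G be the total gain and D = k + 1. An optimum O adds at
-- most `α * D * G` to the stack S, since a rejected edge has increment at most α times its stars.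
-- The stack itself is worth at most f(∅) + (α / a) G, since the threshold leaves at least the share
-- a / α of each increment as gain. For linear f only the first cost arises, so a may be small; for
-- submodular f the sum (1 + a)(1 + a D) / a is minimised over a. Without monotonicity f(O ∪ S) may
-- fall below f(O). Keeping accepted edges with probability q preserves the share 1 - q of f(O) in
-- expectation, but optimal edges refused by the coin must then be paid for as well.
--
-- Memory is bounded by splitting the stacked edges active for a constraint into chains along which
-- the weight grows by a factor α. Each chain ends in a different element of a heaviest basis, so
-- the rank bounds their number, and W bounds their length. A maximum b-matching enters through its
-- saturated vertices, which meet every edge outside it.

module OrderedField (R : EuclideanField) where
  open EuclideanField R public
    renaming (refl to ≈-refl; sym to ≈-sym; trans to ≈-trans)
  open IsDecTotalOrder isDecTotalOrder public
    using (total; antisym; _≤?_; _≟_)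
    renaming (refl to ≤-refl; reflexive to ≤-reflexive; trans to ≤-trans)
  open Algebra.Properties.Ring ring using (-‿distribˡ-*; -‿distribʳ-*; -‿+-comm; -0#≈0#; -‿involutive)
  open Algebra.Properties.Semiring.Mult.TCOptimised semiring
    using (×-homo-+; ×1-homo-*; 1+×) renaming (_×_ to _·_)

  poset : Poset 0ℓ 0ℓ 0ℓ
  poset = record { isPartialOrder = IsDecTotalOrder.isPartialOrder isDecTotalOrder }

  module ≤-Reasoning = Relation.Binary.Reasoning.PartialOrder poset

  private
    ⟦_⟧ : ℤ → Carrier
    ⟦ + n ⟧      = n · 1#
    ⟦ -[1+ n ] ⟧ = - (suc n · 1#)

    cancel : ∀ a x y → x - y ≈ (a + x) - (a + y)
    cancel a x y = begin-equality
      x - y                     ≈⟨ +-cong (+-identityʳ x) ≈-refl ⟨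
      x + 0# - y                ≈⟨ +-cong (+-cong ≈-refl (-‿inverseʳ a)) ≈-refl ⟨
      x + (a - a) - y           ≈⟨ +-cong (+-assoc _ _ _) ≈-refl ⟨
      x + a - a - y             ≈⟨ +-cong (+-cong (+-comm x a) ≈-refl) ≈-refl ⟩
      a + x - a - y             ≈⟨ +-assoc _ _ _ ⟩
      a + x + (- a - y)         ≈⟨ +-cong ≈-refl (-‿+-comm a y) ⟩
      (a + x) - (a + y)         ∎
      where open ≤-Reasoning

    ⊖-homo : ∀ m n → ⟦ m ⊖ n ⟧ ≈ m · 1# - n · 1#
    ⊖-homo m zero = ≈-sym (≈-trans (+-cong ≈-refl -0#≈0#) (+-identityʳ _))
    ⊖-homo zero (suc n) = ≈-sym (+-identityˡ _)
    ⊖-homo (suc m) (suc n) = ≈-trans (reflexive (cong ⟦_⟧ (ℤₚ.[1+m]⊖[1+n]≡m⊖n m n)))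
      (≈-trans (⊖-homo m n) (≈-trans (cancel 1# _ _)
        (≈-sym (+-cong (1+× m 1#) (-‿cong (1+× n 1#))))))

    ⟦⟧-+ : ∀ i j → ⟦ i ℤ.+ j ⟧ ≈ ⟦ i ⟧ + ⟦ j ⟧
    ⟦⟧-+ (+ m) (+ n) = ×-homo-+ 1# m n
    ⟦⟧-+ (+ m) -[1+ n ] = ⊖-homo m (suc n)
    ⟦⟧-+ -[1+ m ] (+ n) = ≈-trans (⊖-homo n (suc m)) (+-comm _ _)
    ⟦⟧-+ -[1+ m ] -[1+ n ] = ≈-trans (-‿cong (≈-trans
        (reflexive (cong (λ k → suc k · 1#) (≡.sym (ℕₚ.+-suc m n))))
        (×-homo-+ 1# (suc m) (suc n)))) (≈-sym (-‿+-comm _ _))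

    ⟦⟧-neg : ∀ i → ⟦ ℤ.- i ⟧ ≈ - ⟦ i ⟧
    ⟦⟧-neg (+ zero) = ≈-sym -0#≈0#
    ⟦⟧-neg (+ suc n) = ≈-refl
    ⟦⟧-neg -[1+ n ] = ≈-sym (-‿involutive _)

    ⟦⟧-*⁺ : ∀ m j → ⟦ + m ℤ.* j ⟧ ≈ ⟦ + m ⟧ * ⟦ j ⟧
    ⟦⟧-*⁺ m (+ n) = ≈-trans (reflexive (cong ⟦_⟧ (≡.sym (ℤₚ.pos-* m n)))) (×1-homo-* m n)
    ⟦⟧-*⁺ m -[1+ n ] = ≈-trans (reflexive (cong ⟦_⟧ (≡.sym (ℤₚ.neg-distribʳ-* (+ m) (+ suc n)))))
      (≈-trans (⟦⟧-neg (+ m ℤ.* + suc n)) (≈-trans (-‿cong (⟦⟧-*⁺ m (+ suc n))) (-‿distribʳ-* _ _)))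

    ⟦⟧-* : ∀ i j → ⟦ i ℤ.* j ⟧ ≈ ⟦ i ⟧ * ⟦ j ⟧
    ⟦⟧-* (+ m) j = ⟦⟧-*⁺ m j
    ⟦⟧-* -[1+ m ] j = ≈-trans (reflexive (cong ⟦_⟧ (≡.sym (ℤₚ.neg-distribˡ-* (+ suc m) j))))
      (≈-trans (⟦⟧-neg (+ suc m ℤ.* j)) (≈-trans (-‿cong (⟦⟧-*⁺ (suc m) j)) (-‿distribˡ-* _ _)))

    ℤ-homomorphism : ℤ.+-*-rawRing -Raw-AlmostCommutative⟶ fromCommutativeRing commutativeRing
    ℤ-homomorphism = record
      { ⟦_⟧ = ⟦_⟧ ; +-homo = ⟦⟧-+ ; *-homo = ⟦⟧-* ; -‿homo = ⟦⟧-neg ; 0-homo = ≈-refl ; 1-homo = ≈-refl }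

    ≟-coefficient : ∀ i j → Maybe (⟦ i ⟧ ≈ ⟦ j ⟧)
    ≟-coefficient i j with i ℤₚ.≟ j
    ... | yes i≡j = just (reflexive (cong ⟦_⟧ i≡j))
    ... | no  _   = nothing

  open Algebra.Solver.Ring ℤ.+-*-rawRing (fromCommutativeRing commutativeRing) ℤ-homomorphism ≟-coefficient public
    using (solve; _:=_; con; _:+_; _:*_; _:-_; :-_)

  -- The usual route to an inequality below: `d` is a visibly nonnegative expression for the slack,
  -- and the ring solver checks the identity.
  ≤-by : ∀ {x y} d → 0# ≤ d → d ≈ y - x → x ≤ y
  ≤-by {x} {y} d 0≤d d≈y-x = begin
    x           ≈⟨ +-identityˡ x ⟨
    0# + x      ≤⟨ +-monoˡ-≤ x (≤-trans 0≤d (≤-reflexive d≈y-x)) ⟩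
    y - x + x   ≈⟨ solve 2 (λ x y → (y :- x) :+ x := y) ≈-refl x y ⟩
    y           ∎
    where open ≤-Reasoning

  ≤⇒0≤ : ∀ {x y} → x ≤ y → 0# ≤ y - x
  ≤⇒0≤ {x} {y} x≤y = ≤-trans (≤-reflexive (≈-sym (-‿inverseʳ x))) (+-monoˡ-≤ (- x) x≤y)

  x≤x+y : ∀ {x y} → 0# ≤ y → x ≤ x + y
  x≤x+y {x} {y} 0≤y = ≤-by y 0≤y (solve 2 (λ x y → y := (x :+ y) :- x) ≈-refl x y)

  x≤y+x : ∀ {x y} → 0# ≤ y → x ≤ y + x
  x≤y+x {x} {y} 0≤y = ≤-trans (x≤x+y 0≤y) (≤-reflexive (+-comm x y))

  +-mono-≤ : ∀ {x y u v} → x ≤ y → u ≤ v → x + u ≤ y + v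
  +-mono-≤ {x} {y} {u} {v} x≤y u≤v = begin
    x + u ≤⟨ +-monoˡ-≤ u x≤y ⟩
    y + u ≈⟨ +-comm y u ⟩
    u + y ≤⟨ +-monoˡ-≤ y u≤v ⟩
    v + y ≈⟨ +-comm v y ⟩
    y + v ∎
    where open ≤-Reasoning

  +-nonNegative : ∀ {x y} → 0# ≤ x → 0# ≤ y → 0# ≤ x + y
  +-nonNegative 0≤x 0≤y = ≤-trans (≤-reflexive (≈-sym (+-identityʳ 0#))) (+-mono-≤ 0≤x 0≤y)

  *-monoˡ-≤ : ∀ {z x y} → 0# ≤ z → x ≤ y → z * x ≤ z * y
  *-monoˡ-≤ {z} {x} {y} 0≤z x≤y = ≤-by (z * (y - x)) (*-nonNegative 0≤z (≤⇒0≤ x≤y))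
    (solve 3 (λ x y z → z :* (y :- x) := z :* y :- z :* x) ≈-refl x y z)

  *-mono-≤ : ∀ {x y u v} → 0# ≤ u → 0# ≤ y → x ≤ y → u ≤ v → x * u ≤ y * v
  *-mono-≤ {x} {y} {u} {v} 0≤u 0≤y x≤y u≤v = begin
    x * u ≈⟨ *-comm x u ⟩
    u * x ≤⟨ *-monoˡ-≤ 0≤u x≤y ⟩
    u * y ≈⟨ *-comm u y ⟩
    y * u ≤⟨ *-monoˡ-≤ 0≤y u≤v ⟩
    y * v ∎
    where open ≤-Reasoning

  ≰⇒≥ : ∀ {x y} → ¬ x ≤ y → y ≤ x
  ≰⇒≥ {x} {y} x≰y with total x y
  ... | inj₁ x≤y = ⊥-elim (x≰y x≤y)
  ... | inj₂ y≤x = y≤x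

  ≰⇒> : ∀ {x y} → ¬ x ≤ y → y < x
  ≰⇒> x≰y = ≰⇒≥ x≰y , λ y≈x → x≰y (≤-reflexive (≈-sym y≈x))

  <⇒≰ : ∀ {x y} → x < y → ¬ y ≤ x
  <⇒≰ (x≤y , x≉y) y≤x = x≉y (antisym x≤y y≤x)

  <-≤-trans : ∀ {x y z} → x < y → y ≤ z → x < z
  <-≤-trans x<y y≤z = ≤-trans (proj₁ x<y) y≤z , λ x≈z → <⇒≰ x<y (≤-trans y≤z (≤-reflexive (≈-sym x≈z)))

  0≤1 : 0# ≤ 1#
  0≤1 with total 0# 1#
  ... | inj₁ 0≤1 = 0≤1
  ... | inj₂ 1≤0 = ≤-trans (*-nonNegative 0≤-1 0≤-1)
      (≤-reflexive (solve 0 ((con (+ 0) :- con (+ 1)) :* (con (+ 0) :- con (+ 1)) := con (+ 1)) ≈-refl))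
    where 0≤-1 = ≤⇒0≤ 1≤0

  0<1 : 0# < 1#
  0<1 = 0≤1 , 0≉1

  x<x+1 : ∀ x → x < x + 1#
  x<x+1 x = x≤x+y 0≤1 ,
    λ eq → 0≉1 (≈-trans (≈-sym (-‿inverseʳ x)) (≈-trans (+-cong eq ≈-refl)
      (solve 1 (λ x → (x :+ con (+ 1)) :- x := con (+ 1)) ≈-refl x)))

  +-positive : ∀ {x y} → 0# < x → 0# ≤ y → 0# < x + y
  +-positive 0<x 0≤y = <-≤-trans 0<x (x≤x+y 0≤y)

  *-positive : ∀ {x y} → 0# < x → 0# < y → 0# < x * y
  *-positive {x} {y} (0≤x , 0≉x) (0≤y , 0≉y) = *-nonNegative 0≤x 0≤y , λ 0≈xy → 0≉y (begin-equality
      0#               ≈⟨ zeroʳ (x ⁻¹) ⟨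
      x ⁻¹ * 0#        ≈⟨ *-cong ≈-refl 0≈xy ⟩
      x ⁻¹ * (x * y)   ≈⟨ solve 3 (λ x y z → z :* (x :* y) := (x :* z) :* y) ≈-refl x y (x ⁻¹) ⟩
      x * x ⁻¹ * y     ≈⟨ *-cong (*-inverseʳ x (0≉x ∘ ≈-sym)) ≈-refl ⟩
      1# * y           ≈⟨ *-identityˡ y ⟩
      y                ∎)
    where open ≤-Reasoning

  ⁻¹-inverse : ∀ {x} → 0# < x → x * x ⁻¹ ≈ 1#
  ⁻¹-inverse {x} (_ , 0≉x) = *-inverseʳ x (0≉x ∘ ≈-sym)

  ⁻¹-positive : ∀ {x} → 0# < x → 0# < x ⁻¹
  ⁻¹-positive {x} 0<x = ≰⇒> λ x⁻¹≤0 → <⇒≰ 0<1 (begin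
      1#       ≈⟨ ⁻¹-inverse 0<x ⟨
      x * x ⁻¹ ≤⟨ *-monoˡ-≤ (proj₁ 0<x) x⁻¹≤0 ⟩
      x * 0#   ≈⟨ zeroʳ x ⟩
      0#       ∎)
    where open ≤-Reasoning

  *-cancelˡ-≤ : ∀ {z x y} → 0# < z → z * x ≤ z * y → x ≤ y
  *-cancelˡ-≤ {z} {x} {y} 0<z zx≤zy = begin
    x              ≈⟨ cancelled x ⟨
    z ⁻¹ * (z * x) ≤⟨ *-monoˡ-≤ (proj₁ (⁻¹-positive 0<z)) zx≤zy ⟩
    z ⁻¹ * (z * y) ≈⟨ cancelled y ⟩
    y              ∎
    where
    open ≤-Reasoning
    cancelled : ∀ x → z ⁻¹ * (z * x) ≈ x
    cancelled x = begin-equality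
      z ⁻¹ * (z * x)  ≈⟨ solve 3 (λ x z i → i :* (z :* x) := (z :* i) :* x) ≈-refl x z (z ⁻¹) ⟩
      z * z ⁻¹ * x    ≈⟨ *-cong (⁻¹-inverse 0<z) ≈-refl ⟩
      1# * x          ≈⟨ *-identityˡ x ⟩
      x               ∎

  -- Finite sums, counts above a threshold, and the layer-cake comparison.

  ∑ : ∀ {a} {A : Set a} → List A → (A → Carrier) → Carrier
  ∑ []       f = 0#
  ∑ (x ∷ xs) f = f x + ∑ xs f

  module _ {a} {A : Set a} where

    ∑-cong : ∀ (xs : List A) {f g} → (∀ x → f x ≈ g x) → ∑ xs f ≈ ∑ xs g
    ∑-cong []       f≈g = ≈-refl
    ∑-cong (x ∷ xs) f≈g = +-cong (f≈g x) (∑-cong xs f≈g)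

    ∑-mono : ∀ (xs : List A) {f g} → (∀ x → f x ≤ g x) → ∑ xs f ≤ ∑ xs g
    ∑-mono []       f≤g = ≤-refl
    ∑-mono (x ∷ xs) f≤g = +-mono-≤ (f≤g x) (∑-mono xs f≤g)

    ∑-nonNegative : ∀ (xs : List A) {f} → (∀ {x} → x ∈ˡ xs → 0# ≤ f x) → 0# ≤ ∑ xs f
    ∑-nonNegative []       0≤f = ≤-refl
    ∑-nonNegative (x ∷ xs) 0≤f = +-nonNegative (0≤f (here refl)) (∑-nonNegative xs (0≤f ∘ there))

    ∑-+ : ∀ (xs : List A) f g → ∑ xs (λ x → f x + g x) ≈ ∑ xs f + ∑ xs g
    ∑-+ []       f g = ≈-sym (+-identityˡ 0#)
    ∑-+ (x ∷ xs) f g = ≈-trans (+-cong ≈-refl (∑-+ xs f g))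
      (solve 4 (λ a b c d → (a :+ b) :+ (c :+ d) := (a :+ c) :+ (b :+ d)) ≈-refl (f x) (g x) (∑ xs f) (∑ xs g))

    ∑-0 : ∀ (xs : List A) → ∑ xs (λ _ → 0#) ≈ 0#
    ∑-0 []       = ≈-refl
    ∑-0 (x ∷ xs) = ≈-trans (+-identityˡ _) (∑-0 xs)

    ∑-* : ∀ (xs : List A) c f → ∑ xs (λ x → c * f x) ≈ c * ∑ xs f
    ∑-* []       c f = ≈-sym (zeroʳ c)
    ∑-* (x ∷ xs) c f = ≈-trans (+-cong ≈-refl (∑-* xs c f)) (≈-sym (distribˡ c _ _))

    ∑-++ : ∀ (xs ys : List A) f → ∑ (xs ++ ys) f ≈ ∑ xs f + ∑ ys f
    ∑-++ []       ys f = ≈-sym (+-identityˡ _)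
    ∑-++ (x ∷ xs) ys f = ≈-trans (+-cong ≈-refl (∑-++ xs ys f)) (≈-sym (+-assoc _ _ _))

    term≤∑ : ∀ {xs : List A} {f x} → (∀ x → 0# ≤ f x) → x ∈ˡ xs → f x ≤ ∑ xs f
    term≤∑ {y ∷ xs} 0≤f (here refl)  = x≤x+y (∑-nonNegative xs (λ {x} _ → 0≤f x))
    term≤∑ {y ∷ xs} 0≤f (there x∈xs) = ≤-trans (term≤∑ 0≤f x∈xs) (x≤y+x (0≤f y))

    ∑-map : ∀ {b} {B : Set b} (g : B → A) xs (f : A → Carrier) → ∑ (map g xs) f ≈ ∑ xs (f ∘ g)
    ∑-map g []       f = ≈-refl
    ∑-map g (x ∷ xs) f = +-cong ≈-refl (∑-map g xs f)

    ∑-comm : ∀ {b} {B : Set b} (xs : List A) (ys : List B) (f : A → B → Carrier) →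
             ∑ xs (λ x → ∑ ys (f x)) ≈ ∑ ys (λ y → ∑ xs (λ x → f x y))
    ∑-comm []       ys f = ≈-sym (lemma ys)
      where
      lemma : ∀ {b} {B : Set b} (ys : List B) → ∑ ys (λ _ → 0#) ≈ 0#
      lemma []       = ≈-refl
      lemma (_ ∷ ys) = ≈-trans (+-identityˡ _) (lemma ys)
    ∑-comm (x ∷ xs) ys f = ≈-trans (+-cong ≈-refl (∑-comm xs ys f)) (≈-sym (lemma ys))
      where
      lemma : ∀ ys → ∑ ys (λ y → f x y + ∑ xs (λ x → f x y)) ≈ ∑ ys (f x) + ∑ ys (λ y → ∑ xs (λ x → f x y))
      lemma []       = ≈-sym (+-identityˡ 0#)
      lemma (y ∷ ys) = ≈-trans (+-cong ≈-refl (lemma ys))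
        (solve 4 (λ a b c d → (a :+ b) :+ (c :+ d) := (a :+ c) :+ (b :+ d)) ≈-refl _ _ _ _)

  ∑-↭ : ∀ {a} {A : Set a} {xs ys : List A} f → xs ↭ ys → ∑ xs f ≈ ∑ ys f
  ∑-↭ f _↭_.refl = ≈-refl
  ∑-↭ f (prep x p) = +-cong ≈-refl (∑-↭ f p)
  ∑-↭ f (swap x y p) = ≈-trans (+-cong ≈-refl (+-cong ≈-refl (∑-↭ f p)))
    (solve 3 (λ a b c → a :+ (b :+ c) := b :+ (a :+ c)) ≈-refl _ _ _)
  ∑-↭ f (_↭_.trans p q) = ≈-trans (∑-↭ f p) (∑-↭ f q)

  indicator : Carrier → Carrier → ℕ
  indicator t x = if does (t ≤? x) then 1 else 0

  indicator-yes : ∀ {t x} → t ≤ x → indicator t x ≡ 1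
  indicator-yes {t} {x} t≤x rewrite dec-true (t ≤? x) t≤x = refl

  indicator-no : ∀ {t x} → ¬ t ≤ x → indicator t x ≡ 0
  indicator-no {t} {x} t≰x rewrite dec-false (t ≤? x) t≰x = refl

  tally : ∀ {a} {A : Set a} → Carrier → List A → (A → Carrier) → ℕ
  tally t []       f = 0
  tally t (x ∷ xs) f = indicator t (f x) ℕ.+ tally t xs f

  module _ {a} {A : Set a} where

    tally-↭ : ∀ t (f : A → Carrier) {xs ys} → xs ↭ ys → tally t xs f ≡ tally t ys f
    tally-↭ t f _↭_.refl = refl
    tally-↭ t f (prep x p) = cong (_ ℕ.+_) (tally-↭ t f p)
    tally-↭ t f {_} {_ ∷ _ ∷ ws} (swap x y p) rewrite tally-↭ t f p = begin
      i ℕ.+ (j ℕ.+ n)   ≡⟨ ℕₚ.+-assoc i j n ⟨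
      i ℕ.+ j ℕ.+ n     ≡⟨ cong (ℕ._+ n) (ℕₚ.+-comm i j) ⟩
      j ℕ.+ i ℕ.+ n     ≡⟨ ℕₚ.+-assoc j i n ⟩
      j ℕ.+ (i ℕ.+ n)   ∎
      where
      open ≡.≡-Reasoning
      i = indicator t (f x)
      j = indicator t (f y)
      n = tally t ws f
    tally-↭ t f (_↭_.trans p q) = ≡.trans (tally-↭ t f p) (tally-↭ t f q)

    tally-++ : ∀ t xs ys (f : A → Carrier) → tally t (xs ++ ys) f ≡ tally t xs f ℕ.+ tally t ys f
    tally-++ t []       ys f = refl
    tally-++ t (x ∷ xs) ys f = ≡.trans (cong (indicator t (f x) ℕ.+_) (tally-++ t xs ys f))
      (≡.sym (ℕₚ.+-assoc (indicator t (f x)) _ _))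

    tally-map : ∀ {b} {B : Set b} t (g : B → A) xs (f : A → Carrier) → tally t (map g xs) f ≡ tally t xs (f ∘ g)
    tally-map t g []       f = refl
    tally-map t g (x ∷ xs) f = cong (indicator t (f (g x)) ℕ.+_) (tally-map t g xs f)

    tally-none : ∀ {t} {f : A → Carrier} xs → (∀ {x} → x ∈ˡ xs → ¬ t ≤ f x) → tally t xs f ≡ 0
    tally-none [] none = refl
    tally-none (x ∷ xs) none = cong₂ ℕ._+_ (indicator-no (none (here refl))) (tally-none xs (none ∘ there))

    tally-some : ∀ {t} {f : A → Carrier} xs → 1 ℕ.≤ tally t xs f →
                 ∃[ x ] ∃[ ys ] xs ↭ x ∷ ys × t ≤ f x
    tally-some {t} {f} (x ∷ xs) 1≤ with t ≤? f x
    ... | yes t≤fx = x , xs , ↭-refl , t≤fx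
    ... | no  t≰fx with tally-some xs 1≤
    ...   | y , ys , xs↭ , t≤fy = y , x ∷ ys , ↭-trans (prep x xs↭) (swap x y ↭-refl) , t≤fy

    extract-maximum : ∀ (f : A → Carrier) x xs →
      ∃[ z ] ∃[ zs ] x ∷ xs ↭ z ∷ zs × (∀ {y} → y ∈ˡ zs → f y ≤ f z)
    extract-maximum f x [] = x , [] , ↭-refl , λ ()
    extract-maximum f x (y ∷ xs) with extract-maximum f y xs
    ... | z , zs , p , zs≤z with f x ≤? f z
    ...   | yes x≤z = z , x ∷ zs , ↭-trans (prep x p) (swap x z ↭-refl) ,
                      λ { (here refl) → x≤z ; (there y∈) → zs≤z y∈ }
    ...   | no  x≰z = x , z ∷ zs , prep x p ,
                      λ { (here refl) → ≰⇒≥ x≰z ; (there y∈) → ≤-trans (zs≤z y∈) (≰⇒≥ x≰z) }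

  module _ {a b} {A : Set a} {B : Set b} {f : A → Carrier} {g : B → Carrier} where

    private
      -- Match a maximal x with any y such that f x ≤ g y and remove both.
      layer-cake′ : ∀ n xs ys → length xs ≡ n → (∀ {y} → y ∈ˡ ys → 0# ≤ g y) →
                    (∀ t → 0# < t → tally t xs f ℕ.≤ tally t ys g) → ∑ xs f ≤ ∑ ys g
      layer-cake′ n [] ys _ 0≤g dominated = ∑-nonNegative ys 0≤g
      layer-cake′ (suc n) (x ∷ xs) ys len 0≤g dominated with extract-maximum f x xs
      ... | z , zs , p , zs≤z with 0# ≤? f z | f z ≤? 0#
      ...   | _ | yes z≤0 = begin
        ∑ (x ∷ xs) f            ≈⟨ ∑-↭ f p ⟩
        f z + ∑ zs f            ≤⟨ +-mono-≤ z≤0 (nonPositive zs zs≤z) ⟩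
        0# + 0#                 ≈⟨ +-identityʳ 0# ⟩
        0#                      ≤⟨ ∑-nonNegative ys 0≤g ⟩
        ∑ ys g                  ∎
        where
        open ≤-Reasoning
        nonPositive : ∀ ws → (∀ {y} → y ∈ˡ ws → f y ≤ f z) → ∑ ws f ≤ 0#
        nonPositive [] _ = ≤-refl
        nonPositive (w ∷ ws) ws≤z = ≤-trans (+-mono-≤ (≤-trans (ws≤z (here refl)) z≤0) (nonPositive ws (ws≤z ∘ there)))
          (≤-reflexive (+-identityʳ 0#))
      ...   | no 0≰z | no z≰0 = ⊥-elim (z≰0 (≰⇒≥ 0≰z))
      -- At the level `f z` the left count is at least one, so domination supplies some `y` with
      -- `f z ≤ g y`.
      ...   | yes _ | no z≰0 with tally-some ys (ℕₚ.≤-trans 1≤tally (dominated (f z) (≰⇒> z≰0)))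
        where
        1≤tally : 1 ℕ.≤ tally (f z) (x ∷ xs) f
        1≤tally = subst (1 ℕ.≤_) (≡.sym (≡.trans (tally-↭ (f z) f p)
          (cong (ℕ._+ tally (f z) zs f) (indicator-yes ≤-refl)))) (ℕ.s≤s ℕ.z≤n)
      ...     | y , ys′ , q , z≤y = begin
        ∑ (x ∷ xs) f    ≈⟨ ∑-↭ f p ⟩
        f z + ∑ zs f    ≤⟨ +-mono-≤ z≤y (layer-cake′ n zs ys′ (ℕₚ.suc-injective (≡.trans (≡.sym (↭ₚ.↭-length p)) len))
                               (0≤g ∘ ↭ₚ.∈-resp-↭ (↭-sym q) ∘ there) dominated′) ⟩
        g y + ∑ ys′ g   ≈⟨ ∑-↭ g q ⟨
        ∑ ys g          ∎
        where
        open ≤-Reasoning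
        dominated′ : ∀ t → 0# < t → tally t zs f ℕ.≤ tally t ys′ g
        dominated′ t 0<t with t ≤? f z
        -- Above `f z` nothing remains on the left, by maximality of `z`; up to `f z` both counts
        -- have dropped by exactly one.
        ... | no  t≰z = subst (ℕ._≤ _) (≡.sym (tally-none zs (λ y∈ t≤y → t≰z (≤-trans t≤y (zs≤z y∈))))) ℕ.z≤n
        ... | yes t≤z = ℕₚ.+-cancelˡ-≤ 1 _ _ (≡.subst₂ ℕ._≤_
            (≡.trans (tally-↭ t f p) (cong (ℕ._+ tally t zs f) (indicator-yes t≤z)))
            (≡.trans (tally-↭ t g q) (cong (ℕ._+ tally t ys′ g) (indicator-yes (≤-trans t≤z z≤y))))
            (dominated t 0<t))

    -- A sum of nonnegative terms is the integral over `t > 0` of the number of terms that are at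
    -- least `t`. The matching argument stands in for that integral, so comparing counts at each
    -- level suffices.
    layer-cake : ∀ xs ys → (∀ {y} → y ∈ˡ ys → 0# ≤ g y) →
                 (∀ t → 0# < t → tally t xs f ℕ.≤ tally t ys g) → ∑ xs f ≤ ∑ ys g
    layer-cake xs ys = layer-cake′ (length xs) xs ys refl

-- Boolean tests, and duplicate-free lists as finite sets.

false≢true : ∀ {b} → b ≡ false → b ≡ true → ∀ {ℓ} {A : Set ℓ} → A
false≢true refl ()

∧-true : ∀ {b c} → b ∧ c ≡ true → b ≡ true × c ≡ true
∧-true {true} {true} refl = refl , refl

does-true : ∀ {A : Set} (d : Dec A) → does d ≡ true → A
does-true (yes x) _ = x

does-false : ∀ {A : Set} (d : Dec A) → does d ≡ false → ¬ A
does-false (no ¬x) _ = ¬x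

bool : ∀ b → b ≡ true ⊎ b ≡ false
bool true  = inj₁ refl
bool false = inj₂ refl

all-true : ∀ {A : Set} {g : A → Bool} xs → all g xs ≡ true → ∀ {x} → x ∈ˡ xs → g x ≡ true
all-true (x ∷ xs) eq (here refl) = proj₁ (∧-true eq)
all-true {g = g} (x ∷ xs) eq (there x∈) = all-true xs (proj₂ (∧-true {g x} eq)) x∈

all-true⁻ : ∀ {A : Set} {g : A → Bool} xs → (∀ {x} → x ∈ˡ xs → g x ≡ true) → all g xs ≡ true
all-true⁻ [] _ = refl
all-true⁻ (x ∷ xs) eq rewrite eq (here refl) = all-true⁻ xs (eq ∘ there)

implies : ∀ {b c} → not b ∨ c ≡ true → b ≡ true → c ≡ true
implies {true} eq refl = eq

implies⁻ : ∀ {b c} → (b ≡ true → c ≡ true) → not b ∨ c ≡ true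
implies⁻ {true}  h = h refl
implies⁻ {false} h = refl

not-true : ∀ {b} → not b ≡ true → b ≡ false
not-true {false} _ = refl

module _ {a} {A : Set a} where

  Unique-resp-↭ : {xs ys : List A} → xs ↭ ys → Unique xs → Unique ys
  Unique-resp-↭ xs↭ys =
    Data.List.Relation.Binary.Permutation.Setoid.Properties.Unique-resp-↭ (≡.setoid A) (↭⇒↭ₛ xs↭ys)

module _ {m : ℕ} where

  open Data.List.Membership.DecPropositional (Finₚ._≟_ {m}) public using () renaming (_∈?_ to _∈ˡ?_)

  fromList : List (Fin m) → Subset m
  fromList []       = ⊥
  fromList (x ∷ xs) = fromList xs ∪ ⁅ x ⁆

  ∈-fromList⁺ : ∀ {x xs} → x ∈ˡ xs → x ∈ fromList xs
  ∈-fromList⁺ (here refl)  = Subsetₚ.x∈p∪q⁺ (inj₂ (Subsetₚ.x∈⁅x⁆ _))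
  ∈-fromList⁺ (there x∈xs) = Subsetₚ.x∈p∪q⁺ (inj₁ (∈-fromList⁺ x∈xs))

  ∈-fromList⁻ : ∀ {x} xs → x ∈ fromList xs → x ∈ˡ xs
  ∈-fromList⁻ []       x∈ = ⊥-elim (Subsetₚ.∉⊥ x∈)
  ∈-fromList⁻ (y ∷ xs) x∈ with Subsetₚ.x∈p∪q⁻ (fromList xs) ⁅ y ⁆ x∈
  ... | inj₁ x∈xs = there (∈-fromList⁻ xs x∈xs)
  ... | inj₂ x∈y  = here (Subsetₚ.x∈⁅y⁆⇒x≡y y x∈y)

  fromList-⊆ : ∀ {xs ys} → xs ⊆ˡ ys → fromList xs ⊆ fromList ys
  fromList-⊆ {xs} xs⊆ys = ∈-fromList⁺ ∘ xs⊆ys ∘ ∈-fromList⁻ xs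

  fromList-≡ : ∀ {xs ys} → xs ⊆ˡ ys → ys ⊆ˡ xs → fromList xs ≡ fromList ys
  fromList-≡ xs⊆ys ys⊆xs = Subsetₚ.⊆-antisym (fromList-⊆ xs⊆ys) (fromList-⊆ ys⊆xs)

∣p∪⁅x⁆∣ : ∀ {m} {p : Subset m} {x} → x ∉ p → ∣ p ∪ ⁅ x ⁆ ∣ ≡ suc ∣ p ∣
∣p∪⁅x⁆∣ {p = inside  ∷ p} {zero}  x∉p = ⊥-elim (x∉p Vec.here)
∣p∪⁅x⁆∣ {p = outside ∷ p} {zero}  x∉p = cong (suc ∘ ∣_∣) (Subsetₚ.∪-identityʳ p)
∣p∪⁅x⁆∣ {p = inside  ∷ p} {suc x} x∉p = cong suc (∣p∪⁅x⁆∣ (x∉p ∘ Vec.there))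
∣p∪⁅x⁆∣ {p = outside ∷ p} {suc x} x∉p = ∣p∪⁅x⁆∣ (x∉p ∘ Vec.there)

module _ {m : ℕ} where

  ∣fromList∣ : ∀ {xs : List (Fin m)} → Unique xs → ∣ fromList xs ∣ ≡ length xs
  ∣fromList∣ [] = Subsetₚ.∣⊥∣≡0 m
  ∣fromList∣ {x ∷ xs} (x∉xs ∷ u) = ≡.trans
    (∣p∪⁅x⁆∣ (λ x∈ → All.lookup x∉xs (∈-fromList⁻ xs x∈) refl)) (cong suc (∣fromList∣ u))

  ∣fromList∣≤length : ∀ (xs : List (Fin m)) → ∣ fromList xs ∣ ℕ.≤ length xs
  ∣fromList∣≤length [] = ℕₚ.≤-reflexive (Subsetₚ.∣⊥∣≡0 m)
  ∣fromList∣≤length (x ∷ xs) with x ∈ˡ? xs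
  ... | yes x∈xs = ℕₚ.≤-trans (Subsetₚ.p⊆q⇒∣p∣≤∣q∣ (fromList-⊆ {xs = x ∷ xs} {xs} (λ { (here refl) → x∈xs ; (there y∈) → y∈ })))
                     (ℕₚ.m≤n⇒m≤1+n (∣fromList∣≤length xs))
  ... | no  x∉xs = ℕₚ.≤-trans (ℕₚ.≤-reflexive (∣p∪⁅x⁆∣ (x∉xs ∘ ∈-fromList⁻ xs)))
                     (ℕ.s≤s (∣fromList∣≤length xs))

  ⊆⇒length≤ : ∀ {xs ys : List (Fin m)} → Unique xs → xs ⊆ˡ ys → length xs ℕ.≤ length ys
  ⊆⇒length≤ {xs} {ys} u xs⊆ys = ℕₚ.≤-trans (ℕₚ.≤-reflexive (≡.sym (∣fromList∣ u)))
    (ℕₚ.≤-trans (Subsetₚ.p⊆q⇒∣p∣≤∣q∣ (fromList-⊆ {xs = xs} {ys} xs⊆ys)) (∣fromList∣≤length ys))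

  pigeonhole : ∀ {xs ys : List (Fin m)} → Unique ys → length xs ℕ.< length ys → ∃[ y ] y ∈ˡ ys × y ∉ˡ xs
  pigeonhole {xs} {ys} u xs<ys with All.all? (_∈ˡ? xs) ys
  ... | yes ys⊆xs = ⊥-elim (ℕₚ.<⇒≱ xs<ys (⊆⇒length≤ u (All.lookup ys⊆xs)))
  ... | no  ys⊈xs with find (Allₚ.¬All⇒Any¬ (_∈ˡ? xs) ys ys⊈xs)
  ...   | y , y∈ys , y∉xs = y , y∈ys , y∉xs

  unique? : ∀ (xs : List (Fin m)) → Dec (Unique xs)
  unique? [] = yes []
  unique? (x ∷ xs) with All.all? (λ y → ¬? (x Finₚ.≟ y)) xs | unique? xs
  ... | yes p | yes q = yes (p ∷ q)
  ... | no ¬p | _     = no λ { (p ∷ _) → ¬p p }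
  ... | _     | no ¬q = no λ { (_ ∷ q) → ¬q q }

-- Matroids on lists: greedy bases, span and rank.

-- Lists stand for sets: a list with a repeated entry counts as dependent.
record ListMatroid (m : ℕ) : Set₁ where
  field
    Ind        : List (Fin m) → Set
    ind?       : ∀ xs → Dec (Ind xs)
    []-ind     : Ind []
    ind⇒unique : ∀ {xs} → Ind xs → Unique xs
    hereditary : ∀ {xs ys} → Unique xs → xs ⊆ˡ ys → Ind ys → Ind xs
    augment    : ∀ {xs ys} → Ind xs → Ind ys → length xs ℕ.< length ys → ∃[ e ] e ∈ˡ ys × Ind (e ∷ xs)

  basis : List (Fin m) → List (Fin m)
  basis []       = []
  basis (x ∷ xs) = if does (ind? (x ∷ basis xs)) then x ∷ basis xs else basis xs

  Span : List (Fin m) → Fin m → Set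
  Span xs e = ¬ Ind (e ∷ basis xs)

  span? : ∀ xs e → Dec (Span xs e)
  span? xs e = ¬? (ind? (e ∷ basis xs))

  rank : List (Fin m) → ℕ
  rank = length ∘ basis

  rank-spanned : ∀ {xs x} → Span xs x → rank (x ∷ xs) ≡ rank xs
  rank-spanned {xs} {x} s rewrite dec-false (ind? (x ∷ basis xs)) s = refl

  rank-unspanned : ∀ {xs x} → ¬ Span xs x → rank (x ∷ xs) ≡ suc (rank xs)
  rank-unspanned {xs} {x} ¬s rewrite dec-true (ind? (x ∷ basis xs)) (decidable-stable (ind? _) ¬s) = refl

  basis-ind : ∀ xs → Ind (basis xs)
  basis-ind [] = []-ind
  basis-ind (x ∷ xs) with ind? (x ∷ basis xs)
  ... | yes p = p
  ... | no  _ = basis-ind xs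

  basis-⊆ : ∀ xs → basis xs ⊆ˡ xs
  basis-⊆ (x ∷ xs) y∈ with ind? (x ∷ basis xs)
  basis-⊆ (x ∷ xs) (here refl) | yes _ = here refl
  basis-⊆ (x ∷ xs) (there y∈)  | yes _ = there (basis-⊆ xs y∈)
  ... | no  _ = there (basis-⊆ xs y∈)

  ind-tail : ∀ {x xs} → Ind (x ∷ xs) → Ind xs
  ind-tail i with ind⇒unique i
  ... | _ ∷ u = hereditary u there i

  ∈⇒span : ∀ xs {x} → x ∈ˡ xs → Span xs x
  ∈⇒span (y ∷ xs) {x} x∈ with ind? (y ∷ basis xs)
  ∈⇒span (y ∷ xs) {x} (here refl) | yes _ = λ i → case ind⇒unique i of λ { ((x≢x ∷ _) ∷ _) → x≢x refl }
  ∈⇒span (y ∷ xs) {x} (there x∈)  | yes _ = λ i → ∈⇒span xs x∈ (case ind⇒unique i of λ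
    { ((_ ∷ x∉) ∷ (_ ∷ u)) → hereditary (x∉ ∷ u) (λ { (here e) → here e ; (there z) → there (there z) }) i })
  ∈⇒span (y ∷ xs) {x} (here refl) | no ¬i = ¬i
  ∈⇒span (y ∷ xs) {x} (there x∈)  | no _ = ∈⇒span xs x∈

  -- Were `ys` longer than the greedy basis, augmentation would extend that basis by an element of
  -- `ys`, which is spanned.
  spanned-ind : ∀ xs {ys} → Ind ys → (∀ {y} → y ∈ˡ ys → Span xs y) → length ys ℕ.≤ rank xs
  spanned-ind xs ind spanned = ℕₚ.≮⇒≥ λ r<n →
    let e , e∈ys , ind′ = augment (basis-ind xs) ind r<n in spanned e∈ys ind′

  rank-mono : ∀ xs ys → (∀ {x} → x ∈ˡ xs → Span ys x) → rank xs ℕ.≤ rank ys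
  rank-mono xs ys spanned = spanned-ind ys (basis-ind xs) (spanned ∘ basis-⊆ xs)

  rank-cong : ∀ xs ys → xs ⊆ˡ ys → ys ⊆ˡ xs → rank xs ≡ rank ys
  rank-cong xs ys xs⊆ys ys⊆xs =
    ℕₚ.≤-antisym (rank-mono xs ys (∈⇒span ys ∘ xs⊆ys)) (rank-mono ys xs (∈⇒span xs ∘ ys⊆xs))

  rank≤length : ∀ xs → rank xs ℕ.≤ length xs
  rank≤length [] = ℕ.z≤n
  rank≤length (x ∷ xs) with ind? (x ∷ basis xs)
  ... | yes _ = ℕ.s≤s (rank≤length xs)
  ... | no  _ = ℕₚ.m≤n⇒m≤1+n (rank≤length xs)

  private
    extend : ∀ d {xs ys} → Ind xs → Ind ys → length xs ℕ.+ d ≡ length ys →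
             ∃[ zs ] Ind zs × xs ⊆ˡ zs × (∀ {z} → z ∈ˡ zs → z ∈ˡ xs ⊎ z ∈ˡ ys) × length zs ≡ length ys
    extend zero {xs} i j eq = xs , i , id , inj₁ , ≡.trans (≡.sym (ℕₚ.+-identityʳ _)) eq
    extend (suc d) {xs} {ys} i j eq with augment i j (subst (length xs ℕ.<_) eq (ℕₚ.m<m+n _ (ℕ.s≤s ℕ.z≤n)))
    ... | e , e∈ys , i′ with extend d i′ j (≡.trans (≡.sym (ℕₚ.+-suc _ d)) eq)
    ...   | zs , k , xs⊆ , from , len = zs , k , xs⊆ ∘ there ,
            (λ z∈ → case from z∈ of λ
              { (inj₁ (here refl)) → inj₂ e∈ys ; (inj₁ (there z∈xs)) → inj₁ z∈xs ; (inj₂ z∈ys) → inj₂ z∈ys }) , len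

  -- Suppose `e ∷ basis ys` is independent, and extend `basis xs` inside it to an independent `zs`
  -- of the same size. If `e` is not in `zs`, then `ys` spans all of `zs`, which is too long. If it
  -- is, then either `e` lies in `basis xs` and is spanned by `ys`, or `e ∷ basis xs` is
  -- independent; both are contradictory.
  span-trans : ∀ xs ys {e} → (∀ {x} → x ∈ˡ xs → Span ys x) → Span xs e → Span ys e
  span-trans xs ys {e} xs⊆ e∈xs ind
    with extend (length (e ∷ basis ys) ℕ.∸ rank xs) (basis-ind xs) ind
           (ℕₚ.m+[n∸m]≡n (ℕₚ.m≤n⇒m≤1+n (rank-mono xs ys xs⊆)))
  ... | zs , k , ⊆zs , from , len with e ∈ˡ? zs
  ...   | no e∉zs = ℕₚ.<-irrefl refl (subst (ℕ._≤ rank ys) len (spanned-ind ys k λ z∈ → case from z∈ of λ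
            { (inj₁ z∈xs) → xs⊆ (basis-⊆ xs z∈xs)
            ; (inj₂ (here refl)) → ⊥-elim (e∉zs z∈)
            ; (inj₂ (there z∈ys)) → ∈⇒span ys (basis-⊆ ys z∈ys) }))
  ...   | yes e∈zs with e ∈ˡ? basis xs
  ...     | yes e∈ = xs⊆ (basis-⊆ xs e∈) ind
  ...     | no  e∉ = e∈xs (hereditary (All.tabulate (λ x∈ e≡x → e∉ (subst (_∈ˡ basis xs) (≡.sym e≡x) x∈)) ∷ ind⇒unique (basis-ind xs))
                       (λ { (here refl) → e∈zs ; (there x∈) → ⊆zs x∈ }) k)

  span-mono : ∀ xs ys {e} → xs ⊆ˡ ys → Span xs e → Span ys e
  span-mono xs ys xs⊆ys = span-trans xs ys (∈⇒span ys ∘ xs⊆ys)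

  -- Otherwise `e ∷ basis xs` would be an independent list spanned by `ys` and longer than the rank
  -- of `ys`.
  equal-rank : ∀ xs ys {e} → xs ⊆ˡ ys → rank ys ℕ.≤ rank xs → Span ys e → Span xs e
  equal-rank xs ys xs⊆ys r≤ e∈ys ind = ℕₚ.<-irrefl refl (ℕₚ.≤-trans (spanned-ind ys ind λ
    { (here refl) → e∈ys ; (there z∈) → ∈⇒span ys (xs⊆ys (basis-⊆ xs z∈)) }) r≤)

  basis-of-ind : ∀ {xs} → Ind xs → basis xs ≡ xs
  basis-of-ind {[]} _ = refl
  basis-of-ind {x ∷ xs} i with basis-of-ind (ind-tail i)
  ... | eq rewrite eq | dec-true (ind? (x ∷ xs)) i = refl

  unspanned⇒ind : ∀ xs ys {e} → Ind xs → xs ⊆ˡ ys → ¬ Span ys e → Ind (e ∷ xs)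
  unspanned⇒ind xs ys {e} i xs⊆ys ¬s = decidable-stable (ind? _)
    λ ¬i → ¬s (span-mono xs ys xs⊆ys (λ i′ → ¬i (subst (Ind ∘ (e ∷_)) (basis-of-ind i) i′)))

  ind-↭ : ∀ {xs ys} → xs ↭ ys → Ind xs → Ind ys
  ind-↭ xs↭ys i = hereditary (Unique-resp-↭ xs↭ys (ind⇒unique i)) (↭ₚ.∈-resp-↭ (↭-sym xs↭ys)) i

uniform : ∀ m → ℕ → ListMatroid m
uniform m b = record
  { Ind        = λ xs → Unique xs × length xs ℕ.≤ b
  ; ind?       = λ xs → unique? xs ×-dec (length xs ℕ.≤? b)
  ; []-ind     = [] , ℕ.z≤n
  ; ind⇒unique = proj₁
  ; hereditary = λ u xs⊆ys (_ , ys≤b) → u , ℕₚ.≤-trans (⊆⇒length≤ u xs⊆ys) ys≤b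
  ; augment    = λ (u , _) (v , ys≤b) xs<ys → let e , e∈ys , e∉xs = pigeonhole v xs<ys in
      e , e∈ys , (All.tabulate (λ x∈ e≡x → e∉xs (subst (_∈ˡ _) (≡.sym e≡x) x∈)) ∷ u) , ℕₚ.≤-trans xs<ys ys≤b
  }

asListMatroid : ∀ {m} → Matroid m → ListMatroid m
asListMatroid M = record
  { Ind        = λ xs → Unique xs × Indep (fromList xs)
  ; ind?       = λ xs → unique? xs ×-dec indep? (fromList xs)
  ; []-ind     = [] , ⊥-indep
  ; ind⇒unique = proj₁
  ; hereditary = λ u xs⊆ys (_ , i) → u , Matroid.hereditary M (fromList-⊆ xs⊆ys) i
  ; augment    = λ {xs} {ys} (u , i) (v , j) xs<ys →
      let e , e∈ys , e∉xs , k = Matroid.augment M i j (≡.subst₂ ℕ._<_ (≡.sym (∣fromList∣ u)) (≡.sym (∣fromList∣ v)) xs<ys)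
      in e , ∈-fromList⁻ ys e∈ys , (All.tabulate (λ x∈ e≡x → e∉xs (∈-fromList⁺ (subst (_∈ˡ xs) (≡.sym e≡x) x∈))) ∷ u) , k
  }
  where open Matroid M using (Indep; indep?; ⊥-indep)

sublists : ∀ {a} {A : Set a} → List A → List (List A)
sublists []       = [] ∷ []
sublists (x ∷ xs) = map (x ∷_) (sublists xs) ++ sublists xs

sublists-⊆ : ∀ {a} {A : Set a} {xs ys : List A} → ys ∈ˡ sublists xs → ys ⊆ˡ xs
sublists-⊆ {xs = []} (here refl) ()
sublists-⊆ {xs = x ∷ xs} ys∈ y∈ with ∈ₚ.∈-++⁻ (map (x ∷_) (sublists xs)) ys∈
... | inj₂ ys∈ʳ = there (sublists-⊆ ys∈ʳ y∈)
... | inj₁ ys∈ˡ with ∈ₚ.∈-map⁻ (x ∷_) ys∈ˡ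
...   | zs , zs∈ , refl with y∈
...     | here refl = here refl
...     | there y∈′ = there (sublists-⊆ zs∈ y∈′)

sublists-unique : ∀ {a} {A : Set a} {xs ys : List A} → ys ∈ˡ sublists xs → Unique xs → Unique ys
sublists-unique {xs = []} (here refl) u = []
sublists-unique {xs = x ∷ xs} ys∈ (x∉xs ∷ u) with ∈ₚ.∈-++⁻ (map (x ∷_) (sublists xs)) ys∈
... | inj₂ ys∈ʳ = sublists-unique ys∈ʳ u
... | inj₁ ys∈ˡ with ∈ₚ.∈-map⁻ (x ∷_) ys∈ˡ
...   | zs , zs∈ , refl = All.tabulate (λ z∈ → All.lookup x∉xs (sublists-⊆ zs∈ z∈)) ∷ sublists-unique zs∈ u

sublists-∷ : ∀ {a} {A : Set a} {x : A} {xs ys} → ys ∈ˡ sublists xs → ys ∈ˡ sublists (x ∷ xs)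
sublists-∷ {x = x} {xs} = ∈ₚ.∈-++⁺ʳ (map (x ∷_) (sublists xs))

sublists-map : ∀ {a b} {A : Set a} {B : Set b} (h : A → B) xs → map (map h) (sublists xs) ≡ sublists (map h xs)
sublists-map h []       = refl
sublists-map h (x ∷ xs) = ≡.trans (Listₚ.map-++ (map h) (map (x ∷_) (sublists xs)) _)
  (cong₂ _++_ (≡.trans (≡.sym (Listₚ.map-∘ (sublists xs))) (≡.trans (Listₚ.map-∘ (sublists xs)) (cong (map (h x ∷_)) (sublists-map h xs))))
    (sublists-map h xs))

-- The procedure over an abstract oracle.

module LocalRatio (R : EuclideanField) (α : EuclideanField.Carrier R) (p : ℕ) where
  open OrderedField R

  -- All that the algorithm asks about edges of type E.  Constraint i only
  -- concerns the edges that are active for it; ok i e tests independence,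
  -- with e serving as the witness through which the constraint is accessed.
  record Oracle (E : Set) : Set where
    field
      active : E → Fin p → Bool
      ok     : Fin p → E → List E → Bool
      value  : List E → Carrier

  record Entry (E : Set) : Set where
    constructor entry
    field
      edge  : E
      gain  : Carrier
      stars : Vec Carrier p

    star : Fin p → Carrier
    star i = Vec.lookup stars i

    weight : Fin p → Carrier
    weight i = star i + gain

  open Entry public

  _⊔_ : Carrier → Carrier → Carrier
  x ⊔ y = if does (x ≤? y) then y else x

  module Procedure {E : Set} (O : Oracle E) where
    open Oracle O public

    restrict : E → Fin p → Carrier → Carrier
    restrict e i x = if active e i then x else 0#

    select : Fin p → List E → List E
    select i []       = []
    select i (x ∷ xs) = if active x i then x ∷ select i xs else select i xs

    greedy : Fin p → E → List E → List E
    greedy i e []       = []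
    greedy i e (x ∷ xs) = if ok i e (x ∷ greedy i e xs) then x ∷ greedy i e xs else greedy i e xs

    spans : Fin p → List E → E → Bool
    spans i xs e = not (ok i e (e ∷ greedy i e xs))

    level : Fin p → Carrier → List (Entry E) → List E
    level i t []      = []
    level i t (x ∷ A) = if active (edge x) i ∧ does (t ≤? weight x i) then edge x ∷ level i t A else level i t A

    -- The largest t such that the edges of weight at least t span e.
    starAmong : Fin p → E → List (Entry E) → List (Entry E) → Carrier
    starAmong i e A []      = 0#
    starAmong i e A (x ∷ B) =
      if active (edge x) i ∧ spans i (level i (weight x i) A) e then weight x i ⊔ starAmong i e A B else starAmong i e A B

    starOf : Fin p → E → List (Entry E) → Carrier
    starOf i e A = restrict e i (starAmong i e A A)

    increment : E → List E → Carrier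
    increment e S = value (e ∷ S) - value S

    penalty : E → List (Entry E) → Carrier
    penalty e A = ∑ (allFin p) (λ i → starOf i e A)

    -- Gains and stars of an edge depend only on the edges below it, so they are a function of the
    -- stack and no register has to hold them.
    annotate : List E → List (Entry E)
    annotate []      = []
    annotate (e ∷ S) = entry e (increment e S - penalty e (annotate S))
                             (Vec.tabulate (λ i → starOf i e (annotate S))) ∷ annotate S

    nonloop : E → Bool
    nonloop e = all (λ i → not (active e i) ∨ ok i e (e ∷ [])) (allFin p)

    -- A loop is spanned at every level, so no largest level exists for it. The test for a positive
    -- increment matters when the penalty is 0: the threshold alone would then admit an edge without
    -- gain.
    accepts : E → List E → Bool
    accepts e S = nonloop e ∧ (not (does (increment e S ≤? 0#)) ∧ does (α * penalty e (annotate S) ≤? increment e S))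

    -- Access to a constraint goes through an edge active for it, so only constraints active at some
    -- edge of `xs` are tested. Any other constraint selects the empty list, which is independent.
    feasible : List E → Bool
    feasible xs = all (λ e → all (λ i → not (active e i) ∨ ok i e (select i xs)) (allFin p)) xs

    best : List (List E) → List E
    best []         = []
    best (xs ∷ xss) = if feasible xs ∧ does (value (best xss) ≤? value xs) then xs else best xss

    choose : List E → List E
    choose S = best (sublists S)

    greedy-All : ∀ {P : E → Set} i e {xs} → All P xs → All P (greedy i e xs)
    greedy-All i e [] = []
    greedy-All i e {x ∷ xs} (px ∷ pxs) with ok i e (x ∷ greedy i e xs)
    ... | true  = px ∷ greedy-All i e pxs
    ... | false = greedy-All i e pxs

    level-All : ∀ {P : E → Set} i t A → All P (map edge A) → All P (level i t A)
    level-All i t [] [] = []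
    level-All i t (x ∷ A) (px ∷ pA) with active (edge x) i ∧ does (t ≤? weight x i)
    ... | true  = px ∷ level-All i t A pA
    ... | false = level-All i t A pA

    select-All : ∀ {P : E → Set} i {xs} → All P xs → All P (select i xs)
    select-All i [] = []
    select-All i {x ∷ xs} (px ∷ pxs) with active x i
    ... | true  = px ∷ select-All i pxs
    ... | false = select-All i pxs

    edges-annotate : ∀ S → map edge (annotate S) ≡ S
    edges-annotate []      = refl
    edges-annotate (e ∷ S) = cong (e ∷_) (edges-annotate S)

  -- Invariance of the procedure under renaming of edges.

  module Naturality {E′ E : Set} (O′ : Oracle E′) (O : Oracle E) (h : E′ → E)
    (active-h : ∀ e i → Oracle.active O′ e i ≡ Oracle.active O (h e) i)
    (ok-h     : ∀ i e xs → Oracle.active O′ e i ≡ true → Unique (map h xs) →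
                Oracle.ok O′ i e xs ≡ Oracle.ok O i (h e) (map h xs))
    (value-h  : ∀ xs → Oracle.value O′ xs ≡ Oracle.value O (map h xs))
    where

    private
      module ′ = Procedure O′
      module ∘ = Procedure O
      U : List E′ → Set
      U xs = Unique (map h xs)

      head∉ : ∀ {x xs} → U (x ∷ xs) → All (λ y → h x ≢ h y) xs
      head∉ (p ∷ _) = Allₚ.map⁻ p

      U-∷ : ∀ {x xs} → All (λ y → h x ≢ h y) xs → U xs → U (x ∷ xs)
      U-∷ p u = Allₚ.map⁺ p ∷ u

      U-greedy : ∀ i e xs → U xs → U (′.greedy i e xs)
      U-greedy i e [] u = []
      U-greedy i e (x ∷ xs) u@(_ ∷ u′) with ′.ok i e (x ∷ ′.greedy i e xs)
      ... | true  = U-∷ (′.greedy-All i e (head∉ u)) (U-greedy i e xs u′)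
      ... | false = U-greedy i e xs u′

      U-level : ∀ i t A → U (map edge A) → U (′.level i t A)
      U-level i t [] u = []
      U-level i t (x ∷ A) u@(_ ∷ u′) with ′.active (edge x) i ∧ does (t ≤? weight x i)
      ... | true  = U-∷ (′.level-All i t A (head∉ u)) (U-level i t A u′)
      ... | false = U-level i t A u′

      U-select : ∀ i xs → U xs → U (′.select i xs)
      U-select i [] u = []
      U-select i (x ∷ xs) u@(_ ∷ u′) with ′.active x i
      ... | true  = U-∷ (′.select-All i (head∉ u)) (U-select i xs u′)
      ... | false = U-select i xs u′

      hE : Entry E′ → Entry E
      hE (entry e g s) = entry (h e) g s

      if-map : ∀ {a b} {A : Set a} {B : Set b} (k : A → B) c {x y} →
               k (if c then x else y) ≡ (if c then k x else k y)
      if-map k true  = refl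
      if-map k false = refl

      if-cong : ∀ {a} {A : Set a} {b c} {x y z w : A} → b ≡ c → x ≡ z → y ≡ w →
                (if b then x else y) ≡ (if c then z else w)
      if-cong refl refl refl = refl

      greedy-h : ∀ i e xs → ′.active e i ≡ true → U xs → map h (′.greedy i e xs) ≡ ∘.greedy i (h e) (map h xs)
      greedy-h i e [] act u = refl
      greedy-h i e (x ∷ xs) act u@(_ ∷ u′) = ≡.trans (if-map (map h) (′.ok i e (x ∷ ′.greedy i e xs)))
        (if-cong (≡.trans (ok-h i e _ act (U-∷ (′.greedy-All i e (head∉ u)) (U-greedy i e xs u′)))
                   (cong (∘.ok i (h e) ∘ (h x ∷_)) ih))
                 (cong (h x ∷_) ih) ih)
        where ih = greedy-h i e xs act u′

      spans-h : ∀ i e xs → ′.active e i ≡ true → U (e ∷ xs) → ′.spans i xs e ≡ ∘.spans i (map h xs) (h e)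
      spans-h i e xs act u@(_ ∷ u′) = cong not (≡.trans
        (ok-h i e _ act (U-∷ (′.greedy-All i e (head∉ u)) (U-greedy i e xs u′)))
        (cong (∘.ok i (h e) ∘ (h e ∷_)) (greedy-h i e xs act u′)))

      level-h : ∀ i t A → map h (′.level i t A) ≡ ∘.level i t (map hE A)
      level-h i t []      = refl
      level-h i t (x ∷ A) = ≡.trans (if-map (map h) (′.active (edge x) i ∧ does (t ≤? weight x i)))
        (if-cong (cong (_∧ does (t ≤? weight x i)) (active-h (edge x) i)) (cong (h (edge x) ∷_) (level-h i t A)) (level-h i t A))

      starAmong-h : ∀ i e A B → ′.active e i ≡ true → U (e ∷ map edge A) →
                    ′.starAmong i e A B ≡ ∘.starAmong i (h e) (map hE A) (map hE B)
      starAmong-h i e A [] act u = refl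
      starAmong-h i e A (x ∷ B) act u@(_ ∷ u′) = if-cong
        (cong₂ _∧_ (active-h (edge x) i) (≡.trans
          (spans-h i e _ act (U-∷ (′.level-All i _ A (head∉ u)) (U-level i _ A u′)))
          (cong (λ L → ∘.spans i L (h e)) (level-h i (weight x i) A))))
        (cong (weight x i ⊔_) ih) ih
        where ih = starAmong-h i e A B act u

      starOf-h : ∀ i e A → U (e ∷ map edge A) → ′.starOf i e A ≡ ∘.starOf i (h e) (map hE A)
      starOf-h i e A u with ′.active e i in eq
      ... | true  rewrite ≡.trans (≡.sym (active-h e i)) eq = starAmong-h i e A A eq u
      ... | false rewrite ≡.trans (≡.sym (active-h e i)) eq = refl

      increment-h : ∀ e S → ′.increment e S ≡ ∘.increment (h e) (map h S)
      increment-h e S = cong₂ _-_ (value-h (e ∷ S)) (value-h S)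

      ∑-≡ : ∀ {A : Set} (xs : List A) {f g : A → Carrier} → (∀ x → f x ≡ g x) → ∑ xs f ≡ ∑ xs g
      ∑-≡ [] eq = refl
      ∑-≡ (x ∷ xs) eq = cong₂ _+_ (eq x) (∑-≡ xs eq)

      annotate-h : ∀ S → U S → map hE (′.annotate S) ≡ ∘.annotate (map h S)
      stars-h : ∀ e S → U (e ∷ S) → ∀ i → ′.starOf i e (′.annotate S) ≡ ∘.starOf i (h e) (∘.annotate (map h S))
      penalty-h : ∀ e S → U (e ∷ S) → ′.penalty e (′.annotate S) ≡ ∘.penalty (h e) (∘.annotate (map h S))

      stars-h e S u@(_ ∷ u′) i = ≡.trans
        (starOf-h i e (′.annotate S) (subst (U ∘ (e ∷_)) (≡.sym (′.edges-annotate S)) u))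
        (cong (∘.starOf i (h e)) (annotate-h S u′))

      penalty-h e S u = ∑-≡ (allFin p) (stars-h e S u)

      annotate-h []      u = refl
      annotate-h (e ∷ S) u@(_ ∷ u′) = cong₂ _∷_
        (cong₂ (entry (h e)) (cong₂ _-_ (increment-h e S) (penalty-h e S u)) (Vecₚ.tabulate-cong (stars-h e S u)))
        (annotate-h S u′)

      all-cong : ∀ {A : Set} (xs : List A) {f g : A → Bool} → (∀ x → f x ≡ g x) → all f xs ≡ all g xs
      all-cong xs eq = cong and (Listₚ.map-cong eq xs)

      nonloop-h : ∀ e → ′.nonloop e ≡ ∘.nonloop (h e)
      nonloop-h e = all-cong (allFin p) λ i → guarded i
        where
        guarded : ∀ i → not (′.active e i) ∨ ′.ok i e (e ∷ []) ≡ not (∘.active (h e) i) ∨ ∘.ok i (h e) (h e ∷ [])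
        guarded i with ′.active e i in eq
        ... | true  rewrite ≡.trans (≡.sym (active-h e i)) eq = ok-h i e (e ∷ []) eq ([] ∷ [])
        ... | false rewrite ≡.trans (≡.sym (active-h e i)) eq = refl

      select-h : ∀ i xs → map h (′.select i xs) ≡ ∘.select i (map h xs)
      select-h i []       = refl
      select-h i (x ∷ xs) = ≡.trans (if-map (map h) (′.active x i))
        (if-cong (active-h x i) (cong (h x ∷_) (select-h i xs)) (select-h i xs))

      all-map : ∀ {A B : Set} (k : A → B) (f : B → Bool) xs → all f (map k xs) ≡ all (f ∘ k) xs
      all-map k f xs = cong and (≡.sym (Listₚ.map-∘ xs))

      feasible-h : ∀ xs → U xs → ′.feasible xs ≡ ∘.feasible (map h xs)
      feasible-h xs u = ≡.trans (all-cong xs λ e → all-cong (allFin p) (guarded e)) (≡.sym (all-map h _ xs))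
        where
        guarded : ∀ e i → not (′.active e i) ∨ ′.ok i e (′.select i xs) ≡
                          not (∘.active (h e) i) ∨ ∘.ok i (h e) (∘.select i (map h xs))
        guarded e i with ′.active e i in eq
        ... | true  rewrite ≡.trans (≡.sym (active-h e i)) eq =
          ≡.trans (ok-h i e _ eq (U-select i xs u)) (cong (∘.ok i (h e)) (select-h i xs))
        ... | false rewrite ≡.trans (≡.sym (active-h e i)) eq = refl

      best-h : ∀ xss → All U xss → map h (′.best xss) ≡ ∘.best (map (map h) xss)
      best-h [] [] = refl
      best-h (xs ∷ xss) (u ∷ us) = ≡.trans (if-map (map h) (′.feasible xs ∧ does (′.value (′.best xss) ≤? ′.value xs)))
        (if-cong (cong₂ _∧_ (feasible-h xs u) (cong₂ (λ a b → does (a ≤? b))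
          (≡.trans (value-h _) (cong ∘.value (best-h xss us))) (value-h xs))) refl (best-h xss us))

    -- The streaming algorithm works with positions in its store, the analysis with the edges of the
    -- instance; this makes their decisions agree. Every list handed to `ok` is a sublist of a
    -- duplicate-free one, which is what the hypothesis `ok-h` asks for.
    accepts-natural : ∀ e S → Unique (map h (e ∷ S)) → ′.accepts e S ≡ ∘.accepts (h e) (map h S)
    accepts-natural e S u = cong₂ _∧_ (nonloop-h e) (cong₂ _∧_
      (cong (λ x → not (does (x ≤? 0#))) (increment-h e S))
      (cong₂ (λ x y → does (α * x ≤? y)) (penalty-h e S u) (increment-h e S)))

    choose-natural : ∀ S → Unique (map h S) → map h (′.choose S) ≡ ∘.choose (map h S)
    choose-natural S u = ≡.trans (best-h (sublists S) (All.tabulate λ {xs} xs∈ →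
        sublists-unique (subst (map h xs ∈ˡ_) (sublists-map h S) (∈ₚ.∈-map⁺ (map h) xs∈)) u))
      (cong ∘.best (sublists-map h S))

-- Levels, stars, and the effect of an accepted edge on ranks.

module Analysis (R : EuclideanField)
  (a : EuclideanField.Carrier R) (0<a : EuclideanField._<_ R (EuclideanField.0# R) a) {p m : ℕ}
  (isActive : Fin m → Fin p → Bool) (matroid : Fin p → ListMatroid m) (f : Subset m → EuclideanField.Carrier R) where

  open OrderedField R
  open LocalRatio R (1# + a) p

  α : Carrier
  α = 1# + a

  oracle : Oracle (Fin m)
  oracle = record
    { active = isActive
    ; ok     = λ i _ xs → does (ListMatroid.ind? (matroid i) xs)
    ; value  = f ∘ fromList
    }

  open Procedure oracle

  module 𝓜 (i : Fin p) = ListMatroid (matroid i)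
  open 𝓜 using (Ind; Span; span?; rank)
  open Streaming R using (Submodular)

  edges : List (Entry (Fin m)) → List (Fin m)
  edges = map edge

  α-positive : 0# < α
  α-positive = +-positive 0<1 (proj₁ 0<a)

  1≤α : 1# ≤ α
  1≤α = x≤x+y (proj₁ 0<a)

  module _ (i : Fin p) where

    greedy≡basis : ∀ e xs → greedy i e xs ≡ 𝓜.basis i xs
    greedy≡basis e [] = refl
    greedy≡basis e (x ∷ xs) rewrite greedy≡basis e xs = refl

    spans≡span? : ∀ xs e → spans i xs e ≡ does (span? i xs e)
    spans≡span? xs e rewrite greedy≡basis e xs = refl

    level-keep : ∀ {t x} A → isActive (edge x) i ≡ true → t ≤ weight x i → level i t (x ∷ A) ≡ edge x ∷ level i t A
    level-keep {t} {x} A act t≤ rewrite act | dec-true (t ≤? weight x i) t≤ = refl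

    level-drop : ∀ {t x} A → ¬ t ≤ weight x i → level i t (x ∷ A) ≡ level i t A
    level-drop {t} {x} A t≰ with isActive (edge x) i
    ... | true  rewrite dec-false (t ≤? weight x i) t≰ = refl
    ... | false = refl

    level-inactive : ∀ {t x} A → isActive (edge x) i ≡ false → level i t (x ∷ A) ≡ level i t A
    level-inactive A act rewrite act = refl

    ∈-level⁻ : ∀ t A {e} → e ∈ˡ level i t A → ∃[ x ] x ∈ˡ A × edge x ≡ e × isActive e i ≡ true × t ≤ weight x i
    ∈-level⁻ t (x ∷ A) e∈ with isActive (edge x) i in act | t ≤? weight x i
    ∈-level⁻ t (x ∷ A) (here refl) | true | yes t≤ = x , here refl , refl , act , t≤
    ∈-level⁻ t (x ∷ A) (there e∈)  | true | yes _ = let y , y∈ , rest = ∈-level⁻ t A e∈ in y , there y∈ , rest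
    ... | true  | no _ = let y , y∈ , rest = ∈-level⁻ t A e∈ in y , there y∈ , rest
    ... | false | _    = let y , y∈ , rest = ∈-level⁻ t A e∈ in y , there y∈ , rest

    level-∷ : ∀ t x A → level i t A ⊆ˡ level i t (x ∷ A)
    level-∷ t x A e∈ with isActive (edge x) i ∧ does (t ≤? weight x i)
    ... | true  = there e∈
    ... | false = e∈

    ∈-level⁺ : ∀ t A {x} → x ∈ˡ A → isActive (edge x) i ≡ true → t ≤ weight x i → edge x ∈ˡ level i t A
    ∈-level⁺ t (y ∷ A) (here refl) act t≤ rewrite level-keep {t} {y} A act t≤ = here refl
    ∈-level⁺ t (y ∷ A) (there x∈)  act t≤ = level-∷ t y A (∈-level⁺ t A x∈ act t≤)

    level-antitone : ∀ {s t} A → s ≤ t → level i t A ⊆ˡ level i s A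
    level-antitone {s} {t} A s≤t e∈ with ∈-level⁻ t A e∈
    ... | x , x∈ , refl , act , t≤ = ∈-level⁺ s A x∈ act (≤-trans s≤t t≤)

  module _ (i : Fin p) (e : Fin m) (A : List (Entry (Fin m))) where

    private
      S = λ t → level i t A

      candidate : ∀ x → x ∈ˡ A → isActive (edge x) i ≡ true → Span i (S (weight x i)) e →
                  isActive (edge x) i ∧ spans i (S (weight x i)) e ≡ true
      candidate x _ act s rewrite act | spans≡span? i (S (weight x i)) e = dec-true (span? i (S (weight x i)) e) s

      ⊔-≥ˡ : ∀ x y → x ≤ x ⊔ y
      ⊔-≥ˡ x y with x ≤? y
      ... | yes x≤y = x≤y
      ... | no  _   = ≤-refl

      ⊔-≥ʳ : ∀ x y → y ≤ x ⊔ y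
      ⊔-≥ʳ x y with x ≤? y
      ... | yes _   = ≤-refl
      ... | no  x≰y = ≰⇒≥ x≰y

      upper : ∀ B {x} → x ∈ˡ B → isActive (edge x) i ∧ spans i (S (weight x i)) e ≡ true → weight x i ≤ starAmong i e A B
      upper (y ∷ B) (here refl) c rewrite c = ⊔-≥ˡ (weight y i) (starAmong i e A B)
      upper (y ∷ B) (there x∈) c with isActive (edge y) i ∧ spans i (S (weight y i)) e
      ... | true  = ≤-trans (upper B x∈ c) (⊔-≥ʳ (weight y i) (starAmong i e A B))
      ... | false = upper B x∈ c

      attained : ∀ B → starAmong i e A B ≡ 0# ⊎
                 (Σ[ x ∈ Entry (Fin m) ] starAmong i e A B ≡ weight x i × Span i (S (weight x i)) e)
      attained [] = inj₁ refl
      attained (y ∷ B) with isActive (edge y) i ∧ spans i (S (weight y i)) e in c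
      ... | false = attained B
      ... | true with weight y i ≤? starAmong i e A B
      ...   | yes _ = attained B
      ...   | no  _ = inj₂ (y , refl , does-true (span? i (S (weight y i)) e)
                        (≡.trans (≡.sym (spans≡span? i (S (weight y i)) e)) (proj₂ (∧-true {isActive (edge y) i} c))))

      0≤starAmong : ∀ B → 0# ≤ starAmong i e A B
      0≤starAmong [] = ≤-refl
      0≤starAmong (y ∷ B) with isActive (edge y) i ∧ spans i (S (weight y i)) e
      ... | true  = ≤-trans (0≤starAmong B) (⊔-≥ʳ (weight y i) (starAmong i e A B))
      ... | false = 0≤starAmong B

      lightest : ∀ t B → (∃[ x ] x ∈ˡ B × isActive (edge x) i ≡ true × t ≤ weight x i ×
                            (∀ y → y ∈ˡ B → isActive (edge y) i ≡ true → t ≤ weight y i → weight x i ≤ weight y i)) ⊎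
                         (∀ y → y ∈ˡ B → isActive (edge y) i ≡ true → ¬ t ≤ weight y i)
      lightest t [] = inj₂ λ _ ()
      lightest t (z ∷ B) with bool (isActive (edge z) i) | t ≤? weight z i | lightest t B
      ... | inj₂ inact | _ | inj₁ (x , x∈ , act , t≤ , min) = inj₁ (x , there x∈ , act , t≤ ,
              λ { y (here refl) act → false≢true inact act ; y (there y∈) → min y y∈ })
      ... | inj₂ inact | _ | inj₂ none = inj₂ λ { y (here refl) act → false≢true inact act ; y (there y∈) → none y y∈ }
      ... | inj₁ act | no t≰ | inj₁ (x , x∈ , actx , t≤ , min) = inj₁ (x , there x∈ , actx , t≤ ,
              λ { y (here refl) _ t≤y → ⊥-elim (t≰ t≤y) ; y (there y∈) → min y y∈ })
      ... | inj₁ act | no t≰ | inj₂ none = inj₂ λ { y (here refl) _ → t≰ ; y (there y∈) → none y y∈ }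
      ... | inj₁ act | yes t≤z | inj₂ none = inj₁ (z , here refl , act , t≤z ,
              λ { y (here refl) _ _ → ≤-refl ; y (there y∈) act t≤y → ⊥-elim (none y y∈ act t≤y) })
      ... | inj₁ act | yes t≤z | inj₁ (x , x∈ , actx , t≤ , min) with weight x i ≤? weight z i
      ...   | yes x≤z = inj₁ (x , there x∈ , actx , t≤ , λ { y (here refl) _ _ → x≤z ; y (there y∈) → min y y∈ })
      ...   | no  x≰z = inj₁ (z , here refl , act , t≤z ,
              λ { y (here refl) _ _ → ≤-refl ; y (there y∈) act t≤y → ≤-trans (≰⇒≥ x≰z) (min y y∈ act t≤y) })

    0≤starOf : 0# ≤ starOf i e A
    0≤starOf with isActive e i
    ... | true  = 0≤starAmong A
    ... | false = ≤-refl

    starOf-spans : isActive e i ≡ true → ∀ {t} → 0# < t → t ≤ starOf i e A → Span i (level i t A) e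
    starOf-spans act {t} 0<t t≤ rewrite act with attained A
    ... | inj₁ ≡0 = ⊥-elim (<⇒≰ 0<t (subst (t ≤_) ≡0 t≤))
    ... | inj₂ (x , ≡w , s) = 𝓜.span-mono i (S (weight x i)) (S t) (level-antitone i A (subst (t ≤_) ≡w t≤)) s

    -- The lightest active edge of weight at least `t` has a weight with the same level as `t`, so
    -- it is among the candidates for the maximum. If there is no such edge the level is empty, and
    -- `e` would be a loop.
    spanned⇒≤starOf : isActive e i ≡ true → Ind i (e ∷ []) → ∀ {t} → Span i (level i t A) e → t ≤ starOf i e A
    spanned⇒≤starOf act nonloop {t} s rewrite act with lightest t A
    ... | inj₁ (x , x∈ , actx , t≤ , min) = ≤-trans t≤ (upper A x∈ (candidate x x∈ actx
            (𝓜.span-mono i (S t) (S (weight x i)) heavier s)))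
      where
      heavier : S t ⊆ˡ S (weight x i)
      heavier y∈ with ∈-level⁻ i t A y∈
      ... | y , y∈A , refl , acty , t≤y = ∈-level⁺ i (weight x i) A y∈A acty (min y y∈A acty t≤y)
    ... | inj₂ none = ⊥-elim (𝓜.span-mono i (S t) [] empty s nonloop)
      where
      empty : S t ⊆ˡ []
      empty y∈ with ∈-level⁻ i t A y∈
      ... | y , y∈A , refl , acty , t≤y = ⊥-elim (none y y∈A acty t≤y)

  totalStar : Entry (Fin m) → Carrier
  totalStar x = ∑ (allFin p) (star x)

  record Fits (x : Entry (Fin m)) (A : List (Entry (Fin m))) : Set where
    field
      fresh         : edge x ∉ˡ edges A
      gain-positive : 0# < gain x
      0≤star        : ∀ i → 0# ≤ star x i
      inactive-star : ∀ i → isActive (edge x) i ≡ false → star x i ≡ 0#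
      star⇒span     : ∀ i → isActive (edge x) i ≡ true → ∀ {t} → 0# < t → t ≤ star x i → Span i (level i t A) (edge x)
      span⇒star     : ∀ i → isActive (edge x) i ≡ true → ∀ {t} → Span i (level i t A) (edge x) → t ≤ star x i
      balance       : gain x + totalStar x ≈ increment (edge x) (edges A)
      threshold     : α * totalStar x ≤ increment (edge x) (edges A)

  data Good : List (Entry (Fin m)) → Set where
    []  : Good []
    _∷_ : ∀ {x A} → Fits x A → Good A → Good (x ∷ A)

  NonLoop : Fin m → Set
  NonLoop e = ∀ i → isActive e i ≡ true → Ind i (e ∷ [])

  nonloop⁻ : ∀ {e} → nonloop e ≡ true → NonLoop e
  nonloop⁻ {e} nl i act = does-true (𝓜.ind? i (e ∷ [])) (implies (all-true (allFin p) nl (∈ₚ.∈-allFin i)) act)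

  nonloop⁺ : ∀ {e} → NonLoop e → nonloop e ≡ true
  nonloop⁺ {e} nl = all-true⁻ (allFin p) λ {i} _ → implies⁻ λ act → dec-true (𝓜.ind? i (e ∷ [])) (nl i act)

  rejected-bound : ∀ {e S} → NonLoop e → accepts e S ≡ false → increment e S ≤ α * penalty e (annotate S)
  rejected-bound {e} {S} nl rej rewrite nonloop⁺ nl with increment e S ≤? 0# | α * penalty e (annotate S) ≤? increment e S
  ... | yes inc≤0 | _ = ≤-trans inc≤0 (*-nonNegative (proj₁ α-positive)
                          (∑-nonNegative (allFin p) (λ {i} _ → 0≤starOf i e (annotate S))))
  ... | no _ | no low = ≰⇒≥ low

  accepted-fits : ∀ {e S} → accepts e S ≡ true → e ∉ˡ S → Good (annotate S) → Good (annotate (e ∷ S))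
  accepted-fits {e} {S} acc e∉S good = record
      { fresh = λ e∈ → e∉S (subst (e ∈ˡ_) (edges-annotate S) e∈)
      -- The threshold `α * pen ≤ inc` gives `a * inc ≤ α * (inc - pen)`, so the strict positivity
      -- of `inc` passes to the gain.
      ; gain-positive = ≰⇒> λ gain≤0 → <⇒≰ (*-positive 0<a inc>0) (begin
          a * inc                               ≈⟨ solve 2 (λ a x → a :* x := (con (+ 1) :+ a) :* x :- x) ≈-refl a inc ⟩
          α * inc - inc                         ≤⟨ +-mono-≤ ≤-refl (≤-by _ (≤⇒0≤ thr) (solve 2 (λ x y → x :- y := (:- y) :- (:- x)) ≈-refl inc (α * pen))) ⟩
          α * inc - α * pen                     ≈⟨ solve 3 (λ c x y → c :* x :- c :* y := c :* (x :- y)) ≈-refl α inc pen ⟩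
          α * (inc - pen)                       ≤⟨ *-monoˡ-≤ (proj₁ α-positive) gain≤0 ⟩
          α * 0#                                ≈⟨ zeroʳ α ⟩
          0#                                    ∎)
      ; 0≤star = λ i → subst (0# ≤_) (≡.sym (lk i)) (0≤starOf i e (annotate S))
      ; inactive-star = λ i act → ≡.trans (lk i) (cong (λ b → if b then starAmong i e (annotate S) (annotate S) else 0#) act)
      ; star⇒span = λ i act 0<t t≤ → starOf-spans i e (annotate S) act 0<t (subst (_ ≤_) (lk i) t≤)
      ; span⇒star = λ i act s → subst (_ ≤_) (≡.sym (lk i)) (spanned⇒≤starOf i e (annotate S) act (nl i act) s)
      ; balance = begin-equality
          inc - pen + sum★    ≈⟨ +-cong ≈-refl sum★≈ ⟩
          inc - pen + pen      ≈⟨ solve 2 (λ x y → x :- y :+ y := x) ≈-refl inc pen ⟩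
          inc                  ≡⟨ inc≡ ⟩
          increment e (edges (annotate S)) ∎
      ; threshold = begin
          α * sum★            ≈⟨ *-cong ≈-refl sum★≈ ⟩
          α * pen              ≤⟨ thr ⟩
          inc                  ≡⟨ inc≡ ⟩
          increment e (edges (annotate S)) ∎
      } ∷ good
    where
    open ≤-Reasoning
    inc = increment e S
    pen = penalty e (annotate S)
    stars′ : Vec Carrier p
    stars′ = Vec.tabulate (λ i → starOf i e (annotate S))
    sum★ = ∑ (allFin p) (Vec.lookup stars′)
    lk : ∀ i → Vec.lookup stars′ i ≡ starOf i e (annotate S)
    lk = Vecₚ.lookup∘tabulate (λ i → starOf i e (annotate S))
    sum★≈ : sum★ ≈ pen
    sum★≈ = ∑-cong (allFin p) (λ i → reflexive (lk i))
    inc≡ : inc ≡ increment e (edges (annotate S))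
    inc≡ = cong (increment e) (≡.sym (edges-annotate S))
    parts = ∧-true {nonloop e} acc
    nl = nonloop⁻ (proj₁ parts)
    parts′ = ∧-true {not (does (inc ≤? 0#))} (proj₂ parts)
    inc>0 : 0# < inc
    inc>0 = ≰⇒> (does-false (inc ≤? 0#) (not-true (proj₁ parts′)))
    thr : α * pen ≤ inc
    thr = does-true (α * pen ≤? inc) (proj₂ parts′)

  activeWeight : Fin p → Entry (Fin m) → Carrier
  activeWeight i x = restrict (edge x) i (weight x i)

  activeGain : Fin p → Entry (Fin m) → Carrier
  activeGain i x = restrict (edge x) i (gain x)

  restrict-on : ∀ {e i x} → isActive e i ≡ true → restrict e i x ≡ x
  restrict-on act rewrite act = refl

  restrict-off : ∀ {e i x} → isActive e i ≡ false → restrict e i x ≡ 0#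
  restrict-off act rewrite act = refl

  0≤restrict : ∀ {e i x} → 0# ≤ x → 0# ≤ restrict e i x
  0≤restrict {e} {i} 0≤x with isActive e i
  ... | true  = 0≤x
  ... | false = ≤-refl

  -- For an active constraint the cases are weight < t, t ≤ star, and star < t ≤ weight. Each
  -- constructor carries the resulting equations, so that matching and rewriting yield the change of
  -- every count at once.
  data Step (i : Fin p) (t : Carrier) (x : Entry (Fin m)) (A : List (Entry (Fin m))) : Set where
    inactive : isActive (edge x) i ≡ false → level i t (x ∷ A) ≡ level i t A →
               indicator t (star x i) ≡ 0 → indicator t (activeWeight i x) ≡ 0 → Step i t x A
    above    : isActive (edge x) i ≡ true → ¬ t ≤ weight x i → level i t (x ∷ A) ≡ level i t A →
               indicator t (star x i) ≡ 0 → indicator t (activeWeight i x) ≡ 0 → Step i t x A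
    spanned  : isActive (edge x) i ≡ true → t ≤ weight x i → level i t (x ∷ A) ≡ edge x ∷ level i t A →
               Span i (level i t A) (edge x) →
               indicator t (star x i) ≡ 1 → indicator t (activeWeight i x) ≡ 1 → Step i t x A
    joins    : isActive (edge x) i ≡ true → t ≤ weight x i → level i t (x ∷ A) ≡ edge x ∷ level i t A →
               ¬ Span i (level i t A) (edge x) →
               indicator t (star x i) ≡ 0 → indicator t (activeWeight i x) ≡ 1 → Step i t x A

  star≤weight : ∀ {x A} → Fits x A → ∀ i → star x i ≤ weight x i
  star≤weight {x} fits i = x≤x+y (proj₁ (Fits.gain-positive fits))

  step : ∀ i {t} → 0# < t → ∀ {x A} → Fits x A → Step i t x A
  step i {t} 0<t {x} {A} fits with bool (isActive (edge x) i)
  ... | inj₂ act = inactive act (level-inactive i {t} {x} A act)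
          (indicator-no (λ t≤ → <⇒≰ 0<t (subst (t ≤_) (Fits.inactive-star fits i act) t≤)))
          (indicator-no (λ t≤ → <⇒≰ 0<t (subst (t ≤_) (restrict-off act) t≤)))
  ... | inj₁ act with t ≤? weight x i
  ...   | no t≰ = above act t≰ (level-drop i {t} {x} A t≰) (indicator-no (λ t≤ → t≰ (≤-trans t≤ (star≤weight fits i))))
                    (indicator-no (t≰ ∘ subst (t ≤_) (restrict-on act)))
  ...   | yes t≤ with span? i (level i t A) (edge x)
  ...     | yes s = spanned act t≤ (level-keep i {t} {x} A act t≤) s (indicator-yes (Fits.span⇒star fits i act s))
                      (indicator-yes (subst (t ≤_) (≡.sym (restrict-on act)) t≤))
  ...     | no ¬s = joins act t≤ (level-keep i {t} {x} A act t≤) ¬s (indicator-no (¬s ∘ Fits.star⇒span fits i act 0<t))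
                      (indicator-yes (subst (t ≤_) (≡.sym (restrict-on act)) t≤))

  level-rank : ∀ {A} → Good A → ∀ i {t} → 0# < t →
               rank i (level i t A) ℕ.+ tally t A (λ x → star x i) ≡ tally t A (activeWeight i)
  level-rank [] i 0<t = refl
  level-rank {x ∷ A} (fits ∷ good) i {t} 0<t with step i 0<t fits | level-rank good i 0<t
  ... | inactive _ l s w | ih rewrite l | s | w = ih
  ... | above _ _ l s w  | ih rewrite l | s | w = ih
  ... | spanned _ _ l sp s w | ih rewrite l | s | w | 𝓜.rank-spanned i {level i t A} {edge x} sp = ≡.trans (ℕₚ.+-suc _ _) (cong suc ih)
  ... | joins _ _ l sp s w | ih rewrite l | s | w | 𝓜.rank-unspanned i {level i t A} {edge x} sp = cong suc ih

  select-++ : ∀ i xs ys → select i (xs ++ ys) ≡ select i xs ++ select i ys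
  select-++ i [] ys = refl
  select-++ i (x ∷ xs) ys with isActive x i
  ... | true  = cong (x ∷_) (select-++ i xs ys)
  ... | false = select-++ i xs ys

  ∈-select⁺ : ∀ i {x xs} → x ∈ˡ xs → isActive x i ≡ true → x ∈ˡ select i xs
  ∈-select⁺ i {x} {_ ∷ xs} (here refl) act rewrite act = here refl
  ∈-select⁺ i {x} {y ∷ xs} (there x∈) act with isActive y i
  ... | true  = there (∈-select⁺ i x∈ act)
  ... | false = ∈-select⁺ i x∈ act

  ∈-select⁻ : ∀ i {x} xs → x ∈ˡ select i xs → x ∈ˡ xs × isActive x i ≡ true
  ∈-select⁻ i (y ∷ xs) x∈ with isActive y i in act
  ∈-select⁻ i (y ∷ xs) (here refl) | true = here refl , act
  ∈-select⁻ i (y ∷ xs) (there x∈) | true = let x∈′ , act′ = ∈-select⁻ i xs x∈ in there x∈′ , act′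
  ... | false = let x∈′ , act′ = ∈-select⁻ i xs x∈ in there x∈′ , act′

  select-unique : ∀ i {xs} → Unique xs → Unique (select i xs)
  select-unique i [] = []
  select-unique i {x ∷ xs} (x∉ ∷ u) with isActive x i
  ... | true  = select-All i x∉ ∷ select-unique i u
  ... | false = select-unique i u

  select-↭ : ∀ i {xs ys} → xs ↭ ys → select i xs ↭ select i ys
  select-↭ i _↭_.refl = ↭-refl
  select-↭ i (prep x p) with isActive x i
  ... | true  = prep x (select-↭ i p)
  ... | false = select-↭ i p
  select-↭ i (swap x y p) with isActive x i | isActive y i
  ... | true  | true  = swap x y (select-↭ i p)
  ... | true  | false = prep x (select-↭ i p)
  ... | false | true  = prep y (select-↭ i p)
  ... | false | false = select-↭ i p
  select-↭ i (_↭_.trans p q) = ↭-trans (select-↭ i p) (select-↭ i q)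

  level-unique : ∀ i t A → Unique (edges A) → Unique (level i t A)
  level-unique i t [] u = []
  level-unique i t (x ∷ A) (x∉ ∷ u) with isActive (edge x) i ∧ does (t ≤? weight x i)
  ... | true  = level-All i t A x∉ ∷ level-unique i t A u
  ... | false = level-unique i t A u

  level⊆select : ∀ i t A → level i t A ⊆ˡ select i (edges A)
  level⊆select i t A e∈ with ∈-level⁻ i t A e∈
  ... | x , x∈ , refl , act , _ = ∈-select⁺ i (∈ₚ.∈-map⁺ edge x∈) act

  -- Charging an independent set to the gains.

  Independent : List (Fin m) → Set
  Independent xs = ∀ i → Ind i (select i xs)

  -- H records the edges of an independent set as they arrive.  The weight of
  -- a record is the share of the stack charged to it by each constraint.
  Charged : List (Entry (Fin m)) → Entry (Fin m) → Set
  Charged A h = ∀ i → isActive (edge h) i ≡ true → ∀ {t} → 0# < t → t ≤ weight h i → Span i (level i t A) (edge h)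

  totalCharge : Entry (Fin m) → Carrier
  totalCharge h = ∑ (allFin p) (λ i → activeWeight i h)

  totalGain : Entry (Fin m) → Carrier
  totalGain x = ∑ (allFin p) (λ i → activeGain i x)

  private
    level-length : ∀ i {t} → 0# < t → ∀ H → length (level i t H) ≡ tally t H (activeWeight i)
    level-length i 0<t [] = refl
    level-length i {t} 0<t (x ∷ H) with isActive (edge x) i
    ... | false rewrite indicator-no (<⇒≰ 0<t) = level-length i 0<t H
    ... | true with t ≤? weight x i
    ...   | yes _ = cong suc (level-length i 0<t H)
    ...   | no  _ = level-length i 0<t H

  module _ {A H : List (Entry (Fin m))} (good : Good A) (charged : ∀ {h} → h ∈ˡ H → Charged A h)
           (uniq : Unique (edges H)) (ind : Independent (edges H)) where

    private
      tally-charges : ∀ i {t} → 0# < t → tally t H (activeWeight i) ℕ.≤ rank i (level i t A)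
      tally-charges i {t} 0<t = subst (ℕ._≤ _) (level-length i 0<t H) (𝓜.spanned-ind i (level i t A)
          (𝓜.hereditary i (level-unique i t H uniq) (level⊆select i t H) (ind i)) spanned′)
        where
        spanned′ : ∀ {e} → e ∈ˡ level i t H → Span i (level i t A) e
        spanned′ e∈ with ∈-level⁻ i t H e∈
        ... | h , h∈ , refl , act , t≤ = charged h∈ i act 0<t t≤

      good-nonNegative : ∀ {B} → Good B → ∀ i → ∀ {x} → x ∈ˡ B → 0# ≤ activeWeight i x
      good-nonNegative (fits ∷ _) i (here refl) =
        0≤restrict (≤-trans (Fits.0≤star fits i) (star≤weight fits i))
      good-nonNegative (_ ∷ g) i (there y∈) = good-nonNegative g i y∈

      activeWeight≈ : ∀ {B} → Good B → ∀ i → ∑ B (activeWeight i) ≈ ∑ B (λ x → star x i) + ∑ B (activeGain i)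
      activeWeight≈ [] i = ≈-sym (+-identityʳ 0#)
      activeWeight≈ {x ∷ B} (fits ∷ g) i = ≈-trans (+-cong one (activeWeight≈ g i))
          (solve 4 (λ a b c d → (a :+ b) :+ (c :+ d) := (a :+ c) :+ (b :+ d)) ≈-refl _ _ _ _)
        where
        one : activeWeight i x ≈ star x i + activeGain i x
        one with bool (isActive (edge x) i)
        ... | inj₁ act rewrite act = ≈-refl
        ... | inj₂ act rewrite act = ≈-sym (≈-trans (+-identityʳ _) (reflexive (Fits.inactive-star fits i act)))

      -- The records of weight at least `t` are independent and spanned by the level, so they number
      -- at most its rank, which `level-rank` gives as weights minus stars. The stars are moved to
      -- the left, since counts in ℕ are compared without subtraction.
      charge-one : ∀ i → ∑ H (activeWeight i) ≤ ∑ A (activeGain i)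
      charge-one i = ≤-by _ (≤⇒0≤ both) (begin-equality
          ∑ A (activeWeight i) - ∑ (map (activeWeight i) H ++ map (λ x → star x i) A) id
            ≈⟨ +-cong ≈-refl (-‿cong (≈-trans (∑-++ (map (activeWeight i) H) _ id) (+-cong (∑-map _ H id) (∑-map _ A id)))) ⟩
          ∑ A (activeWeight i) - (∑ H (activeWeight i) + ∑ A (λ x → star x i))
            ≈⟨ +-cong (activeWeight≈ good i) ≈-refl ⟩
          ∑ A (λ x → star x i) + ∑ A (activeGain i) - (∑ H (activeWeight i) + ∑ A (λ x → star x i))
            ≈⟨ solve 3 (λ s g h → (s :+ g) :- (h :+ s) := g :- h) ≈-refl _ _ _ ⟩
          ∑ A (activeGain i) - ∑ H (activeWeight i) ∎)
        where
        open ≤-Reasoning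
        both : ∑ (map (activeWeight i) H ++ map (λ x → star x i) A) id ≤ ∑ A (activeWeight i)
        both = layer-cake (map (activeWeight i) H ++ map (λ x → star x i) A) A (good-nonNegative good i) λ t 0<t →
          ≡.subst₂ ℕ._≤_
            (≡.sym (≡.trans (tally-++ t (map (activeWeight i) H) _ id) (cong₂ ℕ._+_ (tally-map t (activeWeight i) H id) (tally-map t _ A id))))
            (level-rank good i 0<t)
            (ℕₚ.+-monoˡ-≤ _ (tally-charges i 0<t))

    charge-bound : ∑ H totalCharge ≤ ∑ A totalGain
    charge-bound = begin
      ∑ H totalCharge                                  ≈⟨ ∑-comm H (allFin p) (λ h i → activeWeight i h) ⟩
      ∑ (allFin p) (λ i → ∑ H (activeWeight i))        ≤⟨ ∑-mono (allFin p) charge-one ⟩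
      ∑ (allFin p) (λ i → ∑ A (activeGain i))          ≈⟨ ∑-comm (allFin p) A activeGain ⟩
      ∑ A totalGain                                    ∎
      where open ≤-Reasoning

  -- Extracting a solution from the stack.

  blamed : Fin p → Fin p → Carrier → Carrier
  blamed i j x = if does (j Finₚ.≟ i) then x else 0#

  -- The edges are reconsidered in reverse order of arrival, given the set M
  -- of those already taken.  An edge is rejected, and constraint i blamed for
  -- it, when M and the older edges of at least its weight span it.
  -- levels says that the rejections are paid for by the stars of the chosen.
  record Selected (A : List (Entry (Fin m))) (M : List (Fin m)) : Set where
    field
      chosen      : List (Entry (Fin m))
      rejected    : List (Entry (Fin m) × Fin p)
      chosen⊆     : ∀ {x} → x ∈ˡ chosen → x ∈ˡ A
      rejected⊆   : ∀ {x} → x ∈ˡ rejected → proj₁ x ∈ˡ A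
      chosen∈     : edges chosen ∈ˡ sublists (edges A)
      independent : Independent (edges chosen ++ M)
      gains       : ∑ A gain ≈ ∑ chosen gain + ∑ rejected (gain ∘ proj₁)
      worth       : f ⊥ + ∑ chosen (λ x → gain x + totalStar x) ≤ f (fromList (edges chosen))
      levels      : ∀ i {t} → 0# < t →
        tally t rejected (λ (x , j) → blamed i j (weight x i)) ℕ.+ rank i (select i M ++ level i t A) ℕ.≤
        tally t rejected (λ (x , j) → blamed i j (star x i)) ℕ.+ tally t chosen (λ x → star x i)
          ℕ.+ (rank i (level i t A) ℕ.+ length (select i M))

  private
    -- Call rank of the level + length of M - rank of both together the overlap of M with the level.
    -- The invariant bounds the rejected weights by stars plus overlap, and a step compares the
    -- overlaps before and after. Adding the two inequalities and cancelling common terms replaces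
    -- subtraction.
    shuffle : ∀ {w r₁ s c r₀ l bw r₁′ r₀′ l′ bs ic} →
      w ℕ.+ r₁ ℕ.≤ s ℕ.+ c ℕ.+ (r₀ ℕ.+ l) → bw ℕ.+ r₁′ ℕ.+ r₀ ℕ.+ l ℕ.≤ bs ℕ.+ ic ℕ.+ r₁ ℕ.+ r₀′ ℕ.+ l′ →
      (bw ℕ.+ w) ℕ.+ r₁′ ℕ.≤ (bs ℕ.+ s) ℕ.+ (ic ℕ.+ c) ℕ.+ (r₀′ ℕ.+ l′)
    shuffle {w} {r₁} {s} {c} {r₀} {l} {bw} {r₁′} {r₀′} {l′} {bs} {ic} p q =
      ℕₚ.+-cancelʳ-≤ (r₁ ℕ.+ r₀ ℕ.+ l) _ _ (≡.subst₂ ℕ._≤_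
        (S.solve 6 (λ w r₁ bw r₁′ r₀ l → (w S.:+ r₁) S.:+ (bw S.:+ r₁′ S.:+ r₀ S.:+ l) S.:=
           ((bw S.:+ w) S.:+ r₁′) S.:+ (r₁ S.:+ r₀ S.:+ l)) refl w r₁ bw r₁′ r₀ l)
        (S.solve 9 (λ s c r₀ l bs ic r₁ r₀′ l′ → (s S.:+ c S.:+ (r₀ S.:+ l)) S.:+ (bs S.:+ ic S.:+ r₁ S.:+ r₀′ S.:+ l′) S.:=
           ((bs S.:+ s) S.:+ (ic S.:+ c) S.:+ (r₀′ S.:+ l′)) S.:+ (r₁ S.:+ r₀ S.:+ l)) refl s c r₀ l bs ic r₁ r₀′ l′)
        (ℕₚ.+-mono-≤ p q))
      where module S = +-*-Solver

    rank-middle : ∀ i xs ys e → rank i (xs ++ e ∷ ys) ≡ rank i (e ∷ xs ++ ys)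
    rank-middle i xs ys e = 𝓜.rank-cong i (xs ++ e ∷ ys) (e ∷ xs ++ ys)
      (↭ₚ.∈-resp-↭ (↭ₚ.shift e xs ys)) (↭ₚ.∈-resp-↭ (↭-sym (↭ₚ.shift e xs ys)))

    rank-≤suc : ∀ i e xs → rank i (e ∷ xs) ℕ.≤ suc (rank i xs)
    rank-≤suc i e xs with span? i xs e
    ... | yes s = subst (ℕ._≤ _) (≡.sym (𝓜.rank-spanned i {xs} {e} s)) (ℕₚ.n≤1+n _)
    ... | no ¬s = ℕₚ.≤-reflexive (𝓜.rank-unspanned i {xs} {e} ¬s)

  module _ (submodular : Submodular f) where

    private
      Blame : Entry (Fin m) → List (Entry (Fin m)) → List (Fin m) → Fin p → Set
      Blame x A M i = isActive (edge x) i ≡ true × Span i (select i M ++ level i (weight x i) A) (edge x)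

      -- Moving `x` from the stack into `M` raises the overlap only for t ≤ star, where the star
      -- pays. Above the weight of `x`, blamelessness makes `x` independent of `M` and the level, so
      -- the joint rank grows with the length of `M`. Between star and weight, `x` had already
      -- contributed to the rank of its level.
      take-step : ∀ {x A M} → Fits x A → (∀ i → ¬ Blame x A M i) → ∀ i {t} → 0# < t →
        rank i (select i M ++ level i t (x ∷ A)) ℕ.+ rank i (level i t A) ℕ.+ length (select i (edge x ∷ M)) ℕ.≤
        indicator t (star x i) ℕ.+ rank i (select i (edge x ∷ M) ++ level i t A) ℕ.+ rank i (level i t (x ∷ A)) ℕ.+ length (select i M)
      take-step {x} {A} {M} fits blameless i {t} 0<t with step i 0<t fits
      ... | inactive act l s _ rewrite l | s | act = ℕₚ.≤-refl
      ... | above act t≰ l s _ rewrite l | s | act | 𝓜.rank-unspanned i {select i M ++ level i t A} {edge x}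
              (λ sp → blameless i (act , 𝓜.span-mono i (select i M ++ level i t A) _
                (⊆ₚ.++⁺ʳ (select i M) (level-antitone i A (≰⇒≥ t≰))) sp)) =
              ℕₚ.≤-reflexive (ℕₚ.+-suc _ _)
      ... | spanned act _ l sp s _ rewrite l | s | act | rank-middle i (select i M) (level i t A) (edge x) | 𝓜.rank-spanned i {level i t A} {edge x} sp =
              ℕₚ.≤-reflexive (ℕₚ.+-suc _ _)
      ... | joins act _ l ¬sp s _ rewrite l | s | act | rank-middle i (select i M) (level i t A) (edge x) | 𝓜.rank-unspanned i {level i t A} {edge x} ¬sp =
              ℕₚ.≤-reflexive (≡.trans (ℕₚ.+-suc _ _) (cong (ℕ._+ length (select i M)) (≡.sym (ℕₚ.+-suc _ _))))

      -- For a constraint that is not blamed this is diminishing returns of rank. For the blamed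
      -- one, between star and weight, `x` raises the rank of its level but not the rank of the
      -- level joined with `M`; the extra unit of overlap pays for its weight.
      leave-step : ∀ {x A M j} → Fits x A → Blame x A M j → ∀ i {t} → 0# < t →
        indicator t (blamed i j (weight x i)) ℕ.+ rank i (select i M ++ level i t (x ∷ A)) ℕ.+ rank i (level i t A) ℕ.≤
        indicator t (blamed i j (star x i)) ℕ.+ rank i (select i M ++ level i t A) ℕ.+ rank i (level i t (x ∷ A))
      leave-step {x} {A} {M} {j} fits (actj , bl) i {t} 0<t with j Finₚ.≟ i
      leave-step {x} {A} {M} {j} fits (actj , bl) i {t} 0<t | no _
        rewrite indicator-no {t} {0#} (<⇒≰ 0<t) with step i 0<t fits
      ... | inactive _ l _ _ rewrite l = ℕₚ.≤-refl
      ... | above _ _ l _ _ rewrite l = ℕₚ.≤-refl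
      ... | spanned _ _ l sp _ _ rewrite l | rank-middle i (select i M) (level i t A) (edge x)
              | 𝓜.rank-spanned i {level i t A} {edge x} sp
              | 𝓜.rank-spanned i {select i M ++ level i t A} {edge x} (𝓜.span-mono i (level i t A) _ (∈ₚ.∈-++⁺ʳ (select i M)) sp) = ℕₚ.≤-refl
      ... | joins _ _ l ¬sp _ _ rewrite l | rank-middle i (select i M) (level i t A) (edge x) | 𝓜.rank-unspanned i {level i t A} {edge x} ¬sp =
              ℕₚ.≤-trans (ℕₚ.+-monoˡ-≤ _ (rank-≤suc i (edge x) (select i M ++ level i t A))) (ℕₚ.≤-reflexive (≡.sym (ℕₚ.+-suc _ _)))
      leave-step {x} {A} {M} {.i} fits (actj , bl) i {t} 0<t | yes refl with step i 0<t fits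
      ... | inactive act _ _ _ = false≢true act actj
      ... | above _ t≰ l s _ rewrite l | s | indicator-no t≰ = ℕₚ.≤-refl
      ... | spanned _ t≤ l sp s _ rewrite l | s | indicator-yes t≤ | rank-middle i (select i M) (level i t A) (edge x)
              | 𝓜.rank-spanned i {level i t A} {edge x} sp
              | 𝓜.rank-spanned i {select i M ++ level i t A} {edge x} (𝓜.span-mono i (level i t A) _ (∈ₚ.∈-++⁺ʳ (select i M)) sp) = ℕₚ.≤-refl
      ... | joins _ t≤ l ¬sp s _ rewrite l | s | indicator-yes t≤ | rank-middle i (select i M) (level i t A) (edge x)
              | 𝓜.rank-unspanned i {level i t A} {edge x} ¬sp
              | 𝓜.rank-spanned i {select i M ++ level i t A} {edge x} (𝓜.span-mono i (select i M ++ level i (weight x i) A) _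
                  (⊆ₚ.++⁺ʳ (select i M) (level-antitone i A t≤)) bl) =
              ℕₚ.≤-reflexive (≡.sym (ℕₚ.+-suc _ _))

    -- An edge is taken when no constraint can be blamed, which in particular keeps `M` independent.
    -- The remaining stack is then treated relative to the enlarged `M`, so the recursion carries
    -- `M` as an argument.
    selection : ∀ {A} → Good A → ∀ M → Independent M → Selected A M
    selection [] M ind = record
      { chosen = [] ; rejected = [] ; chosen⊆ = λ () ; rejected⊆ = λ () ; chosen∈ = here refl ; independent = ind
      ; gains = ≈-sym (+-identityʳ 0#) ; worth = ≤-reflexive (+-identityʳ (f ⊥))
      ; levels = λ i _ → subst (λ L → rank i L ℕ.≤ length (select i M)) (≡.sym (Listₚ.++-identityʳ (select i M))) (𝓜.rank≤length i (select i M))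
      }
    selection {x ∷ A} (fits ∷ good) M ind
      with Finₚ.any? (λ i → (isActive (edge x) i Boolₚ.≟ true) ×-dec span? i (select i M ++ level i (weight x i) A) (edge x))
    ... | yes (j , bl) = record
      { chosen = chosen ; rejected = (x , j) ∷ rejected
      ; chosen⊆ = there ∘ chosen⊆ ; rejected⊆ = λ { (here refl) → here refl ; (there y∈) → there (rejected⊆ y∈) }
      ; chosen∈ = sublists-∷ {xs = edges A} chosen∈ ; independent = independent
      ; gains = ≈-trans (+-cong ≈-refl gains) (solve 3 (λ g c r → g :+ (c :+ r) := c :+ (g :+ r)) ≈-refl _ _ _)
      ; worth = worth
      ; levels = λ i {t} 0<t → shuffle {r₁ = rank i (select i M ++ level i t A)}
          {tally t rejected (λ (x , j) → blamed i j (star x i))} {tally t chosen (λ x → star x i)} {rank i (level i t A)}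
           {l = length (select i M)}
          {bw = indicator t (blamed i j (weight x i))} {bs = indicator t (blamed i j (star x i))} {ic = 0} (levels i 0<t)
          (ℕₚ.+-monoˡ-≤ (length (select i M)) (ℕₚ.≤-trans (leave-step {M = M} fits bl i 0<t) (ℕₚ.≤-reflexive
            (cong (λ z → z ℕ.+ rank i (select i M ++ level i t A) ℕ.+ rank i (level i t (x ∷ A)))
              (≡.sym (ℕₚ.+-identityʳ (indicator t (blamed i j (star x i)))))))))
      }
      where open Selected (selection good M ind)
    ... | no blameless = record
      { chosen = x ∷ chosen ; rejected = rejected
      ; chosen⊆ = λ { (here refl) → here refl ; (there y∈) → there (chosen⊆ y∈) } ; rejected⊆ = there ∘ rejected⊆
      ; chosen∈ = ∈ₚ.∈-++⁺ˡ (∈ₚ.∈-map⁺ (edge x ∷_) chosen∈)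
      ; independent = λ i → 𝓜.ind-↭ i (select-↭ i (↭ₚ.shift (edge x) (edges chosen) M)) (independent i)
      ; gains = ≈-trans (+-cong ≈-refl gains) (≈-sym (+-assoc _ _ _))
      -- The chosen edges below `x` are among `A`, so by submodularity the increment of `x` over
      -- them is at least the recorded one, gain plus total star.
      ; worth = begin
          f ⊥ + (gain x + totalStar x + ∑ chosen (λ x → gain x + totalStar x))
            ≈⟨ solve 3 (λ a b c → a :+ (b :+ c) := (a :+ c) :+ b) ≈-refl _ _ _ ⟩
          f ⊥ + ∑ chosen (λ x → gain x + totalStar x) + (gain x + totalStar x)
            ≤⟨ +-mono-≤ worth (≤-reflexive (Fits.balance fits)) ⟩
          f (fromList (edges chosen)) + increment (edge x) (edges A)
            ≤⟨ +-mono-≤ ≤-refl (submodular (fromList-⊆ {xs = edges chosen} {edges A} (sublists-⊆ chosen∈))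
                 (Fits.fresh fits ∘ ∈-fromList⁻ (edges A))) ⟩
          f (fromList (edges chosen)) + increment (edge x) (edges chosen)
            ≈⟨ solve 2 (λ a b → a :+ (b :- a) := b) ≈-refl _ _ ⟩
          f (fromList (edges (x ∷ chosen))) ∎
      ; levels = λ i {t} 0<t → shuffle {r₁ = rank i (select i (edge x ∷ M) ++ level i t A)}
          {tally t rejected (λ (x , j) → blamed i j (star x i))} {tally t chosen (λ x → star x i)} {rank i (level i t A)}
           {l = length (select i (edge x ∷ M))}
          {bw = 0} {bs = 0} {ic = indicator t (star x i)} (levels i 0<t) (take-step {M = M} fits (λ i b → blameless (i , b)) i 0<t)
      }
      where
      open ≤-Reasoning
      extended : Independent (edge x ∷ M)
      extended i with isActive (edge x) i in act
      ... | false = ind i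
      ... | true  = 𝓜.unspanned⇒ind i (select i M) (select i M ++ level i (weight x i) A) (ind i) ∈ₚ.∈-++⁺ˡ
                      (λ s → blameless (i , act , s))
      open Selected (selection good (edge x ∷ M) extended)

  good-fits : ∀ {A} → Good A → ∀ {x} → x ∈ˡ A → ∃[ B ] Fits x B
  good-fits (fits ∷ _) (here refl) = _ , fits
  good-fits (_ ∷ good) (there x∈)  = good-fits good x∈

  module _ {A : List (Entry (Fin m))} (good : Good A) where

    private
      0≤star : ∀ {x} → x ∈ˡ A → ∀ i → 0# ≤ star x i
      0≤star x∈ = Fits.0≤star (proj₂ (good-fits good x∈))

      0≤gain : ∀ {x} → x ∈ˡ A → 0# ≤ gain x
      0≤gain x∈ = proj₁ (Fits.gain-positive (proj₂ (good-fits good x∈)))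

      0≤blamed : ∀ i j {x} → 0# ≤ x → 0# ≤ blamed i j x
      0≤blamed i j 0≤x with j Finₚ.≟ i
      ... | yes _ = 0≤x
      ... | no  _ = ≤-refl

      blamed-+ : ∀ i j x y → blamed i j (x + y) ≈ blamed i j x + blamed i j y
      blamed-+ i j x y with j Finₚ.≟ i
      ... | yes _ = ≈-refl
      ... | no  _ = ≈-sym (+-identityʳ 0#)

      ≤∑-blamed : ∀ j {x} → 0# ≤ x → x ≤ ∑ (allFin p) (λ i → blamed i j x)
      ≤∑-blamed j {x} 0≤x = ≤-trans (≤-reflexive (reflexive (≡.sym own)))
          (term≤∑ {xs = allFin p} {f = λ i → blamed i j x} (λ i → 0≤blamed i j 0≤x) (∈ₚ.∈-allFin j))
        where
        own : blamed j j x ≡ x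
        own rewrite dec-true (j Finₚ.≟ j) refl = refl

      ∑-mono-∈ : ∀ {X : Set} (xs : List X) {g h : X → Carrier} → (∀ {x} → x ∈ˡ xs → g x ≤ h x) → ∑ xs g ≤ ∑ xs h
      ∑-mono-∈ [] _ = ≤-refl
      ∑-mono-∈ (x ∷ xs) g≤h = +-mono-≤ (g≤h (here refl)) (∑-mono-∈ xs (g≤h ∘ there))

    -- For empty `M` the ranks in `levels` cancel, and layer-cake bounds the gains rejected by `i`
    -- by the i-stars of the chosen edges. Since `worth` credits every chosen edge with its stars
    -- besides its gain, all gains are recovered.
    good-solution : Submodular f → ∃[ M ] M ∈ˡ sublists (edges A) × Independent M × f ⊥ + ∑ A gain ≤ f (fromList M)
    good-solution submodular = edges chosen , chosen∈ ,
        subst Independent (Listₚ.++-identityʳ (edges chosen)) independent , (begin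
        f ⊥ + ∑ A gain                                        ≈⟨ +-cong ≈-refl gains ⟩
        f ⊥ + (∑ chosen gain + ∑ rejected (gain ∘ proj₁))     ≤⟨ +-mono-≤ ≤-refl (+-mono-≤ ≤-refl paid) ⟩
        f ⊥ + (∑ chosen gain + ∑ chosen totalStar)            ≈⟨ +-cong ≈-refl (∑-+ chosen gain totalStar) ⟨
        f ⊥ + ∑ chosen (λ x → gain x + totalStar x)           ≤⟨ worth ⟩
        f (fromList (edges chosen))                           ∎)
      where
      open ≤-Reasoning
      open Selected (selection submodular good [] (λ i → 𝓜.[]-ind i))
      bS bG bW : Fin p → Entry (Fin m) × Fin p → Carrier
      bS i (x , j) = blamed i j (star x i)
      bG i (x , j) = blamed i j (gain x)
      bW i (x , j) = blamed i j (weight x i)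
      money : Fin p → List Carrier
      money i = map (bS i) rejected ++ map (λ x → star x i) chosen
      0≤money : ∀ i {y} → y ∈ˡ money i → 0# ≤ y
      0≤money i y∈ with ∈ₚ.∈-++⁻ (map (bS i) rejected) y∈
      ... | inj₁ y∈ˡ with ∈ₚ.∈-map⁻ (bS i) y∈ˡ
      ...   | (x , j) , x∈ , refl = 0≤blamed i j (0≤star (rejected⊆ x∈) i)
      0≤money i y∈ | inj₂ y∈ʳ with ∈ₚ.∈-map⁻ (λ x → star x i) y∈ʳ
      ...   | x , x∈ , refl = 0≤star (chosen⊆ x∈) i
      tallies : ∀ i t → 0# < t → tally t rejected (bW i) ℕ.≤ tally t (money i) id
      tallies i t 0<t = ℕₚ.+-cancelʳ-≤ (rank i (level i t A)) _ _ (≡.subst (tally t rejected (bW i) ℕ.+ rank i (level i t A) ℕ.≤_)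
        (cong₂ ℕ._+_ (≡.sym (≡.trans (tally-++ t (map (bS i) rejected) _ id)
          (cong₂ ℕ._+_ (tally-map t (bS i) rejected id) (tally-map t _ chosen id)))) (ℕₚ.+-identityʳ _)) (levels i 0<t))
      paid-one : ∀ i → ∑ rejected (bG i) ≤ ∑ chosen (λ x → star x i)
      paid-one i = ≤-by _ (≤⇒0≤ (layer-cake rejected (money i) (0≤money i) (tallies i))) (begin-equality
        ∑ (money i) id - ∑ rejected (bW i)
          ≈⟨ +-cong (≈-trans (∑-++ (map (bS i) rejected) _ id) (+-cong (∑-map _ rejected id) (∑-map _ chosen id)))
               (-‿cong (≈-trans (∑-cong rejected (λ (x , j) → blamed-+ i j (star x i) (gain x))) (∑-+ rejected (bS i) (bG i)))) ⟩
        ∑ rejected (bS i) + ∑ chosen (λ x → star x i) - (∑ rejected (bS i) + ∑ rejected (bG i))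
          ≈⟨ solve 3 (λ s c g → (s :+ c) :- (s :+ g) := c :- g) ≈-refl _ _ _ ⟩
        ∑ chosen (λ x → star x i) - ∑ rejected (bG i) ∎)
      paid : ∑ rejected (gain ∘ proj₁) ≤ ∑ chosen totalStar
      paid = begin
        ∑ rejected (gain ∘ proj₁)                               ≤⟨ ∑-mono-∈ rejected (λ {(x , j)} x∈ → ≤∑-blamed j (0≤gain (rejected⊆ x∈))) ⟩
        ∑ rejected (λ y → ∑ (allFin p) (λ i → bG i y))          ≈⟨ ∑-comm rejected (allFin p) (λ y i → bG i y) ⟩
        ∑ (allFin p) (λ i → ∑ rejected (bG i))                  ≤⟨ ∑-mono (allFin p) paid-one ⟩
        ∑ (allFin p) (λ i → ∑ chosen (λ x → star x i))          ≈⟨ ∑-comm (allFin p) chosen (λ i x → star x i) ⟩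
        ∑ chosen totalStar                                      ∎

  -- Consequences of the acceptance threshold.

  module _ {x A} (fits : Fits x A) where

    private
      tot inc : Carrier
      tot = totalStar x
      inc = increment (edge x) (edges A)

    a*increment≤ : a * inc ≤ α * gain x
    a*increment≤ = ≤-by _ (≤⇒0≤ (Fits.threshold fits)) (begin-equality
      inc - α * tot                 ≈⟨ solve 3 (λ a i t → i :- (con (+ 1) :+ a) :* t := (con (+ 1) :+ a) :* (i :- t) :- a :* i) ≈-refl a inc tot ⟩
      α * (inc - tot) - a * inc     ≈⟨ +-cong (*-cong ≈-refl (+-cong (Fits.balance fits) ≈-refl)) ≈-refl ⟨
      α * (gain x + tot - tot) - a * inc ≈⟨ +-cong (*-cong ≈-refl (solve 2 (λ g t → (g :+ t) :- t := g) ≈-refl (gain x) tot)) ≈-refl ⟩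
      α * gain x - a * inc          ∎)
      where open ≤-Reasoning

    a*totalStar≤gain : a * tot ≤ gain x
    a*totalStar≤gain = ≤-by _ (≤⇒0≤ (Fits.threshold fits)) (begin-equality
      inc - α * tot                 ≈⟨ +-cong (Fits.balance fits) ≈-refl ⟨
      gain x + tot - α * tot        ≈⟨ solve 3 (λ a g t → (g :+ t) :- (con (+ 1) :+ a) :* t := g :- a :* t) ≈-refl a (gain x) tot ⟩
      gain x - a * tot              ∎)
      where open ≤-Reasoning

    star≤total : ∀ i → star x i ≤ tot
    star≤total i = term≤∑ {xs = allFin p} {f = star x} (Fits.0≤star fits) (∈ₚ.∈-allFin i)

    -- A single star is at most the total, and the threshold makes the gain at least `a` times the
    -- total. Hence an edge outweighs by a factor `α` whatever it displaces; this is the source of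
    -- the logarithm in the memory bound.
    α*star≤weight : ∀ i → α * star x i ≤ weight x i
    α*star≤weight i = begin
      α * star x i              ≈⟨ solve 2 (λ a s → (con (+ 1) :+ a) :* s := s :+ a :* s) ≈-refl a (star x i) ⟩
      star x i + a * star x i   ≤⟨ +-mono-≤ ≤-refl (≤-trans (*-monoˡ-≤ (proj₁ 0<a) (star≤total i)) a*totalStar≤gain) ⟩
      weight x i                ∎
      where open ≤-Reasoning

    weight≤increment : ∀ i → weight x i ≤ inc
    weight≤increment i = begin
      star x i + gain x   ≤⟨ +-mono-≤ (star≤total i) ≤-refl ⟩
      tot + gain x        ≈⟨ +-comm tot (gain x) ⟩
      gain x + tot        ≈⟨ Fits.balance fits ⟩
      inc                 ∎
      where open ≤-Reasoning

    increment-positive : 0# < inc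
    increment-positive = <-≤-trans (+-positive (Fits.gain-positive fits)
      (∑-nonNegative (allFin p) (λ {i} _ → Fits.0≤star fits i))) (≤-reflexive (Fits.balance fits))

  stack-value : ∀ {A} → Good A → a * f (fromList (edges A)) ≤ a * f ⊥ + α * ∑ A gain
  stack-value [] = ≤-reflexive (≈-sym (≈-trans (+-cong ≈-refl (zeroʳ α)) (+-identityʳ _)))
  stack-value {x ∷ A} (fits ∷ good) = begin
    a * f (fromList (edges (x ∷ A)))
      ≈⟨ solve 3 (λ a u v → a :* v := a :* u :+ a :* (v :- u)) ≈-refl a (f (fromList (edges A))) _ ⟩
    a * f (fromList (edges A)) + a * increment (edge x) (edges A)
      ≤⟨ +-mono-≤ (stack-value good) (a*increment≤ fits) ⟩
    a * f ⊥ + α * ∑ A gain + α * gain x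
      ≈⟨ solve 4 (λ b c s g → (b :+ c :* s) :+ c :* g := b :+ c :* (g :+ s)) ≈-refl (a * f ⊥) α (∑ A gain) (gain x) ⟩
    a * f ⊥ + α * ∑ (x ∷ A) gain ∎
    where open ≤-Reasoning

  indicator-cong : ∀ {t x y} → x ≈ y → indicator t x ≡ indicator t y
  indicator-cong {t} {x} {y} x≈y with t ≤? x | t ≤? y
  ... | yes _ | yes _ = refl
  ... | no  _ | no  _ = refl
  ... | yes p | no ¬q = ⊥-elim (¬q (≤-trans p (≤-reflexive x≈y)))
  ... | no ¬p | yes q = ⊥-elim (¬p (≤-trans q (≤-reflexive (≈-sym x≈y))))

  -- Chains of replacements and the size of the stack.

  private
    total-length : List (Carrier × ℕ) → ℕ
    total-length []            = 0
    total-length ((_ , ℓ) ∷ P) = ℓ ℕ.+ total-length P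

    total-length-↭ : ∀ {P Q} → P ↭ Q → total-length P ≡ total-length Q
    total-length-↭ _↭_.refl = refl
    total-length-↭ (prep (_ , ℓ) p) = cong (ℓ ℕ.+_) (total-length-↭ p)
    total-length-↭ (swap (_ , k) (_ , ℓ) p) rewrite total-length-↭ p = +-*-Solver.solve 3
      (λ k ℓ n → k +-*-Solver.:+ (ℓ +-*-Solver.:+ n) +-*-Solver.:= ℓ +-*-Solver.:+ (k +-*-Solver.:+ n)) refl k ℓ _
    total-length-↭ (_↭_.trans p q) = ≡.trans (total-length-↭ p) (total-length-↭ q)

    -- Finitely many weights cannot accumulate at `s`: if none equals `s`, the count at `s` persists
    -- on some interval above it.
    gap : ∀ s (P : List (Carrier × ℕ)) →
      (∃[ q ] ∃[ Q ] P ↭ q ∷ Q × proj₁ q ≈ s) ⊎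
      (∃[ t ] s < t × (∀ {u} → s < u → u ≤ t → tally u P proj₁ ≡ tally s P proj₁))
    gap s [] = inj₂ (s + 1# , x<x+1 s , λ _ _ → refl)
    gap s ((w , ℓ) ∷ P) with w ≟ s | gap s P
    ... | yes w≈s | _ = inj₁ ((w , ℓ) , P , ↭-refl , w≈s)
    ... | no _ | inj₁ (q , Q , p , q≈s) = inj₁ (q , _ ∷ Q , ↭-trans (prep _ p) (swap _ q ↭-refl) , q≈s)
    ... | no w≉s | inj₂ (t , s<t , const) with s ≤? w
    ...   | no s≰w = inj₂ (t , s<t , λ {u} s<u u≤t → cong₂ ℕ._+_
              (indicator-no {u} (λ u≤w → s≰w (≤-trans (proj₁ s<u) u≤w))) (const s<u u≤t))
    ...   | yes s≤w with t ≤? w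
    ...     | yes t≤w = inj₂ (t , s<t , λ {u} s<u u≤t → cong₂ ℕ._+_
              (indicator-yes {u} (≤-trans u≤t t≤w)) (const s<u u≤t))
    ...     | no t≰w = inj₂ (w , (s≤w , w≉s ∘ ≈-sym) , λ {u} s<u u≤w → cong₂ ℕ._+_
              (indicator-yes {u} u≤w) (const s<u (≤-trans u≤w (≰⇒≥ t≰w))))

    lowest : ∀ (P : List (Carrier × ℕ)) → (∀ {q} → q ∈ˡ P → 0# < proj₁ q) →
             ∃[ t ] 0# < t × (∀ {u} → 0# < u → u ≤ t → tally u P proj₁ ≡ length P)
    lowest [] _ = 1# , 0<1 , λ _ _ → refl
    lowest ((w , _) ∷ P) pos with lowest P (pos ∘ there)
    ... | t , 0<t , full with t ≤? w
    ...   | yes t≤w = t , 0<t , λ {u} 0<u u≤t → cong₂ ℕ._+_ (indicator-yes {u} (≤-trans u≤t t≤w)) (full 0<u u≤t)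
    ...   | no  t≰w = w , pos (here refl) , λ {u} 0<u u≤w → cong₂ ℕ._+_ (indicator-yes {u} u≤w) (full 0<u (≤-trans u≤w (≰⇒≥ t≰w)))

  module StackSize (W : Carrier) (N : ℕ)
    (ratio   : ∀ {X Y e e′} → X ⊆ˡ Y → e ∉ˡ Y → e′ ∉ˡ X → 0# < increment e′ X → increment e Y ≤ W * increment e′ X)
    (maximal : ∀ ℓ → a * α ^ ℓ ≤ α * α * W → ℓ ℕ.≤ N) where

    private
      -- A token (w , ℓ) stands for a chain of ℓ edges, each replacing the one
      -- before it in a basis of largest weight, the last one of weight w.
      record Valid (A : List (Entry (Fin m))) (q : Carrier × ℕ) : Set where
        field
          positive  : 0# < proj₁ q
          short     : proj₂ q ℕ.≤ N
          {first}   : Fin m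
          {before}  : List (Fin m)
          before⊆   : before ⊆ˡ edges A
          first∉    : first ∉ˡ before
          base>0    : 0# < increment first before
          geometric : a * α ^ proj₂ q * increment first before ≤ α * α * proj₁ q

      older : ∀ {x A q} → Valid A q → Valid (x ∷ A) q
      older v = record { Valid v ; before⊆ = there ∘ Valid.before⊆ v }

      module _ {x A} (fits : Fits x A) (i : Fin p) where

        -- The weight of `x` is at most its increment, hence at most `W` times the increment that
        -- began the chain. Against the geometric growth this caps the length `ℓ`.
        extended : ∀ {X e′ ℓ} → X ⊆ˡ edges A → e′ ∉ˡ X → 0# < increment e′ X →
                a * α ^ ℓ * increment e′ X ≤ α * α * weight x i → Valid (x ∷ A) (weight x i , ℓ)
        extended {X} {e′} {ℓ} X⊆ e′∉ base geo = record
          { positive = <-≤-trans (Fits.gain-positive fits) (x≤y+x (Fits.0≤star fits i))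
          ; short = maximal ℓ (*-cancelˡ-≤ base (begin
              inc′ * (a * α ^ ℓ)    ≈⟨ *-comm _ _ ⟩
              a * α ^ ℓ * inc′      ≤⟨ geo ⟩
              α * α * weight x i    ≤⟨ *-monoˡ-≤ 0≤αα (≤-trans (weight≤increment fits i) (ratio X⊆ (Fits.fresh fits) e′∉ base)) ⟩
              α * α * (W * inc′)    ≈⟨ solve 3 (λ c w i → c :* (w :* i) := i :* (c :* w)) ≈-refl (α * α) W inc′ ⟩
              inc′ * (α * α * W)    ∎))
          ; before⊆ = there ∘ X⊆ ; first∉ = e′∉ ; base>0 = base ; geometric = geo
          }
          where
          open ≤-Reasoning
          inc′ = increment e′ X
          0≤αα = *-nonNegative (proj₁ α-positive) (proj₁ α-positive)

        -- The first edge has weight at least its gain, which is at least `a / α` times its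
        -- increment. This costs one factor `α` in `geometric`; the other appears because the first
        -- edge counts towards the length.
        singleton : Valid (x ∷ A) (weight x i , 1)
        singleton = extended id (Fits.fresh fits) (increment-positive fits) (begin
            a * (α * 1#) * inc     ≈⟨ solve 3 (λ a c i → a :* (c :* con (+ 1)) :* i := c :* (a :* i)) ≈-refl a α inc ⟩
            α * (a * inc)          ≤⟨ *-monoˡ-≤ (proj₁ α-positive) (≤-trans (a*increment≤ fits) (*-monoˡ-≤ (proj₁ α-positive)
                                        (x≤y+x (Fits.0≤star fits i)))) ⟩
            α * (α * weight x i)   ≈⟨ *-assoc _ _ _ ⟨
            α * α * weight x i     ∎)
          where
          open ≤-Reasoning
          inc = increment (edge x) (edges A)

        longer : ∀ {w ℓ} → w ≈ star x i → Valid A (w , ℓ) → Valid (x ∷ A) (weight x i , suc ℓ)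
        longer {w} {ℓ} w≈ v = extended before⊆ first∉ base>0 (begin
            a * (α * α ^ ℓ) * inc′     ≈⟨ solve 4 (λ a c d i → a :* (c :* d) :* i := c :* (a :* d :* i)) ≈-refl a α (α ^ ℓ) inc′ ⟩
            α * (a * α ^ ℓ * inc′)     ≤⟨ *-monoˡ-≤ (proj₁ α-positive) geometric ⟩
            α * (α * α * w)            ≈⟨ solve 2 (λ c w → c :* (c :* c :* w) := c :* c :* (c :* w)) ≈-refl α w ⟩
            α * α * (α * w)            ≈⟨ *-cong ≈-refl (*-cong ≈-refl w≈) ⟩
            α * α * (α * star x i)     ≤⟨ *-monoˡ-≤ (*-nonNegative (proj₁ α-positive) (proj₁ α-positive)) (α*star≤weight fits i) ⟩
            α * α * weight x i         ∎)
          where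
          open ≤-Reasoning
          open Valid v
          inc′ = increment first before

      -- By `ranks` the token weights are those of a heaviest basis of the active edges; by `counts`
      -- the chain lengths add up to the number of active edges.
      record Tokens (i : Fin p) (A : List (Entry (Fin m))) : Set where
        field
          tokens : List (Carrier × ℕ)
          valid  : ∀ {q} → q ∈ˡ tokens → Valid A q
          ranks  : ∀ {t} → 0# < t → tally t tokens proj₁ ≡ rank i (level i t A)
          counts : total-length tokens ≡ length (select i (edges A))

      module _ {i x A} (fits : Fits x A) (act : isActive (edge x) i ≡ true) (T : Tokens i A) where
        open Tokens T

        private
          open-token : ¬ 0# < star x i → ∀ {t} → 0# < t →
                       indicator t (weight x i) ℕ.+ tally t tokens proj₁ ≡ rank i (level i t (x ∷ A))
          open-token ¬0<s {t} 0<t with step i 0<t fits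
          ... | inactive ¬act _ _ _ = false≢true ¬act act
          ... | above _ t≰ l _ _ rewrite l | indicator-no t≰ = ranks 0<t
          ... | spanned _ _ _ sp _ _ = ⊥-elim (¬0<s (<-≤-trans 0<t (Fits.span⇒star fits i act sp)))
          ... | joins _ t≤ l ¬sp _ _ rewrite l | indicator-yes t≤ | 𝓜.rank-unspanned i {level i t A} {edge x} ¬sp = cong suc (ranks 0<t)

          move-token : ∀ {w ℓ Q} → tokens ↭ (w , ℓ) ∷ Q → w ≈ star x i → ∀ {t} → 0# < t →
                       indicator t (weight x i) ℕ.+ tally t Q proj₁ ≡ rank i (level i t (x ∷ A))
          move-token {w} {ℓ} {Q} p w≈ {t} 0<t with step i 0<t fits | ≡.trans (≡.sym (tally-↭ t proj₁ p)) (ranks 0<t)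
          ... | inactive ¬act _ _ _ | _ = false≢true ¬act act
          ... | above _ t≰ l s _ | r rewrite l | indicator-no t≰ | indicator-cong {t} w≈ | s = r
          ... | spanned _ t≤ l sp s _ | r rewrite l | indicator-yes t≤ | indicator-cong {t} w≈ | s
                  | 𝓜.rank-spanned i {level i t A} {edge x} sp = r
          ... | joins _ t≤ l ¬sp s _ | r rewrite l | indicator-yes t≤ | indicator-cong {t} w≈ | s
                  | 𝓜.rank-unspanned i {level i t A} {edge x} ¬sp = cong suc r

          -- If the count just above the star equals the count at the star, the two levels have
          -- equal rank and so the same span. The higher level would then span the edge, against the
          -- maximality of the star.
          no-gap : 0# < star x i → ∀ {t} → star x i < t → tally t tokens proj₁ ≡ tally (star x i) tokens proj₁ → ∀ {ℓ} {B : Set ℓ} → B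
          no-gap 0<s {t} s<t eq = ⊥-elim (<⇒≰ s<t (Fits.span⇒star fits i act
            (𝓜.equal-rank i (level i t A) (level i (star x i) A) (level-antitone i A (proj₁ s<t))
              (ℕₚ.≤-reflexive (≡.trans (≡.sym (ranks 0<s)) (≡.trans (≡.sym eq) (ranks (<-≤-trans 0<s (proj₁ s<t))))))
              (Fits.star⇒span fits i act 0<s ≤-refl))))

          counts′ : ∀ {n} → n ≡ suc (total-length tokens) → n ≡ length (select i (edge x ∷ edges A))
          counts′ eq rewrite act = ≡.trans eq (cong suc counts)

        -- A positive star is the weight of some token, that of the basis element which the edge
        -- displaces, and its chain grows by one. A star of 0 means that nothing is displaced, and a
        -- new chain begins.
        advance : Tokens i (x ∷ A)
        advance with star x i ≤? 0# | gap (star x i) tokens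
        ... | yes s≤0 | _ = record
          { tokens = (weight x i , 1) ∷ tokens
          ; valid  = λ { (here refl) → singleton fits i ; (there q∈) → older (valid q∈) }
          ; ranks  = open-token (λ 0<s → <⇒≰ 0<s s≤0)
          ; counts = counts′ refl
          }
        ... | no s≰0 | inj₂ (t , s<t , const) = no-gap (≰⇒> s≰0) s<t (const s<t ≤-refl)
        ... | no s≰0 | inj₁ ((w , ℓ) , Q , p , w≈s) = record
          { tokens = (weight x i , suc ℓ) ∷ Q
          ; valid  = λ { (here refl) → longer fits i w≈s (valid (↭ₚ.∈-resp-↭ (↭-sym p) (here refl)))
                       ; (there q∈) → older (valid (↭ₚ.∈-resp-↭ (↭-sym p) (there q∈))) }
          ; ranks  = move-token p w≈s
          ; counts = counts′ (cong suc (≡.sym (total-length-↭ p)))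
          }

      allTokens : ∀ {A} → Good A → ∀ i → Tokens i A
      allTokens [] i = record { tokens = [] ; valid = λ () ; ranks = λ _ → refl ; counts = refl }
      allTokens {x ∷ A} (fits ∷ good) i with bool (isActive (edge x) i)
      ... | inj₁ act = advance fits act (allTokens good i)
      ... | inj₂ act = record
        { tokens = tokens ; valid = older ∘ valid
        ; ranks = λ {t} 0<t → ≡.trans (ranks 0<t) (cong (rank i) (≡.sym (level-inactive i {t} {x} A act)))
        ; counts = ≡.trans counts (cong length (≡.sym skip))
        }
        where
        open Tokens (allTokens good i)
        skip : select i (edge x ∷ edges A) ≡ select i (edges A)
        skip rewrite act = refl

    -- At a level below all token weights every token is counted, so the number of chains is a rank
    -- and at most `b`.
    active-count : ∀ {A} → Good A → ∀ i {b} → (∀ {xs} → Ind i xs → length xs ℕ.≤ b) →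
                   length (select i (edges A)) ℕ.≤ N ℕ.* b
    active-count {A} good i {b} bound with allTokens good i
    ... | T with lowest (Tokens.tokens T) (Valid.positive ∘ Tokens.valid T)
    ...   | t , 0<t , full = subst (ℕ._≤ N ℕ.* b) counts (ℕₚ.≤-trans (each tokens (Valid.short ∘ valid)) (ℕₚ.*-monoʳ-≤ N
              (subst (ℕ._≤ b) (≡.trans (≡.sym (ranks 0<t)) (full 0<t ≤-refl)) (bound (𝓜.basis-ind i (level i t A))))))
      where
      open Tokens T
      each : ∀ P → (∀ {q} → q ∈ˡ P → proj₂ q ℕ.≤ N) → total-length P ℕ.≤ N ℕ.* length P
      each [] _ = ℕ.z≤n
      each (q ∷ P) short = subst (proj₂ q ℕ.+ total-length P ℕ.≤_) (≡.sym (ℕₚ.*-suc N (length P)))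
        (ℕₚ.+-mono-≤ (short (here refl)) (each P (short ∘ there)))

-- Expectation and certainty on probability trees.

module OutcomeProperties (R : EuclideanField) where
  open OrderedField R
  open Streaming R

  module _ {a b} {A : Set a} {B : Set b} where

    𝔼->>= : ∀ {μ} (h : B → Carrier) (t : Outcome A μ) (k : A → Outcome B μ) →
            𝔼 h (t >>= k) ≡ 𝔼 (λ x → 𝔼 h (k x)) t
    𝔼->>= h (pure x) k = refl
    𝔼->>= h (flip p _ _ s t) k = cong₂ (λ x y → p * x + (1# - p) * y) (𝔼->>= h s k) (𝔼->>= h t k)

    Always->>= : ∀ {μ ℓ} {P : B → Set ℓ} (t : Outcome A μ) {k : A → Outcome B μ} →
                 Always (λ x → Always P (k x)) t → Always P (t >>= k)
    Always->>= (pure x) all = all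
    Always->>= (flip _ _ _ s t) (all-s , all-t) = Always->>= s all-s , Always->>= t all-t

    >>=-cong : ∀ {μ} (t : Outcome A μ) {k l : A → Outcome B μ} → (∀ x → k x ≡ l x) → (t >>= k) ≡ (t >>= l)
    >>=-cong (pure x) k≡l = k≡l x
    >>=-cong (flip p 0≤p p≤1 s t) k≡l = cong₂ (flip p 0≤p p≤1) (>>=-cong s k≡l) (>>=-cong t k≡l)

  >>=-assoc : ∀ {a b c μ} {A : Set a} {B : Set b} {C : Set c} (t : Outcome A μ) (k : A → Outcome B μ) (l : B → Outcome C μ) →
              (t >>= k >>= l) ≡ (t >>= λ x → k x >>= l)
  >>=-assoc (pure x) k l = refl
  >>=-assoc (flip p 0≤p p≤1 s t) k l = cong₂ (flip p 0≤p p≤1) (>>=-assoc s k l) (>>=-assoc t k l)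

  module _ {a} {A : Set a} where

    Always-const : ∀ {μ ℓ} {P : A → Set ℓ} (t : Outcome A μ) → (∀ x → P x) → Always P t
    Always-const (pure x) all = all x
    Always-const (flip _ _ _ s t) all = Always-const s all , Always-const t all

    Always-map : ∀ {μ ℓ ℓ′} {P : A → Set ℓ} {Q : A → Set ℓ′} (t : Outcome A μ) → (∀ {x} → P x → Q x) → Always P t → Always Q t
    Always-map (pure x) f all = f all
    Always-map (flip _ _ _ s t) f (all-s , all-t) = Always-map s f all-s , Always-map t f all-t

    convex-≤ : ∀ {p x y z} → 0# ≤ p → p ≤ 1# → x ≤ z → y ≤ z → p * x + (1# - p) * y ≤ z
    convex-≤ {p} {x} {y} {z} 0≤p p≤1 x≤z y≤z = begin
      p * x + (1# - p) * y   ≤⟨ +-mono-≤ (*-monoˡ-≤ 0≤p x≤z) (*-monoˡ-≤ (≤⇒0≤ p≤1) y≤z) ⟩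
      p * z + (1# - p) * z   ≈⟨ solve 2 (λ p z → p :* z :+ (con (+ 1) :- p) :* z := z) ≈-refl p z ⟩
      z                      ∎
      where open ≤-Reasoning

    𝔼-mono : ∀ {μ} {g h : A → Carrier} (t : Outcome A μ) → Always (λ x → g x ≤ h x) t → 𝔼 g t ≤ 𝔼 h t
    𝔼-mono (pure x) g≤h = g≤h
    𝔼-mono (flip p 0≤p p≤1 s t) (all-s , all-t) =
      +-mono-≤ (*-monoˡ-≤ 0≤p (𝔼-mono s all-s)) (*-monoˡ-≤ (≤⇒0≤ p≤1) (𝔼-mono t all-t))

    𝔼-+ : ∀ {μ} (g h : A → Carrier) (t : Outcome A μ) → 𝔼 (λ x → g x + h x) t ≈ 𝔼 g t + 𝔼 h t
    𝔼-+ g h (pure x) = ≈-refl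
    𝔼-+ g h (flip p _ _ s t) = ≈-trans (+-cong (*-cong ≈-refl (𝔼-+ g h s)) (*-cong ≈-refl (𝔼-+ g h t)))
      (solve 5 (λ p a b c d → p :* (a :+ b) :+ (con (+ 1) :- p) :* (c :+ d) :=
        (p :* a :+ (con (+ 1) :- p) :* c) :+ (p :* b :+ (con (+ 1) :- p) :* d)) ≈-refl p (𝔼 g s) (𝔼 h s) (𝔼 g t) (𝔼 h t))

    𝔼-* : ∀ {μ} c (g : A → Carrier) (t : Outcome A μ) → 𝔼 (λ x → c * g x) t ≈ c * 𝔼 g t
    𝔼-* c g (pure x) = ≈-refl
    𝔼-* c g (flip p _ _ s t) = ≈-trans (+-cong (*-cong ≈-refl (𝔼-* c g s)) (*-cong ≈-refl (𝔼-* c g t)))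
      (solve 4 (λ p c a b → p :* (c :* a) :+ (con (+ 1) :- p) :* (c :* b) :=
        c :* (p :* a :+ (con (+ 1) :- p) :* b)) ≈-refl p c (𝔼 g s) (𝔼 g t))

-- The random evolution of the stack.

module Process (R : EuclideanField)
  (a : EuclideanField.Carrier R) (0<a : EuclideanField._<_ R (EuclideanField.0# R) a) {p m : ℕ}
  (isActive : Fin m → Fin p → Bool) (matroid : Fin p → ListMatroid m) (f : Subset m → EuclideanField.Carrier R)
  {μ : Mode} (coin : Streaming.Outcome R Bool μ) where

  open OrderedField R
  open LocalRatio R (1# + a) p
  open Analysis R a 0<a isActive matroid f
  open Procedure oracle
  open 𝓜 using (Ind)
  open Streaming R
  open OutcomeProperties R

  feasible⁻ : ∀ xs → feasible xs ≡ true → Independent xs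
  feasible⁻ xs ok i with select i xs in eq
  ... | [] = 𝓜.[]-ind i
  ... | y ∷ ys with ∈-select⁻ i {y} xs (subst (y ∈ˡ_) (≡.sym eq) (here refl))
  ...   | y∈ , act = subst (Ind i) eq (does-true (𝓜.ind? i (select i xs))
            (implies (all-true (allFin p) (all-true xs ok y∈) (∈ₚ.∈-allFin i)) act))

  feasible⁺ : ∀ xs → Independent xs → feasible xs ≡ true
  feasible⁺ xs ind = all-true⁻ xs λ _ → all-true⁻ (allFin p) λ {i} _ → implies⁻ λ _ → dec-true (𝓜.ind? i (select i xs)) (ind i)

  best-independent : ∀ xss → Independent (best xss)
  best-independent [] i = 𝓜.[]-ind i
  best-independent (xs ∷ xss) with feasible xs in ok | value (best xss) ≤? value xs
  ... | true  | yes _ = feasible⁻ xs ok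
  ... | true  | no  _ = best-independent xss
  ... | false | _     = best-independent xss

  best-maximal : ∀ {xs} xss → xs ∈ˡ xss → Independent xs → value xs ≤ value (best xss)
  best-maximal (ys ∷ xss) (here refl) ind rewrite feasible⁺ ys ind with value (best xss) ≤? value ys
  ... | yes _ = ≤-refl
  ... | no ≰  = ≰⇒≥ ≰
  best-maximal (ys ∷ xss) (there xs∈) ind with feasible ys | value (best xss) ≤? value ys
  ... | true  | yes ≤ys = ≤-trans (best-maximal xss xs∈ ind) ≤ys
  ... | true  | no  _   = best-maximal xss xs∈ ind
  ... | false | _       = best-maximal xss xs∈ ind

  gains : List (Fin m) → Carrier
  gains S = ∑ (annotate S) gain

  choose-value : Submodular f → ∀ {S} → Good (annotate S) → f ⊥ + gains S ≤ value (choose S)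
  choose-value submodular {S} good with good-solution good submodular
  ... | M , M∈ , ind , worth = ≤-trans worth
          (best-maximal (sublists S) (subst (λ T → M ∈ˡ sublists T) (edges-annotate S) M∈) ind)

  grow : Bool → Fin m → List (Fin m) → List (Fin m)
  grow b e S = if b then e ∷ S else S

  decide : Fin m → List (Fin m) → Outcome Bool μ
  decide e S = if accepts e S then coin else pure false

  runStack : List (Fin m) → List (Fin m) → Outcome (List (Fin m)) μ
  runStack S []       = pure S
  runStack S (e ∷ es) = decide e S >>= λ b → runStack (grow b e S) es

  record Fresh (S es : List (Fin m)) : Set where
    field
      good   : Good (annotate S)
      unique : Unique es
      apart  : ∀ {e} → e ∈ˡ es → e ∉ˡ S

  initially : ∀ {es} → Unique es → Fresh [] es
  initially u = record { good = [] ; unique = u ; apart = λ _ () }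

  skip : ∀ {S e es} → Fresh S (e ∷ es) → Fresh S es
  skip F with Fresh.unique F
  ... | _ ∷ u = record { good = Fresh.good F ; unique = u ; apart = Fresh.apart F ∘ there }

  push : ∀ {S e es} → accepts e S ≡ true → Fresh S (e ∷ es) → Fresh (e ∷ S) es
  push {S} {e} acc F with Fresh.unique F
  ... | e∉es ∷ u = record
    { good = accepted-fits acc (Fresh.apart F (here refl)) (Fresh.good F) ; unique = u
    ; apart = λ { x∈ (here refl) → All.lookup e∉es x∈ refl ; x∈ (there x∈S) → Fresh.apart F (there x∈) x∈S } }

  run-fresh : ∀ S es → Fresh S es → Always (λ S → Fresh S []) (runStack S es)
  run-fresh S [] F = F
  run-fresh S (e ∷ es) F with accepts e S in acc
  ... | false = run-fresh S es (skip F)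
  ... | true  = Always->>= coin (Always-const coin λ
    { true → run-fresh (e ∷ S) es (push acc F) ; false → run-fresh S es (skip F) })

  fresh-unique : ∀ {A} → Good A → Unique (edges A)
  fresh-unique [] = []
  fresh-unique (fits ∷ good) = All.tabulate (λ y∈ x≡y → Fits.fresh fits (subst (_∈ˡ _) (≡.sym x≡y) y∈)) ∷ fresh-unique good

  stack-unique : ∀ {S} → Good (annotate S) → Unique S
  stack-unique {S} good = subst Unique (edges-annotate S) (fresh-unique good)

  always-good : ∀ {ℓ} {Q : List (Fin m) → Set ℓ} {stream} → Unique stream →
                (∀ {S} → Good (annotate S) → Q S) → Always Q (runStack [] stream)
  always-good {stream = stream} u good⇒ =
    Always-map (runStack [] stream) (good⇒ ∘ Fresh.good) (run-fresh [] stream (initially u))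

  module Expectation (q : Carrier) (0≤q : 0# ≤ q) (q≤1 : q ≤ 1#)
    (coin-law : ∀ (h : Bool → Carrier) → 𝔼 h coin ≈ q * h true + (1# - q) * h false) where

    𝔼-step : ∀ (h : List (Fin m) → Carrier) e S es → accepts e S ≡ true →
             𝔼 h (runStack S (e ∷ es)) ≈ q * 𝔼 h (runStack (e ∷ S) es) + (1# - q) * 𝔼 h (runStack S es)
    𝔼-step h e S es acc rewrite acc = ≈-trans (reflexive (𝔼->>= h coin _)) (coin-law _)

    𝔼-reject : ∀ (h : List (Fin m) → Carrier) e S es → accepts e S ≡ false →
               𝔼 h (runStack S (e ∷ es)) ≡ 𝔼 h (runStack S es)
    𝔼-reject h e S es rej rewrite rej = refl

    module Charging
      (D : Carrier) (degree : ∀ e x → ∑ (allFin p) (λ i → restrict e i x) ≈ D * x)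
      (Q : Subset m → List (Fin m) → Carrier) (κ : Carrier)
      (Q-skip : ∀ {X e S} → e ∉ X → e ∉ˡ S → Q X (e ∷ S) ≤ Q X S)
      (Q-both : ∀ {X e S} → e ∉ X → e ∉ˡ S → Q (X ∪ ⁅ e ⁆) (e ∷ S) ≤ Q X S + κ * increment e S)
      (Q-only : ∀ {X e S} → e ∉ X → e ∉ˡ S → Q (X ∪ ⁅ e ⁆) S ≤ Q X S + increment e S)
      (κ-star : q * κ + (1# - q) ≤ α) (κ-gain : q * κ + (1# - q) ≤ q * (α * D))
      (O : Subset m) (independent : ∀ {xs} → Unique xs → (∀ {x} → x ∈ˡ xs → x ∈ O) → Independent xs)
      where

      -- `Q X S` measures what the part `X` of the optimum is worth in view of the stack: its weight
      -- for linear functions, its marginal value over `S` for submodular ones. `κ` is the rate at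
      -- which `Q` grows when an edge enters both arguments, 1 in the first use and 0 in the second.
      potential : List (Fin m) → Carrier
      potential S = Q O S - α * ∑ (annotate S) totalGain

      record Ledger (S es : List (Fin m)) (H : List (Entry (Fin m))) : Set where
        field
          fresh    : Fresh S es
          charged  : ∀ {h} → h ∈ˡ H → Charged (annotate S) h
          within   : ∀ {e} → e ∈ˡ edges H → e ∈ O
          distinct : Unique (edges H)
          disjoint : ∀ {e} → e ∈ˡ es → e ∉ˡ edges H
          covers   : ∀ {e} → e ∈ O → e ∈ˡ edges H ⊎ e ∈ˡ es

      private
        charged-∷ : ∀ e S {h} → Charged (annotate S) h → Charged (annotate (e ∷ S)) h
        charged-∷ e S ch i act {t} 0<t t≤ = 𝓜.span-mono i (level i t (annotate S)) (level i t (annotate (e ∷ S)))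
          (level-∷ i t (entry e (increment e S - penalty e (annotate S)) (Vec.tabulate (λ i → starOf i e (annotate S)))) (annotate S)) (ch i act 0<t t≤)

        unrecorded : ∀ {S e es H} → e ∉ O → Ledger S (e ∷ es) H → ∀ {x} → x ∈ O → x ∈ˡ edges H ⊎ x ∈ˡ es
        unrecorded e∉O L x∈O with Ledger.covers L x∈O
        ... | inj₁ x∈H = inj₁ x∈H
        ... | inj₂ (here refl) = ⊥-elim (e∉O x∈O)
        ... | inj₂ (there x∈es) = inj₂ x∈es

        ledger-skip : ∀ {S e es H} → e ∉ O → Ledger S (e ∷ es) H → Ledger S es H
        ledger-skip e∉O L = record
          { fresh = skip fresh ; charged = charged ; within = within ; distinct = distinct
          ; disjoint = disjoint ∘ there ; covers = unrecorded e∉O L }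
          where open Ledger L

        ledger-push : ∀ {S e es H} → accepts e S ≡ true → e ∉ O → Ledger S (e ∷ es) H → Ledger (e ∷ S) es H
        ledger-push {S} {e} acc e∉O L = record
          { fresh = push acc fresh ; charged = λ {h} h∈ → charged-∷ e S {h} (charged h∈) ; within = within ; distinct = distinct
          ; disjoint = disjoint ∘ there ; covers = unrecorded e∉O L }
          where open Ledger L

        ledger-record : ∀ {S e es H S′ x} → edge x ≡ e → e ∈ O → Ledger S (e ∷ es) H → Fresh S′ es →
                        (∀ {h} → h ∈ˡ H → Charged (annotate S′) h) → Charged (annotate S′) x → Ledger S′ es (x ∷ H)
        ledger-record {e = e} {H = H} refl e∈O L F chH chx = record
          { fresh = F
          ; charged = λ { (here refl) → chx ; (there h∈) → chH h∈ }
          ; within = λ { (here refl) → e∈O ; (there h∈) → within h∈ }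
          ; distinct = All.tabulate (λ y∈ e≡y → disjoint (here refl) (subst (_∈ˡ edges H) (≡.sym e≡y) y∈)) ∷ distinct
          ; disjoint = λ { y∈ (here refl) → case Fresh.unique fresh of λ { (e∉ ∷ _) → All.lookup e∉ y∈ refl }
                         ; y∈ (there y∈H) → disjoint (there y∈) y∈H }
          ; covers = λ y∈O → case covers y∈O of λ
              { (inj₁ y∈H) → inj₁ (there y∈H) ; (inj₂ (here refl)) → inj₁ (here refl) ; (inj₂ (there y∈es)) → inj₂ y∈es }
          }
          where open Ledger L

        -- The zero is not the gain of the edge. It makes the record's weights equal to the stars,
        -- the levels up to which the stack spans an edge that stays outside it.
        refused : Fin m → List (Fin m) → Entry (Fin m)
        refused e S = entry e 0# (Vec.tabulate (λ i → starOf i e (annotate S)))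

        refused-charged : ∀ e S → Charged (annotate S) (refused e S)
        refused-charged e S i act {t} 0<t t≤ = starOf-spans i e (annotate S) act 0<t (≤-trans t≤
          (≤-reflexive (≈-trans (+-identityʳ _) (reflexive (Vecₚ.lookup∘tabulate (λ i → starOf i e (annotate S)) i)))))

        accepted-charged : ∀ x A → Charged (x ∷ A) x
        accepted-charged x A i act {t} 0<t t≤ = 𝓜.∈⇒span i (level i t (x ∷ A)) (∈-level⁺ i t (x ∷ A) (here refl) act t≤)

        restrict-star : ∀ e S i g → restrict e i (Vec.lookup (Vec.tabulate (λ i → starOf i e (annotate S))) i + g) ≈
                                    starOf i e (annotate S) + restrict e i g
        restrict-star e S i g rewrite Vecₚ.lookup∘tabulate (λ i → starOf i e (annotate S)) i with isActive e i
        ... | true  = ≈-refl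
        ... | false = ≈-sym (+-identityʳ 0#)

        charge≈ : ∀ e S g → totalCharge (entry e g (Vec.tabulate (λ i → starOf i e (annotate S)))) ≈ penalty e (annotate S) + D * g
        charge≈ e S g = ≈-trans (∑-cong (allFin p) (λ i → restrict-star e S i g))
          (≈-trans (∑-+ (allFin p) (λ i → starOf i e (annotate S)) (λ i → restrict e i g)) (+-cong ≈-refl (degree e g)))

        bill : List (Fin m) → List (Entry (Fin m)) → Carrier
        bill S H = Q (fromList (edges H)) S - α * ∑ H totalCharge

      -- A supermartingale argument: the bill values the optimal edges seen so far minus α times
      -- their charges and does not increase in expectation. At the end the records exhaust `O`, and
      -- `charge-bound` replaces the charges by the gains.
      expected-potential : ∀ es S H → Ledger S es H → 𝔼 potential (runStack S es) ≤ bill S H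
      expected-potential [] S H L = begin
          Q O S - α * ∑ (annotate S) totalGain
            ≡⟨ cong (λ X → Q X S - α * ∑ (annotate S) totalGain) O≡ ⟩
          Q (fromList (edges H)) S - α * ∑ (annotate S) totalGain
            ≤⟨ ≤-by (α * (∑ (annotate S) totalGain - ∑ H totalCharge))
                 (*-nonNegative (proj₁ α-positive) (≤⇒0≤ (charge-bound (Fresh.good fresh) charged distinct (independent distinct within))))
                 (solve 4 (λ c q g h → c :* (g :- h) := (q :- c :* h) :- (q :- c :* g)) ≈-refl α _ _ _) ⟩
          bill S H ∎
        where
        open ≤-Reasoning
        open Ledger L
        O≡ : O ≡ fromList (edges H)
        O≡ = Subsetₚ.⊆-antisym
          (λ x∈ → case covers x∈ of λ { (inj₁ x∈H) → ∈-fromList⁺ x∈H ; (inj₂ ()) })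
          (within ∘ ∈-fromList⁻ (edges H))
      expected-potential (e ∷ es) S H L = go (bool (accepts e S)) (e Subsetₚ.∈? O)
        where
        open ≤-Reasoning
        open Ledger L
        pen inc : Carrier
        pen = penalty e (annotate S)
        inc = increment e S
        X = fromList (edges H)
        e∉S : e ∉ˡ S
        e∉S = Fresh.apart fresh (here refl)
        e∉X : e ∉ X
        e∉X e∈ = disjoint (here refl) (∈-fromList⁻ (edges H) e∈)
        nonloop-O : e ∈ O → NonLoop e
        nonloop-O e∈O i act = subst (Ind i) sel (independent {e ∷ []} ([] ∷ []) (λ { (here refl) → e∈O }) i)
          where
          sel : select i (e ∷ []) ≡ e ∷ []
          sel rewrite act = refl
        refuse : e ∈ O → 𝔼 potential (runStack S es) ≤ bill S H + (inc - α * pen)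
        refuse e∈O = begin
          𝔼 potential (runStack S es)
            ≤⟨ expected-potential es S (refused e S ∷ H)
                 (ledger-record {x = refused e S} refl e∈O L (skip fresh) charged (refused-charged e S)) ⟩
          Q (X ∪ ⁅ e ⁆) S - α * (totalCharge (refused e S) + ∑ H totalCharge)
            ≤⟨ +-mono-≤ (Q-only e∉X e∉S) (≤-reflexive (-‿cong (*-cong ≈-refl (+-cong (charge≈ e S 0#) ≈-refl)))) ⟩
          Q X S + inc - α * (pen + D * 0# + ∑ H totalCharge)
            ≈⟨ solve 6 (λ q i c p d h → (q :+ i) :- c :* ((p :+ d :* con (+ 0)) :+ h) := (q :- c :* h) :+ (i :- c :* p))
                 ≈-refl (Q X S) inc α pen D (∑ H totalCharge) ⟩
          bill S H + (inc - α * pen) ∎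
        accept : accepts e S ≡ true → e ∈ O →
                 𝔼 potential (runStack (e ∷ S) es) ≤ bill S H + (κ * inc - α * (pen + D * (inc - pen)))
        accept acc e∈O = begin
          𝔼 potential (runStack (e ∷ S) es)
            ≤⟨ expected-potential es (e ∷ S) (x ∷ H)
                 (ledger-record {x = x} refl e∈O L (push acc fresh) (λ {h} h∈ → charged-∷ e S {h} (charged h∈)) (accepted-charged x (annotate S))) ⟩
          Q (X ∪ ⁅ e ⁆) (e ∷ S) - α * (totalCharge x + ∑ H totalCharge)
            ≤⟨ +-mono-≤ (Q-both e∉X e∉S) (≤-reflexive (-‿cong (*-cong ≈-refl (+-cong (charge≈ e S (inc - pen)) ≈-refl)))) ⟩
          Q X S + κ * inc - α * (pen + D * (inc - pen) + ∑ H totalCharge)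
            ≈⟨ solve 5 (λ q i c p h → (q :+ i) :- c :* (p :+ h) := (q :- c :* h) :+ (i :- c :* p))
                 ≈-refl (Q X S) (κ * inc) α (pen + D * (inc - pen)) (∑ H totalCharge) ⟩
          bill S H + (κ * inc - α * (pen + D * (inc - pen))) ∎
          where
          x : Entry (Fin m)
          x = entry e (inc - pen) (Vec.tabulate (λ i → starOf i e (annotate S)))
        go : accepts e S ≡ true ⊎ accepts e S ≡ false → Dec (e ∈ O) → 𝔼 potential (runStack S (e ∷ es)) ≤ bill S H
        go (inj₂ rej) (no e∉O) = begin
          𝔼 potential (runStack S (e ∷ es))   ≡⟨ 𝔼-reject potential e S es rej ⟩
          𝔼 potential (runStack S es)         ≤⟨ expected-potential es S H (ledger-skip e∉O L) ⟩
          bill S H                            ∎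
        -- A member of a feasible set is no loop, so the rejection must be due to its increment.
        go (inj₂ rej) (yes e∈O) = begin
          𝔼 potential (runStack S (e ∷ es))   ≡⟨ 𝔼-reject potential e S es rej ⟩
          𝔼 potential (runStack S es)         ≤⟨ refuse e∈O ⟩
          bill S H + (inc - α * pen)          ≤⟨ ≤-by _ (≤⇒0≤ (rejected-bound {e} {S} (nonloop-O e∈O) rej))
                                                   (solve 3 (λ b i p → p :- i := b :- (b :+ (i :- p))) ≈-refl (bill S H) inc (α * pen)) ⟩
          bill S H                            ∎
        go (inj₁ acc) (no e∉O) = begin
          𝔼 potential (runStack S (e ∷ es))   ≈⟨ 𝔼-step potential e S es acc ⟩
          q * 𝔼 potential (runStack (e ∷ S) es) + (1# - q) * 𝔼 potential (runStack S es)
            ≤⟨ convex-≤ {A = ℕ} 0≤q q≤1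
                 (≤-trans (expected-potential es (e ∷ S) H (ledger-push acc e∉O L)) (+-monoˡ-≤ _ (Q-skip e∉X e∉S)))
                 (expected-potential es S H (ledger-skip e∉O L)) ⟩
          bill S H                            ∎
        go (inj₁ acc) (yes e∈O) = begin
          𝔼 potential (runStack S (e ∷ es))   ≈⟨ 𝔼-step potential e S es acc ⟩
          q * 𝔼 potential (runStack (e ∷ S) es) + (1# - q) * 𝔼 potential (runStack S es)
            ≤⟨ +-mono-≤ (*-monoˡ-≤ 0≤q (accept acc e∈O)) (*-monoˡ-≤ (≤⇒0≤ q≤1) (refuse e∈O)) ⟩
          q * (bill S H + (κ * inc - α * (pen + D * (inc - pen)))) + (1# - q) * (bill S H + (inc - α * pen))
            -- Since `inc` is the penalty plus the gain, the expected slack is linear in these two,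
            -- with the nonnegative coefficients given by `κ-star` and `κ-gain`.
            ≤⟨ ≤-by ((α - (q * κ + (1# - q))) * pen + (q * (α * D) - (q * κ + (1# - q))) * (inc - pen))
                 (+-nonNegative (*-nonNegative (≤⇒0≤ κ-star) 0≤pen) (*-nonNegative (≤⇒0≤ κ-gain) 0≤gain))
                 (solve 7 (λ b q k c p d i →
                    (c :- (q :* k :+ (con (+ 1) :- q))) :* p :+ (q :* (c :* d) :- (q :* k :+ (con (+ 1) :- q))) :* (i :- p) :=
                    b :- (q :* (b :+ (k :* i :- c :* (p :+ d :* (i :- p)))) :+ (con (+ 1) :- q) :* (b :+ (i :- c :* p))))
                  ≈-refl (bill S H) q κ α pen D inc) ⟩
          bill S H                            ∎
          where
          0≤pen : 0# ≤ pen
          0≤pen = ∑-nonNegative (allFin p) (λ {i} _ → 0≤starOf i e (annotate S))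
          0≤gain : 0# ≤ inc - pen
          0≤gain with Fresh.good (push acc fresh)
          ... | fits ∷ _ = proj₁ (Fits.gain-positive fits)

      expected-bound : ∀ {stream} → Unique stream → (∀ {e} → e ∈ O → e ∈ˡ stream) →
                       𝔼 (Q O) (runStack [] stream) ≤ Q ⊥ [] + α * D * 𝔼 gains (runStack [] stream)
      expected-bound {stream} u complete = begin
        𝔼 (Q O) t                                                ≤⟨ 𝔼-mono t (Always-const t λ S → ≤-reflexive (split S)) ⟩
        𝔼 (λ S → potential S + α * D * gains S) t                ≈⟨ 𝔼-+ potential _ t ⟩
        𝔼 potential t + 𝔼 (λ S → α * D * gains S) t              ≈⟨ +-cong ≈-refl (𝔼-* (α * D) gains t) ⟩
        𝔼 potential t + α * D * 𝔼 gains t                        ≤⟨ +-monoˡ-≤ _ (expected-potential stream [] [] ledger) ⟩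
        Q ⊥ [] - α * 0# + α * D * 𝔼 gains t                      ≈⟨ solve 3 (λ b c d → (b :- c :* con (+ 0)) :+ d := b :+ d) ≈-refl _ α _ ⟩
        Q ⊥ [] + α * D * 𝔼 gains t                               ∎
        where
        open ≤-Reasoning
        t = runStack [] stream
        split : ∀ S → Q O S ≈ potential S + α * D * gains S
        split S = ≈-trans (solve 2 (λ q c → q := (q :- c) :+ c) ≈-refl (Q O S) (α * ∑ (annotate S) totalGain))
          (+-cong ≈-refl (≈-trans (*-cong ≈-refl (≈-trans (∑-cong (annotate S) (λ x → degree (edge x) (gain x))) (∑-* (annotate S) D gain)))
            (≈-sym (*-assoc α D (gains S)))))
        ledger : Ledger [] stream []
        ledger = record
          { fresh = initially u ; charged = λ () ; within = λ () ; distinct = [] ; disjoint = λ _ () ; covers = inj₂ ∘ complete }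

    -- The sampling lemma of Feige, Mirrokni and Vondrák, for adaptive choices.
    -- The induction keeps the term q h (Y ++ S), where Y is the cheaper of the
    -- sets that the two outcomes of the coin provide.
    module Survival (nonNegative : NonNegative f) (submodular : Submodular f) (O : Subset m) where

      private
        h : List (Fin m) → Carrier
        h S = f (O ∪ fromList S)

        -- For `e` in `O` both differences vanish; otherwise this is submodularity of `f` at the
        -- sets enlarged by `O`.
        diminishing : ∀ {S T e} → S ⊆ˡ T → e ∉ˡ T → h (e ∷ T) - h T ≤ h (e ∷ S) - h S
        diminishing {S} {T} {e} S⊆T e∉T with e Subsetₚ.∈? O
        ... | yes e∈O = ≤-reflexive (≈-trans (same T) (≈-sym (same S)))
          where
          same : ∀ U → h (e ∷ U) - h U ≈ 0#
          same U = ≈-trans (+-cong (reflexive (cong f (Subsetₚ.⊆-antisym absorb (λ x∈ → case Subsetₚ.x∈p∪q⁻ O (fromList U) x∈ of λ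
              { (inj₁ x∈O) → Subsetₚ.x∈p∪q⁺ (inj₁ x∈O)
              ; (inj₂ x∈U) → Subsetₚ.x∈p∪q⁺ (inj₂ (Subsetₚ.x∈p∪q⁺ (inj₁ x∈U))) })))) ≈-refl) (-‿inverseʳ _)
            where
            absorb : O ∪ fromList (e ∷ U) ⊆ O ∪ fromList U
            absorb x∈ with Subsetₚ.x∈p∪q⁻ O (fromList (e ∷ U)) x∈
            ... | inj₁ x∈O = Subsetₚ.x∈p∪q⁺ (inj₁ x∈O)
            ... | inj₂ x∈ with ∈-fromList⁻ (e ∷ U) x∈
            ...   | here refl = Subsetₚ.x∈p∪q⁺ (inj₁ e∈O)
            ...   | there x∈U = Subsetₚ.x∈p∪q⁺ (inj₂ (∈-fromList⁺ x∈U))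
        ... | no e∉O = begin
          h (e ∷ T) - h T                       ≡⟨ cong (λ X → f X - h T) (Subsetₚ.∪-assoc O (fromList T) ⁅ e ⁆) ⟨
          marginal f e (O ∪ fromList T)         ≤⟨ submodular S⊆T′ e∉T′ ⟩
          marginal f e (O ∪ fromList S)         ≡⟨ cong (λ X → f X - h S) (Subsetₚ.∪-assoc O (fromList S) ⁅ e ⁆) ⟩
          h (e ∷ S) - h S                       ∎
          where
          open ≤-Reasoning
          S⊆T′ : O ∪ fromList S ⊆ O ∪ fromList T
          S⊆T′ x∈ with Subsetₚ.x∈p∪q⁻ O (fromList S) x∈
          ... | inj₁ x∈O = Subsetₚ.x∈p∪q⁺ (inj₁ x∈O)
          ... | inj₂ x∈S = Subsetₚ.x∈p∪q⁺ (inj₂ (fromList-⊆ {xs = S} {T} S⊆T x∈S))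
          e∉T′ : e ∉ O ∪ fromList T
          e∉T′ e∈ with Subsetₚ.x∈p∪q⁻ O (fromList T) e∈
          ... | inj₁ e∈O = e∉O e∈O
          ... | inj₂ e∈T = e∉T (∈-fromList⁻ T e∈T)

        h-cong : ∀ {S T} → S ⊆ˡ T → T ⊆ˡ S → h S ≡ h T
        h-cong {S} {T} S⊆T T⊆S = cong (λ X → f (O ∪ X)) (fromList-≡ {xs = S} {T} S⊆T T⊆S)

        survives : ∀ es S → Fresh S es →
          ∃[ Y ] Y ⊆ˡ es × (1# - q) * h S + q * h (Y ++ S) ≤ 𝔼 h (runStack S es)
        survives [] S F = [] , id , ≤-reflexive (solve 2 (λ q h → (con (+ 1) :- q) :* h :+ q :* h := h) ≈-refl q (h S))
        survives (e ∷ es) S F with bool (accepts e S)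
        ... | inj₂ rej with survives es S (skip F)
        ...   | Y , Y⊆ , bound = Y , there ∘ Y⊆ , ≤-trans bound (≤-reflexive (reflexive (≡.sym (𝔼-reject h e S es rej))))
        survives (e ∷ es) S F | inj₁ acc with survives es (e ∷ S) (push acc F) | survives es S (skip F)
        ... | Y₁ , Y₁⊆ , bound₁ | Y₀ , Y₀⊆ , bound₀ = finish (total h₁ (h (e ∷ Y₀ ++ S)))
          where
          open ≤-Reasoning
          h₁ : Carrier
          h₁ = h (Y₁ ++ e ∷ S)
          drop : h (e ∷ Y₀ ++ S) - h (Y₀ ++ S) ≤ h (e ∷ S) - h S
          drop = diminishing {S} {Y₀ ++ S} (∈ₚ.∈-++⁺ʳ Y₀) λ e∈ → case ∈ₚ.∈-++⁻ Y₀ e∈ of λ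
            { (inj₁ e∈Y) → case Fresh.unique F of λ { (e∉es ∷ _) → All.lookup e∉es (Y₀⊆ e∈Y) refl }
            ; (inj₂ e∈S) → Fresh.apart F (here refl) e∈S }
          shifted : h (e ∷ Y₁ ++ S) ≡ h₁
          shifted = h-cong {e ∷ Y₁ ++ S} {Y₁ ++ e ∷ S} (↭ₚ.∈-resp-↭ (↭-sym (↭ₚ.shift e Y₁ S))) (↭ₚ.∈-resp-↭ (↭ₚ.shift e Y₁ S))
          combined : ∀ z → z ≤ h₁ → z ≤ h (e ∷ Y₀ ++ S) → (1# - q) * h S + q * z ≤ 𝔼 h (runStack S (e ∷ es))
          combined z z≤₁ z≤₀ = begin
            (1# - q) * h S + q * z
              -- With weight `q * (1# - q)`, `drop` trades `h (e ∷ S) + h (Y₀ ++ S)` for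
              -- `h S + h (e ∷ Y₀ ++ S)`. What remains is `(1# - q) * h S` plus q times an average
              -- of `h₁` and `h (e ∷ Y₀ ++ S)`, both at least `z`.
              ≤⟨ ≤-by (q * (1# - q) * ((h (e ∷ S) - h S) - (h (e ∷ Y₀ ++ S) - h (Y₀ ++ S))) +
                       (q * (1# - q) * (h (e ∷ Y₀ ++ S) - z) + q * q * (h₁ - z)))
                   (+-nonNegative (*-nonNegative 0≤q[1-q] (≤⇒0≤ drop))
                     (+-nonNegative (*-nonNegative 0≤q[1-q] (≤⇒0≤ z≤₀)) (*-nonNegative (*-nonNegative 0≤q 0≤q) (≤⇒0≤ z≤₁))))
                   (solve 7 (λ q hs hes y0 ey0 h1 z →
                      q :* (con (+ 1) :- q) :* ((hes :- hs) :- (ey0 :- y0)) :+ (q :* (con (+ 1) :- q) :* (ey0 :- z) :+ q :* q :* (h1 :- z)) :=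
                      (q :* ((con (+ 1) :- q) :* hes :+ q :* h1) :+ (con (+ 1) :- q) :* ((con (+ 1) :- q) :* hs :+ q :* y0)) :-
                      ((con (+ 1) :- q) :* hs :+ q :* z)) ≈-refl q (h S) (h (e ∷ S)) (h (Y₀ ++ S)) (h (e ∷ Y₀ ++ S)) h₁ z) ⟩
            q * ((1# - q) * h (e ∷ S) + q * h₁) + (1# - q) * ((1# - q) * h S + q * h (Y₀ ++ S))
              ≤⟨ +-mono-≤ (*-monoˡ-≤ 0≤q bound₁) (*-monoˡ-≤ (≤⇒0≤ q≤1) bound₀) ⟩
            q * 𝔼 h (runStack (e ∷ S) es) + (1# - q) * 𝔼 h (runStack S es)
              ≈⟨ 𝔼-step h e S es acc ⟨
            𝔼 h (runStack S (e ∷ es)) ∎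
            where 0≤q[1-q] = *-nonNegative 0≤q (≤⇒0≤ q≤1)
          finish : h₁ ≤ h (e ∷ Y₀ ++ S) ⊎ h (e ∷ Y₀ ++ S) ≤ h₁ →
                   ∃[ Y ] Y ⊆ˡ e ∷ es × (1# - q) * h S + q * h (Y ++ S) ≤ 𝔼 h (runStack S (e ∷ es))
          finish (inj₁ h₁≤) = e ∷ Y₁ , (λ { (here refl) → here refl ; (there y∈) → there (Y₁⊆ y∈) }) ,
            combined _ (≤-reflexive (reflexive shifted)) (≤-trans (≤-reflexive (reflexive shifted)) h₁≤)
          finish (inj₂ ≤h₁) = e ∷ Y₀ , (λ { (here refl) → here refl ; (there y∈) → there (Y₀⊆ y∈) }) ,
            combined _ ≤h₁ ≤-refl

      survival : ∀ {stream} → Unique stream → (1# - q) * f O ≤ 𝔼 (λ S → f (O ∪ fromList S)) (runStack [] stream)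
      survival {stream} u with survives stream [] (initially u)
      ... | Y , _ , bound = begin
        (1# - q) * f O                                   ≡⟨ cong (λ X → (1# - q) * f X) (Subsetₚ.∪-identityʳ O) ⟨
        (1# - q) * h []                                  ≤⟨ x≤x+y (*-nonNegative 0≤q (nonNegative _)) ⟩
        (1# - q) * h [] + q * h (Y ++ [])                ≤⟨ bound ⟩
        𝔼 h (runStack [] stream)                         ∎
        where open ≤-Reasoning

-- Translating between positions, lists and subsets.

image-∪ : ∀ {s m} (g : Fin s → Fin m) X x → image g (X ∪ ⁅ x ⁆) ≡ image g X ∪ ⁅ g x ⁆
image-∪ g (inside ∷ X) zero rewrite Subsetₚ.∪-identityʳ X = ≡.sym (begin
  (⁅ g zero ⁆ ∪ image (g ∘ suc) X) ∪ ⁅ g zero ⁆    ≡⟨ Subsetₚ.∪-comm (⁅ g zero ⁆ ∪ image (g ∘ suc) X) _ ⟩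
  ⁅ g zero ⁆ ∪ (⁅ g zero ⁆ ∪ image (g ∘ suc) X)    ≡⟨ Subsetₚ.∪-assoc ⁅ g zero ⁆ _ _ ⟨
  (⁅ g zero ⁆ ∪ ⁅ g zero ⁆) ∪ image (g ∘ suc) X    ≡⟨ cong (_∪ image (g ∘ suc) X) (Subsetₚ.∪-idem ⁅ g zero ⁆) ⟩
  ⁅ g zero ⁆ ∪ image (g ∘ suc) X                   ∎)
  where open ≡.≡-Reasoning
image-∪ g (outside ∷ X) zero rewrite Subsetₚ.∪-identityʳ X = Subsetₚ.∪-comm ⁅ g zero ⁆ _
image-∪ g (inside ∷ X) (suc x) = ≡.trans (cong (⁅ g zero ⁆ ∪_) (image-∪ (g ∘ suc) X x)) (≡.sym (Subsetₚ.∪-assoc ⁅ g zero ⁆ _ _))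
image-∪ g (outside ∷ X) (suc x) = image-∪ (g ∘ suc) X x

image-⊥ : ∀ {s m} (g : Fin s → Fin m) → image g ⊥ ≡ ⊥
image-⊥ {zero}  g = refl
image-⊥ {suc s} g = image-⊥ (g ∘ suc)

image-fromList : ∀ {s m} (g : Fin s → Fin m) xs → image g (fromList xs) ≡ fromList (map g xs)
image-fromList g []       = image-⊥ g
image-fromList g (x ∷ xs) = ≡.trans (image-∪ g (fromList xs) x) (cong (_∪ ⁅ g x ⁆) (image-fromList g xs))

map-lookup-allFin : ∀ {A : Set} (xs : List A) → map (lookup xs) (allFin (length xs)) ≡ xs
map-lookup-allFin xs = ≡.trans (Listₚ.map-tabulate id (lookup xs)) (Listₚ.tabulate-lookup xs)

map-lookup-suc : ∀ {A : Set} x (xs : List A) → map (lookup (x ∷ xs)) (tabulate suc) ≡ xs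
map-lookup-suc x xs = ≡.trans (Listₚ.map-tabulate suc (lookup (x ∷ xs))) (Listₚ.tabulate-lookup xs)

toList : ∀ {m} → Subset m → List (Fin m)
toList {m} X = filter (Subsetₚ._∈? X) (allFin m)

∈-toList⁺ : ∀ {m} {X : Subset m} {x} → x ∈ X → x ∈ˡ toList X
∈-toList⁺ {X = X} x∈ = ∈ₚ.∈-filter⁺ (Subsetₚ._∈? X) (∈ₚ.∈-allFin _) x∈

∈-toList⁻ : ∀ {m} {X : Subset m} {x} → x ∈ˡ toList X → x ∈ X
∈-toList⁻ {m} {X} x∈ = proj₂ (∈ₚ.∈-filter⁻ (Subsetₚ._∈? X) {xs = allFin m} x∈)

toList-unique : ∀ {m} (X : Subset m) → Unique (toList X)
toList-unique {m} X = Uniqueₚ.filter⁺ (Subsetₚ._∈? X) (Uniqueₚ.allFin⁺ m)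

fromList-toList : ∀ {m} (X : Subset m) → fromList (toList X) ≡ X
fromList-toList X = Subsetₚ.⊆-antisym (∈-toList⁻ ∘ ∈-fromList⁻ (toList X)) (∈-fromList⁺ ∘ ∈-toList⁺)

length-toList : ∀ {m} (X : Subset m) → length (toList X) ≡ ∣ X ∣
length-toList X = ≡.trans (≡.sym (∣fromList∣ (toList-unique X))) (cong ∣_∣ (fromList-toList X))

-- The streaming algorithm and its run on an instance.

module Streamer (R : EuclideanField) (a : EuclideanField.Carrier R) {μ : Mode} (coin : Streaming.Outcome R Bool μ) where
  open OrderedField R
  open Streaming R

  module _ {n s : ℕ} (V : View n s) where
    private module V = View V

    -- A view discloses the capacity of a vertex only through an edge containing it. The default 0
    -- never affects a result, because constraint `suc v` is consulted only for edges active at `v`.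
    capacityAt : Fin s → Fin n → ℕ
    capacityAt e v with v Subsetₚ.∈? V.vertices e
    ... | yes v∈e = V.capacity e v∈e
    ... | no  _   = 0

    isActiveAt : Fin s → Fin (suc n) → Bool
    isActiveAt e zero    = true
    isActiveAt e (suc v) = Vec.lookup (V.vertices e) v

    okAt : Fin (suc n) → Fin s → List (Fin s) → Bool
    okAt zero    e xs = V.indep (fromList xs)
    okAt (suc v) e xs = does (length xs ℕ.≤? capacityAt e v)

    viewOracle : LocalRatio.Oracle R (1# + a) (suc n) (Fin s)
    viewOracle = record { active = isActiveAt ; ok = okAt ; value = V.value ∘ fromList }

  algorithm : Algorithm μ
  algorithm = record
    { step = λ {n} {s} V _ →
        (if LocalRatio.Procedure.accepts R (1# + a) (suc n) (viewOracle V) zero (tabulate suc) then coin else pure false)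
        >>= λ b → pure ((if b then zero ∷ tabulate suc else tabulate suc) , [])
    ; output = λ {n} {s} V _ →
        pure (fromList (LocalRatio.Procedure.choose R (1# + a) (suc n) (viewOracle V) (allFin s)))
    }

module Instance (R : EuclideanField)
  (a : EuclideanField.Carrier R) (0<a : EuclideanField._<_ R (EuclideanField.0# R) a)
  {μ : Mode} (coin : Streaming.Outcome R Bool μ)
  {k : ℕ} (P : Problem k) (f : Subset (Problem.m P) → EuclideanField.Carrier R) where

  open OrderedField R
  private module P = Problem P
  open P hiding (matroid; uniform)
  open Streaming R
  open OutcomeProperties R
  open Streamer R a coin

  isActive : Fin m → Fin (suc n) → Bool
  isActive e zero    = true
  isActive e (suc v) = Vec.lookup (vertices e) v

  -- There is one constraint per vertex of the hypergraph besides the given matroid, but an edge is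
  -- active for only `k + 1` of them; that number is what enters the ratio.
  constraint : Fin (suc n) → ListMatroid m
  constraint zero    = asListMatroid (P.matroid)
  constraint (suc v) = uniform m (capacity v)

  open LocalRatio R (1# + a) (suc n)
  open Analysis R a 0<a isActive constraint f
  open Process R a 0<a isActive constraint f coin
  open Procedure oracle
  open Execution algorithm P f hiding (solve)
  open 𝓜 using (Ind)

  private
    lookup⇒∈ : ∀ {n} {X : Subset n} {x} → Vec.lookup X x ≡ true → x ∈ X
    lookup⇒∈ {X = X} {x} eq = Vecₚ.lookup⇒[]= x X eq

    lookup-incident : ∀ v e → Vec.lookup (incident v) e ≡ Vec.lookup (vertices e) v
    lookup-incident v = Vecₚ.lookup∘tabulate (λ e → Vec.lookup (vertices e) v)

    ∈-incident⁻ : ∀ {v e} → e ∈ incident v → Vec.lookup (vertices e) v ≡ true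
    ∈-incident⁻ {v} {e} e∈ = ≡.trans (≡.sym (lookup-incident v e)) (Vecₚ.[]=⇒lookup e∈)

    ∈-incident⁺ : ∀ {v e} → Vec.lookup (vertices e) v ≡ true → e ∈ incident v
    ∈-incident⁺ {v} {e} eq = lookup⇒∈ (≡.trans (lookup-incident v e) eq)

  select-zero : ∀ xs → select zero xs ≡ xs
  select-zero []       = refl
  select-zero (x ∷ xs) = cong (x ∷_) (select-zero xs)

  ∩-incident : ∀ xs v → fromList xs ∩ incident v ⊆ fromList (select (suc v) xs)
  ∩-incident xs v e∈ with Subsetₚ.x∈p∩q⁻ (fromList xs) (incident v) e∈
  ... | e∈xs , e∈v = ∈-fromList⁺ (∈-select⁺ (suc v) (∈-fromList⁻ xs e∈xs) (∈-incident⁻ e∈v))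

  independent⇒feasible : ∀ {xs} → Independent xs → Feasible (fromList xs)
  independent⇒feasible {xs} ind = matching , subst (Indep ∘ fromList) (select-zero xs) (proj₂ (ind zero))
    where
    matching : IsBMatching (fromList xs)
    matching v = ℕₚ.≤-trans (Subsetₚ.p⊆q⇒∣p∣≤∣q∣ (∩-incident xs v))
      (ℕₚ.≤-trans (∣fromList∣≤length (select (suc v) xs)) (proj₂ (ind (suc v))))

  feasible⇒independent : ∀ {O} → Feasible O → ∀ {xs} → Unique xs → (∀ {x} → x ∈ˡ xs → x ∈ O) → Independent xs
  feasible⇒independent {O} (_ , indO) {xs} u xs⊆O zero = subst (Ind zero) (≡.sym (select-zero xs))
    (u , hereditary (λ x∈ → xs⊆O (∈-fromList⁻ xs x∈)) indO)
  feasible⇒independent {O} (matching , _) {xs} u xs⊆O (suc v) = select-unique (suc v) u ,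
    subst (ℕ._≤ capacity v) (∣fromList∣ (select-unique (suc v) u))
      (ℕₚ.≤-trans (Subsetₚ.p⊆q⇒∣p∣≤∣q∣ ⊆O∩v) (matching v))
    where
    ⊆O∩v : fromList (select (suc v) xs) ⊆ O ∩ incident v
    ⊆O∩v e∈ with ∈-select⁻ (suc v) xs (∈-fromList⁻ (select (suc v) xs) e∈)
    ... | e∈xs , act = Subsetₚ.x∈p∩q⁺ (xs⊆O e∈xs , ∈-incident⁺ act)

  fromℕ-∣_∣ : ∀ {j} {A : Set} (X : Subset j) (g : Fin j → A) (h : A → Carrier) x →
             (∀ v → h (g v) ≡ (if Vec.lookup X v then x else 0#)) → ∑ (tabulate g) h ≈ fromℕ ∣ X ∣ * x
  fromℕ-∣ [] ∣ g h x eq = ≈-sym (zeroˡ x)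
  fromℕ-∣ inside ∷ X ∣ g h x eq = ≈-trans (+-cong (reflexive (eq zero)) (fromℕ-∣ X ∣ (g ∘ suc) h x (eq ∘ suc)))
    (solve 2 (λ n x → x :+ n :* x := (con (+ 1) :+ n) :* x) ≈-refl (fromℕ ∣ X ∣) x)
  fromℕ-∣ outside ∷ X ∣ g h x eq = ≈-trans (+-cong (reflexive (eq zero)) (fromℕ-∣ X ∣ (g ∘ suc) h x (eq ∘ suc))) (+-identityˡ _)

  degree : ∀ e x → ∑ (allFin (suc n)) (λ i → restrict e i x) ≈ (fromℕ k + 1#) * x
  degree e x = ≈-trans (+-cong ≈-refl (fromℕ-∣ vertices e ∣ suc (λ i → restrict e i x) x (λ _ → refl)))
    (≈-trans (+-cong ≈-refl (*-cong (reflexive (cong fromℕ (uniform′ e))) ≈-refl))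
      (solve 2 (λ n x → x :+ n :* x := (n :+ con (+ 1)) :* x) ≈-refl (fromℕ k) x))
    where uniform′ = P.uniform

  module _ {s : ℕ} (g : Fin s → Fin m) where

    private
      -- The view tests a set or a length, whereas the list matroids also refuse repetitions, so the
      -- two tests are compared on duplicate-free lists.
      ok-g : ∀ i e xs → isActiveAt (view g) e i ≡ true → Unique (map g xs) →
             okAt (view g) i e xs ≡ Oracle.ok oracle i (g e) (map g xs)
      ok-g zero e xs act u rewrite image-fromList g xs | dec-true (unique? (map g xs)) u = refl
      ok-g (suc v) e xs act u with v Subsetₚ.∈? vertices (g e)
      ... | no v∉ = ⊥-elim (v∉ (lookup⇒∈ act))
      ... | yes _ rewrite dec-true (unique? (map g xs)) u | Listₚ.length-map g xs = refl

      active-g : ∀ e i → isActiveAt (view g) e i ≡ isActive (g e) i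
      active-g e zero    = refl
      active-g e (suc v) = refl

    open Naturality (viewOracle (view g)) oracle g active-g ok-g (λ xs → cong f (image-fromList g xs)) public

  process≡ : ∀ {S e} → Unique (e ∷ S) →
             process (memory S []) e ≡ (decide e S >>= λ b → pure (memory (grow b e S) []))
  process≡ {S} {e} u = ≡.trans (>>=-assoc (tossed seen) reply store) (≡.trans (>>=-cong (tossed seen) stored)
      (cong (λ b → tossed b >>= λ b → pure (memory (grow b e S) [])) same))
    where
    positions : Bool → List (Fin (suc (length S)))
    positions b = if b then zero ∷ tabulate suc else tabulate suc
    tossed : Bool → Outcome Bool μ
    tossed b = if b then coin else pure false
    seen : Bool
    seen = Procedure.accepts (viewOracle (view (lookup (e ∷ S)))) zero (tabulate suc)
    reply : Bool → Outcome (List (Fin (suc (length S))) × List Carrier) μ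
    reply b = pure (positions b , [])
    store : List (Fin (suc (length S))) × List Carrier → Outcome (Memory m) μ
    store (is , rs) = pure (memory (map (lookup (e ∷ S)) is) rs)
    stored : ∀ b → store (positions b , []) ≡ pure (memory (grow b e S) [])
    stored true  = cong (λ T → pure (memory (e ∷ T) [])) (map-lookup-suc e S)
    stored false = cong (λ T → pure (memory T [])) (map-lookup-suc e S)
    same : seen ≡ accepts e S
    same = ≡.trans (accepts-natural (lookup (e ∷ S)) zero (tabulate suc) (subst (λ T → Unique (e ∷ T)) (≡.sym (map-lookup-suc e S)) u))
      (cong (accepts e) (map-lookup-suc e S))

  runFrom≡ : ∀ es {S} → Fresh S es → runFrom (memory S []) es ≡ (runStack S es >>= λ T → pure (memory T []))
  runFrom≡ [] F = refl
  runFrom≡ (e ∷ es) {S} F rewrite process≡ {S} {e} (Allₚ.¬Any⇒All¬ S (Fresh.apart F (here refl)) ∷ stack-unique (Fresh.good F))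
    with accepts e S in acc
  ... | false = runFrom≡ es (skip F)
  ... | true  = ≡.trans (>>=-assoc coin (λ b → pure (memory (grow b e S) [])) (λ c → runFrom c es))
      (≡.trans (>>=-cong coin λ { true → runFrom≡ es (push acc F) ; false → runFrom≡ es (skip F) })
        (≡.sym (>>=-assoc coin (λ b → runStack (grow b e S) es) (λ T → pure (memory T [])))))

  answer≡ : ∀ {S} → Unique S → answer (memory S []) ≡ pure (fromList (choose S))
  answer≡ {S} u = cong pure (≡.trans (image-fromList (lookup S) (Procedure.choose (viewOracle (view (lookup S))) (allFin (length S)))) (cong fromList
    (≡.trans (choose-natural (lookup S) (allFin (length S)) (subst Unique (≡.sym (map-lookup-allFin S)) u))
      (cong choose (map-lookup-allFin S)))))

  module _ {stream : List (Fin m)} (u : Unique stream) where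

    private
      solve≡ : Execution.solve algorithm P f stream ≡ (runStack [] stream >>= λ S → answer (memory S []))
      solve≡ = ≡.trans (cong (_>>= answer) (runFrom≡ stream (initially u))) (>>=-assoc (runStack [] stream) (λ T → pure (memory T [])) answer)

    always-feasible : Always Feasible (Execution.solve algorithm P f stream)
    always-feasible = subst (Always Feasible) (≡.sym solve≡) (Always->>= (runStack [] stream) (always-good u λ {S} good →
      subst (Always Feasible) (≡.sym (answer≡ (stack-unique good))) (independent⇒feasible {choose S} (best-independent (sublists S)))))

    expected-value : 𝔼 (value ∘ choose) (runStack [] stream) ≤ 𝔼 f (Execution.solve algorithm P f stream)
    expected-value = ≤-trans (𝔼-mono (runStack [] stream) (always-good u λ {S} good →
        ≤-reflexive (reflexive (≡.sym (cong (𝔼 f) (answer≡ (stack-unique good)))))))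
      (≤-reflexive (reflexive (≡.sym (≡.trans (cong (𝔼 f) solve≡) (𝔼->>= f (runStack [] stream) (λ S → answer (memory S [])))))))

    always-size : ∀ {B} → (∀ {S} → Good (annotate S) → length S ℕ.≤ B) → Always (λ c → size c ℕ.≤ B) (run stream)
    always-size {B} bound = subst (Always _) (≡.sym (runFrom≡ stream (initially u))) (Always->>= (runStack [] stream)
      (always-good u λ {S} good → subst (ℕ._≤ B) (≡.sym (ℕₚ.+-identityʳ (length S))) (bound good)))

  unique-stream : ∀ {stream} → stream ↭ allFin m → Unique stream
  unique-stream stream↭ = Unique-resp-↭ (↭-sym stream↭) (Uniqueₚ.allFin⁺ m)

  approximates : ∀ {c} → 0# ≤ c →
    (∀ {stream O} → Unique stream → (∀ e → e ∈ˡ stream) → Feasible O →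
      f O ≤ c * 𝔼 (value ∘ choose) (runStack [] stream)) →
    Approximates P algorithm f c
  approximates 0≤c bound stream stream↭ = always-feasible u , λ O (feasible , _) →
      ≤-trans (bound u (λ e → ↭ₚ.∈-resp-↭ (↭-sym stream↭) (∈ₚ.∈-allFin e)) feasible) (*-monoˡ-≤ 0≤c (expected-value u))
    where u = unique-stream stream↭

  private
    sum-mono : ∀ {A : Set} (xs : List A) {g h : A → ℕ} → (∀ x → g x ℕ.≤ h x) → sum (map g xs) ℕ.≤ sum (map h xs)
    sum-mono [] g≤h = ℕ.z≤n
    sum-mono (x ∷ xs) g≤h = ℕₚ.+-mono-≤ (g≤h x) (sum-mono xs g≤h)

    sum-* : ∀ {A : Set} (xs : List A) c (g : A → ℕ) → sum (map (λ x → c ℕ.* g x) xs) ≡ c ℕ.* sum (map g xs)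
    sum-* [] c g = ≡.sym (ℕₚ.*-zeroʳ c)
    sum-* (x ∷ xs) c g = ≡.trans (cong (c ℕ.* g x ℕ.+_) (sum-* xs c g)) (≡.sym (ℕₚ.*-distribˡ-+ c (g x) _))

    sum-0 : ∀ {A : Set} (xs : List A) → sum (map (λ _ → 0) xs) ≡ 0
    sum-0 [] = refl
    sum-0 (x ∷ xs) = sum-0 xs

    length-concatMap : ∀ {A B : Set} (g : A → List B) xs → length (concatMap g xs) ≡ sum (map (length ∘ g) xs)
    length-concatMap g [] = refl
    length-concatMap g (x ∷ xs) = ≡.trans (Listₚ.length-++ (g x)) (cong (length (g x) ℕ.+_) (length-concatMap g xs))

    add-vertices : ∀ {j} {A : Set} (X : Subset j) (g : Fin j → A) (h : A → ℕ) (l : A → ℕ) →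
      (∀ v → h (g v) ≡ (if Vec.lookup X v then suc (l (g v)) else l (g v))) →
      sum (map h (tabulate g)) ≡ ∣ X ∣ ℕ.+ sum (map l (tabulate g))
    add-vertices [] g h l eq = refl
    add-vertices (inside ∷ X) g h l eq rewrite eq zero | add-vertices X (g ∘ suc) h l (eq ∘ suc) =
      cong suc (+-*-Solver.solve 3 (λ a b c → a +-*-Solver.:+ (b +-*-Solver.:+ c) +-*-Solver.:= b +-*-Solver.:+ (a +-*-Solver.:+ c)) refl (l (g zero)) ∣ X ∣ _)
    add-vertices (outside ∷ X) g h l eq rewrite eq zero | add-vertices X (g ∘ suc) h l (eq ∘ suc) =
      +-*-Solver.solve 3 (λ a b c → a +-*-Solver.:+ (b +-*-Solver.:+ c) +-*-Solver.:= b +-*-Solver.:+ (a +-*-Solver.:+ c)) refl (l (g zero)) ∣ X ∣ _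

    handshake : ∀ xs → sum (map (λ v → length (select (suc v) xs)) (allFin n)) ≡ k ℕ.* length xs
    handshake [] = ≡.trans (sum-0 (allFin n)) (≡.sym (ℕₚ.*-zeroʳ k))
    handshake (x ∷ xs) = ≡.trans (add-vertices (vertices x) id (λ v → length (select (suc v) (x ∷ xs))) (λ v → length (select (suc v) xs)) each)
        (≡.trans (cong₂ ℕ._+_ (P.uniform x) (handshake xs)) (≡.sym (ℕₚ.*-suc k (length xs))))
      where
      each : ∀ v → length (select (suc v) (x ∷ xs)) ≡
                   (if Vec.lookup (vertices x) v then suc (length (select (suc v) xs)) else length (select (suc v) xs))
      each v with Vec.lookup (vertices x) v
      ... | true  = refl
      ... | false = refl

  Saturated : Subset m → Fin n → Set
  Saturated M v = capacity v ℕ.≤ ∣ M ∩ incident v ∣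

  -- If every vertex of `e` had spare capacity, adding `e` would give a larger b-matching.
  maximum⇒saturated : ∀ {M} → IsMaximumBMatching M → ∀ e → e ∉ M →
                      ∃[ v ] Vec.lookup (vertices e) v ≡ true × Saturated M v
  maximum⇒saturated {M} (matching , maximum) e e∉M
    with Finₚ.any? (λ v → (Vec.lookup (vertices e) v Boolₚ.≟ true) ×-dec (capacity v ℕ.≤? ∣ M ∩ incident v ∣))
  ... | yes found = found
  ... | no none = ⊥-elim (ℕₚ.<-irrefl refl (subst (ℕ._≤ ∣ M ∣) (∣p∪⁅x⁆∣ e∉M) (maximum (M ∪ ⁅ e ⁆) larger)))
    where
    larger : IsBMatching (M ∪ ⁅ e ⁆)
    larger v with bool (Vec.lookup (vertices e) v)
    ... | inj₁ v∈e = ℕₚ.≤-trans (Subsetₚ.p⊆q⇒∣p∣≤∣q∣ (λ {x} x∈ → within x∈))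
        (ℕₚ.≤-trans (ℕₚ.≤-reflexive (∣p∪⁅x⁆∣ (e∉M ∘ proj₁ ∘ Subsetₚ.x∈p∩q⁻ M (incident v)))) (ℕₚ.≰⇒> (λ sat → none (v , v∈e , sat))))
      where
      within : (M ∪ ⁅ e ⁆) ∩ incident v ⊆ (M ∩ incident v) ∪ ⁅ e ⁆
      within x∈ with Subsetₚ.x∈p∩q⁻ (M ∪ ⁅ e ⁆) (incident v) x∈
      ... | x∈Me , x∈v with Subsetₚ.x∈p∪q⁻ M ⁅ e ⁆ x∈Me
      ...   | inj₁ x∈M = Subsetₚ.x∈p∪q⁺ (inj₁ (Subsetₚ.x∈p∩q⁺ (x∈M , x∈v)))
      ...   | inj₂ x∈e = Subsetₚ.x∈p∪q⁺ (inj₂ x∈e)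
    ... | inj₂ v∉e = ℕₚ.≤-trans (Subsetₚ.p⊆q⇒∣p∣≤∣q∣ (λ {x} x∈ → within x∈)) (matching v)
      where
      within : (M ∪ ⁅ e ⁆) ∩ incident v ⊆ M ∩ incident v
      within x∈ with Subsetₚ.x∈p∩q⁻ (M ∪ ⁅ e ⁆) (incident v) x∈
      ... | x∈Me , x∈v with Subsetₚ.x∈p∪q⁻ M ⁅ e ⁆ x∈Me
      ...   | inj₁ x∈M = Subsetₚ.x∈p∩q⁺ (x∈M , x∈v)
      ...   | inj₂ x∈e with Subsetₚ.x∈⁅y⁆⇒x≡y e x∈e
      ...     | refl = false≢true v∉e (∈-incident⁻ x∈v)

  module _ (W : Carrier) (N : ℕ)
    (ratio   : ∀ {X Y e e′} → X ⊆ˡ Y → e ∉ˡ Y → e′ ∉ˡ X → 0# < increment e′ X → increment e Y ≤ W * increment e′ X)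
    (maximal : ∀ ℓ → a * α ^ ℓ ≤ α * α * W → ℓ ℕ.≤ N) where

    open StackSize W N ratio maximal

    module _ {S : List (Fin m)} (good : Good (annotate S)) where

      private
        selected : ∀ i {b} → (∀ {xs} → Ind i xs → length xs ℕ.≤ b) → length (select i S) ℕ.≤ N ℕ.* b
        selected i {b} bound = subst (λ T → length (select i T) ℕ.≤ N ℕ.* b) (edges-annotate S) (active-count good i bound)

      size≤rank : ∀ {r} → IsRank r → length S ℕ.≤ N ℕ.* r
      size≤rank {r} (_ , greatest) = subst (λ T → length T ℕ.≤ N ℕ.* r) (select-zero S)
        (selected zero λ {xs} (u , ind) → subst (ℕ._≤ r) (∣fromList∣ u) (greatest _ (fromList xs , ind , refl)))

      -- A stacked edge lies in `M` or meets a saturated vertex. At such a vertex there are at most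
      -- `N` times its capacity stacked edges, and the capacity is at most the number of edges of
      -- `M` there; summing over vertices counts each edge of `M` k times.
      size≤matching : ∀ {M} → IsMaximumBMatching M → length S ℕ.≤ ∣ M ∣ ℕ.+ N ℕ.* (k ℕ.* ∣ M ∣)
      size≤matching {M} maximum = ℕₚ.≤-trans (⊆⇒length≤ (stack-unique good) covered)
          (ℕₚ.≤-trans (ℕₚ.≤-reflexive (Listₚ.length-++ (toList M)))
            (ℕₚ.+-mono-≤ (ℕₚ.≤-reflexive (length-toList M)) (begin
              length (concatMap around (allFin n))                               ≡⟨ length-concatMap around (allFin n) ⟩
              sum (map (length ∘ around) (allFin n))                             ≤⟨ sum-mono (allFin n) near ⟩
              sum (map (λ v → N ℕ.* length (select (suc v) (toList M))) (allFin n)) ≡⟨ sum-* (allFin n) N _ ⟩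
              N ℕ.* sum (map (λ v → length (select (suc v) (toList M))) (allFin n)) ≡⟨ cong (N ℕ.*_) (handshake (toList M)) ⟩
              N ℕ.* (k ℕ.* length (toList M))                                    ≡⟨ cong (λ l → N ℕ.* (k ℕ.* l)) (length-toList M) ⟩
              N ℕ.* (k ℕ.* ∣ M ∣)                                                ∎)))
        where
        open ℕₚ.≤-Reasoning
        saturated? : ∀ v → Dec (Saturated M v)
        saturated? v = capacity v ℕ.≤? ∣ M ∩ incident v ∣
        around : Fin n → List (Fin m)
        around v = if does (saturated? v) then select (suc v) S else []
        near : ∀ v → length (around v) ℕ.≤ N ℕ.* length (select (suc v) (toList M))
        near v with saturated? v
        ... | no unsat rewrite dec-false (saturated? v) unsat = ℕ.z≤n
        ... | yes sat rewrite dec-true (saturated? v) sat = ℕₚ.≤-trans (selected (suc v) proj₂) (ℕₚ.*-monoʳ-≤ N (ℕₚ.≤-trans sat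
            (ℕₚ.≤-trans (Subsetₚ.p⊆q⇒∣p∣≤∣q∣ (subst (λ X → X ∩ incident v ⊆ fromList (select (suc v) (toList M)))
              (fromList-toList M) (∩-incident (toList M) v))) (∣fromList∣≤length (select (suc v) (toList M))))))
        covered : S ⊆ˡ toList M ++ concatMap around (allFin n)
        covered {e} e∈S with e Subsetₚ.∈? M
        ... | yes e∈M = ∈ₚ.∈-++⁺ˡ (∈-toList⁺ e∈M)
        ... | no  e∉M with maximum⇒saturated {M} maximum e e∉M
        ...   | v , v∈e , sat = ∈ₚ.∈-++⁺ʳ (toList M) (∈ₚ.∈-concatMap⁺ around (lose (∈ₚ.∈-allFin v) e∈v))
          where
          e∈v : e ∈ˡ around v
          e∈v rewrite dec-true (saturated? v) sat = ∈-select⁺ (suc v) e∈S v∈e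

    usesAtMost : ∀ {M r B} → IsMaximumBMatching M → IsRank r → N ℕ.≤ B → 1 ℕ.+ N ℕ.* k ℕ.≤ B →
                 UsesAtMost P algorithm f (B ℕ.* (∣ M ∣ ℕ.⊓ r))
    usesAtMost {M} {r} {B} maximum isRank N≤B 1+Nk≤B stream stream↭ t =
      always-size (Uniqueₚ.take⁺ t (unique-stream stream↭)) λ {S} good →
        subst (length S ℕ.≤_) (≡.sym (ℕₚ.*-distribˡ-⊓ B ∣ M ∣ r)) (ℕₚ.⊓-glb
          (ℕₚ.≤-trans (size≤matching good {M} maximum) (ℕₚ.≤-trans (ℕₚ.≤-reflexive
            (cong (∣ M ∣ ℕ.+_) (≡.sym (ℕₚ.*-assoc N k ∣ M ∣)))) (ℕₚ.*-monoˡ-≤ ∣ M ∣ 1+Nk≤B)))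
          (ℕₚ.≤-trans (size≤rank good isRank) (ℕₚ.*-monoˡ-≤ r N≤B)))

-- Constants of the memory bounds, powers and logarithms.

linear-constant : ℕ → ℕ
linear-constant k = k ℕ.* (k ℕ.* 2) ℕ.+ (2 ℕ.+ k)

-- With chains of length at most `N = c * (1 ⊔ L)`, the stack is bounded by N per unit of rank and
-- by 1 + N k per edge of the matching; this covers both.
constant : ℕ → ℕ → ℕ
constant k c = 1 ℕ.+ c ℕ.* suc k

module Powers (R : EuclideanField) where
  open OrderedField R

  private
    2ᴿ : Carrier
    2ᴿ = 1# + 1#

  fromℕ-nonNegative : ∀ n → 0# ≤ fromℕ n
  fromℕ-nonNegative zero    = ≤-refl
  fromℕ-nonNegative (suc n) = +-nonNegative 0≤1 (fromℕ-nonNegative n)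

  1≤^ : ∀ {x} → 1# ≤ x → ∀ n → 1# ≤ x ^ n
  1≤^ 1≤x zero = ≤-refl
  1≤^ {x} 1≤x (suc n) = ≤-trans (≤-reflexive (≈-sym (*-identityˡ 1#))) (*-mono-≤ 0≤1 (≤-trans 0≤1 1≤x) 1≤x (1≤^ 1≤x n))

  ^-+ : ∀ x m n → x ^ (m ℕ.+ n) ≈ x ^ m * x ^ n
  ^-+ x zero    n = ≈-sym (*-identityˡ _)
  ^-+ x (suc m) n = ≈-trans (*-cong ≈-refl (^-+ x m n)) (≈-sym (*-assoc _ _ _))

  ^-nonNegative : ∀ {x} → 0# ≤ x → ∀ n → 0# ≤ x ^ n
  ^-nonNegative 0≤x zero    = 0≤1
  ^-nonNegative 0≤x (suc n) = *-nonNegative 0≤x (^-nonNegative 0≤x n)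

  ^-monoˡ-≤ : ∀ {x y} → 0# ≤ x → x ≤ y → ∀ n → x ^ n ≤ y ^ n
  ^-monoˡ-≤ 0≤x x≤y zero = ≤-refl
  ^-monoˡ-≤ 0≤x x≤y (suc n) = *-mono-≤ (^-nonNegative 0≤x n) (≤-trans 0≤x x≤y) x≤y (^-monoˡ-≤ 0≤x x≤y n)

  ^-monoʳ-≤ : ∀ {x m n} → 1# ≤ x → m ℕ.≤ n → x ^ m ≤ x ^ n
  ^-monoʳ-≤ {n = n} 1≤x ℕ.z≤n = 1≤^ 1≤x n
  ^-monoʳ-≤ 1≤x (ℕ.s≤s m≤n) = *-monoˡ-≤ (≤-trans 0≤1 1≤x) (^-monoʳ-≤ 1≤x m≤n)

  ^-* : ∀ x m n → x ^ (m ℕ.* n) ≈ (x ^ n) ^ m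
  ^-* x zero    n = ≈-refl
  ^-* x (suc m) n = ≈-trans (^-+ x n (m ℕ.* n)) (*-cong ≈-refl (^-* x m n))

  ^-cancel-≤ : ∀ {a} → 0# < a → ∀ m n → (1# + a) ^ m ≤ (1# + a) ^ n → m ℕ.≤ n
  ^-cancel-≤ {a} 0<a m n le with m ℕ.≤? n
  ... | yes m≤n = m≤n
  ... | no  m≰n = ⊥-elim (<⇒≰ 0<a (*-cancelˡ-≤ (<-≤-trans 0<1 (1≤^ 1≤α n)) (≤-by _ (≤⇒0≤ (begin
      α * α ^ n  ≤⟨ ^-monoʳ-≤ 1≤α (ℕₚ.≰⇒> m≰n) ⟩
      α ^ m      ≤⟨ le ⟩
      α ^ n      ∎)) (solve 2 (λ a x → x :- (con (+ 1) :+ a) :* x := x :* con (+ 0) :- x :* a) ≈-refl a (α ^ n)))))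
    where
    open ≤-Reasoning
    α = 1# + a
    1≤α : 1# ≤ α
    1≤α = x≤x+y (proj₁ 0<a)

  bernoulli : ∀ {a} → 0# ≤ a → ∀ n → 1# + fromℕ n * a ≤ (1# + a) ^ n
  bernoulli {a} 0≤a zero = ≤-reflexive (solve 1 (λ a → con (+ 1) :+ con (+ 0) :* a := con (+ 1)) ≈-refl a)
  bernoulli {a} 0≤a (suc n) = begin
    1# + (1# + fromℕ n) * a             ≤⟨ ≤-by (a * (fromℕ n * a)) (*-nonNegative 0≤a (*-nonNegative (fromℕ-nonNegative n) 0≤a))
                                             (solve 2 (λ a n → a :* (n :* a) := (con (+ 1) :+ a) :* (con (+ 1) :+ n :* a) :- (con (+ 1) :+ (con (+ 1) :+ n) :* a)) ≈-refl a (fromℕ n)) ⟩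
    (1# + a) * (1# + fromℕ n * a)       ≤⟨ *-monoˡ-≤ (+-nonNegative 0≤1 0≤a) (bernoulli 0≤a n) ⟩
    (1# + a) * (1# + a) ^ n             ∎
    where open ≤-Reasoning

  fromℕ≤2^ : ∀ n → fromℕ n ≤ 2ᴿ ^ n
  fromℕ≤2^ n = ≤-trans (≤-by 1# 0≤1 (solve 1 (λ n → con (+ 1) := (con (+ 1) :+ n :* con (+ 1)) :- n) ≈-refl (fromℕ n))) (bernoulli 0≤1 n)

  quotient-cancel : ∀ {x y} → 0# < y → x / y * y ≈ x
  quotient-cancel {x} {y} 0<y = begin-equality
    x * y ⁻¹ * y     ≈⟨ solve 3 (λ x y i → x :* i :* y := x :* (y :* i)) ≈-refl x y (y ⁻¹) ⟩
    x * (y * y ⁻¹)   ≈⟨ *-cong ≈-refl (⁻¹-inverse 0<y) ⟩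
    x * 1#           ≈⟨ *-identityʳ x ⟩
    x                ∎
    where open ≤-Reasoning

  /-positive : ∀ {x y} → 0# < x → 0# < y → 0# < x / y
  /-positive 0<x 0<y = *-positive 0<x (⁻¹-positive 0<y)

  √-positive : ∀ {x} → 0# < x → 0# < √ x
  √-positive {x} 0<x = √-nonNegative x (proj₁ 0<x) , λ 0≈√ → proj₂ 0<x (begin-equality
    0#           ≈⟨ zeroˡ (√ x) ⟨
    0# * √ x     ≈⟨ *-cong 0≈√ ≈-refl ⟩
    √ x * √ x    ≈⟨ √-square x (proj₁ 0<x) ⟩
    x            ∎)
    where open ≤-Reasoning

  -- The hypothesis on ℓ is what the definition of W yields for a token of length ℓ.
  chain-short : ∀ {ε W L} → 0# < ε → W / ε ≤ (1# + ε) ^ L →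
                ∀ ℓ → ε * (1# + ε) ^ ℓ ≤ (1# + ε) * (1# + ε) * W → ℓ ℕ.≤ 3 ℕ.* (1 ℕ.⊔ L)
  chain-short {ε} {W} {L} 0<ε W≤ ℓ le = ℕₚ.≤-trans (^-cancel-≤ 0<ε ℓ (2 ℕ.+ L) (*-cancelˡ-≤ 0<ε (begin
      ε * β ^ ℓ                        ≤⟨ le ⟩
      β * β * W                        ≈⟨ *-cong ≈-refl (quotient-cancel 0<ε) ⟨
      β * β * (W / ε * ε)              ≤⟨ *-monoˡ-≤ (*-nonNegative 0≤β 0≤β) (*-mono-≤ (proj₁ 0<ε) (^-nonNegative 0≤β L) W≤ ≤-refl) ⟩
      β * β * (β ^ L * ε)              ≈⟨ solve 3 (λ b p e → b :* b :* (p :* e) := e :* (b :* (b :* p))) ≈-refl β (β ^ L) ε ⟩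
      ε * β ^ (2 ℕ.+ L)                ∎)))
      (ℕₚ.+-mono-≤ (ℕₚ.m≤m⊔n 1 L) (ℕₚ.+-mono-≤ (ℕₚ.m≤m⊔n 1 L) (ℕₚ.≤-trans (ℕₚ.m≤n⊔m 1 L) (ℕₚ.≤-reflexive (≡.sym (ℕₚ.+-identityʳ _))))))
    where
    open ≤-Reasoning
    β = 1# + ε
    0≤β = +-nonNegative 0≤1 (proj₁ 0<ε)

  -- Refining ε to a = ε / k costs a constant factor in the chain length:
  -- 1 + ε ≤ (1 + a) ^ k, and W ≥ 1 gives 2 ≤ (1 + ε) ^ (1 + L), which absorbs
  -- the factor k ≤ 2 ^ k that the refinement leaves in the hypothesis.
  refined-chain-short : ∀ {ε a W L} k → 0# < ε → 0# < a → fromℕ k * a ≈ ε → 1# ≤ W → W / ε ≤ (1# + ε) ^ L →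
                        ∀ ℓ → a * (1# + a) ^ ℓ ≤ (1# + a) * (1# + a) * W → ℓ ℕ.≤ linear-constant k ℕ.* (1 ℕ.⊔ L)
  refined-chain-short {ε} {a} {W} {L} k 0<ε 0<a ka≈ε 1≤W W≤ ℓ le =
      ℕₚ.≤-trans (^-cancel-≤ 0<a ℓ (k ℕ.* (suc L ℕ.* k) ℕ.+ (2 ℕ.+ L ℕ.* k)) (*-cancelˡ-≤ 0<a (begin
        a * α ^ ℓ                                              ≤⟨ le ⟩
        α * α * W                                              ≤⟨ *-monoˡ-≤ 0≤αα W≤′ ⟩
        α * α * (ε * β ^ L)                                    ≤⟨ *-monoˡ-≤ 0≤αα (*-monoˡ-≤ (proj₁ 0<ε) (β^≤ L)) ⟩
        α * α * (ε * α ^ (L ℕ.* k))                            ≈⟨ *-cong ≈-refl (*-cong ka≈ε ≈-refl) ⟨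
        α * α * (fromℕ k * a * α ^ (L ℕ.* k))                  ≈⟨ solve 4 (λ c n a p → c :* c :* (n :* a :* p) := a :* (n :* (c :* (c :* p)))) ≈-refl α (fromℕ k) a (α ^ (L ℕ.* k)) ⟩
        a * (fromℕ k * α ^ (2 ℕ.+ L ℕ.* k))                    ≤⟨ *-monoˡ-≤ (proj₁ 0<a) (*-mono-≤ (^-nonNegative 0≤α (2 ℕ.+ L ℕ.* k)) (^-nonNegative 0≤α (k ℕ.* (suc L ℕ.* k))) k≤ ≤-refl) ⟩
        a * (α ^ (k ℕ.* (suc L ℕ.* k)) * α ^ (2 ℕ.+ L ℕ.* k))  ≈⟨ *-cong ≈-refl (^-+ α (k ℕ.* (suc L ℕ.* k)) (2 ℕ.+ L ℕ.* k)) ⟨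
        a * α ^ (k ℕ.* (suc L ℕ.* k) ℕ.+ (2 ℕ.+ L ℕ.* k))      ∎))) exponent
    where
    open ≤-Reasoning
    α β : Carrier
    α = 1# + a
    β = 1# + ε
    0≤α = +-nonNegative 0≤1 (proj₁ 0<a)
    0≤β = +-nonNegative 0≤1 (proj₁ 0<ε)
    0≤αα = *-nonNegative 0≤α 0≤α
    1≤β : 1# ≤ β
    1≤β = x≤x+y (proj₁ 0<ε)
    W≤′ : W ≤ ε * β ^ L
    W≤′ = begin
      W            ≈⟨ quotient-cancel 0<ε ⟨
      W / ε * ε    ≤⟨ *-mono-≤ (proj₁ 0<ε) (^-nonNegative 0≤β L) W≤ ≤-refl ⟩
      β ^ L * ε    ≈⟨ *-comm _ _ ⟩
      ε * β ^ L    ∎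
    β^≤ : ∀ n → β ^ n ≤ α ^ (n ℕ.* k)
    β^≤ n = ≤-trans (^-monoˡ-≤ 0≤β (≤-trans (≤-reflexive (+-cong ≈-refl (≈-sym ka≈ε))) (bernoulli (proj₁ 0<a) k)) n)
      (≤-reflexive (≈-sym (^-* α n k)))
    2≤ : 2ᴿ ≤ β ^ suc L
    2≤ = begin
      1# + 1#               ≤⟨ +-mono-≤ (1≤^ 1≤β L) (≤-trans 1≤W W≤′) ⟩
      β ^ L + ε * β ^ L     ≈⟨ solve 2 (λ p e → p :+ e :* p := (con (+ 1) :+ e) :* p) ≈-refl (β ^ L) ε ⟩
      β * β ^ L             ∎
    k≤ : fromℕ k ≤ α ^ (k ℕ.* (suc L ℕ.* k))
    k≤ = begin
      fromℕ k                          ≤⟨ fromℕ≤2^ k ⟩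
      2ᴿ ^ k                           ≤⟨ ^-monoˡ-≤ (+-nonNegative 0≤1 0≤1) (≤-trans 2≤ (β^≤ (suc L))) k ⟩
      (α ^ (suc L ℕ.* k)) ^ k          ≈⟨ ^-* α k (suc L ℕ.* k) ⟨
      α ^ (k ℕ.* (suc L ℕ.* k))        ∎
    exponent : k ℕ.* (suc L ℕ.* k) ℕ.+ (2 ℕ.+ L ℕ.* k) ℕ.≤ linear-constant k ℕ.* (1 ℕ.⊔ L)
    exponent = ℕₚ.≤-trans
      (ℕₚ.+-mono-≤ (ℕₚ.*-monoʳ-≤ k (ℕₚ.*-monoˡ-≤ k (ℕₚ.+-mono-≤ (ℕₚ.m≤m⊔n 1 L) (ℕₚ.m≤n⊔m 1 L))))
        (ℕₚ.+-mono-≤ (ℕₚ.*-monoʳ-≤ 2 (ℕₚ.m≤m⊔n 1 L)) (ℕₚ.*-monoˡ-≤ k (ℕₚ.m≤n⊔m 1 L))))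
      (ℕₚ.≤-reflexive (S.solve 2 (λ k l → k S.:* ((l S.:+ l) S.:* k) S.:+ (S.con 2 S.:* l S.:+ l S.:* k) S.:=
        (k S.:* (k S.:* S.con 2) S.:+ (S.con 2 S.:+ k)) S.:* l) refl k (1 ℕ.⊔ L)))
      where module S = +-*-Solver

-- Linear functions, and the guarantees for submodular ones.

module LinearFunctions (R : EuclideanField) where
  open OrderedField R
  open Streaming R

  linear-⊥ : ∀ {m} (w : Fin m → Carrier) → linear w ⊥ ≈ 0#
  linear-⊥ {zero}  w = ≈-refl
  linear-⊥ {suc m} w = linear-⊥ (w ∘ suc)

  linear-∪ : ∀ {m} (w : Fin m → Carrier) {X e} → e ∉ X → linear w (X ∪ ⁅ e ⁆) ≈ linear w X + w e
  linear-∪ w {inside ∷ X} {zero} e∉ = ⊥-elim (e∉ Vec.here)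
  linear-∪ w {outside ∷ X} {zero} e∉ rewrite Subsetₚ.∪-identityʳ X = +-comm _ _
  linear-∪ w {inside ∷ X} {suc e} e∉ = ≈-trans (+-cong ≈-refl (linear-∪ (w ∘ suc) (e∉ ∘ Vec.there))) (≈-sym (+-assoc _ _ _))
  linear-∪ w {outside ∷ X} {suc e} e∉ = linear-∪ (w ∘ suc) (e∉ ∘ Vec.there)

  linear-nonNegative : ∀ {m} (w : Fin m → Carrier) → (∀ e → 0# ≤ w e) → NonNegative (linear w)
  linear-nonNegative w 0≤w [] = ≤-refl
  linear-nonNegative w 0≤w (inside ∷ X) = +-nonNegative (0≤w zero) (linear-nonNegative (w ∘ suc) (0≤w ∘ suc) X)
  linear-nonNegative w 0≤w (outside ∷ X) = linear-nonNegative (w ∘ suc) (0≤w ∘ suc) X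

  linear-marginal : ∀ {m} (w : Fin m → Carrier) {X e} → e ∉ X → marginal (linear w) e X ≈ w e
  linear-marginal w {X} {e} e∉X = ≈-trans (+-cong (linear-∪ w e∉X) ≈-refl)
    (solve 2 (λ x y → (x :+ y) :- x := y) ≈-refl (linear w X) (w e))

  linear-submodular : ∀ {m} (w : Fin m → Carrier) → Submodular (linear w)
  linear-submodular w X⊆Y e∉Y = ≤-reflexive (≈-trans (linear-marginal w e∉Y) (≈-sym (linear-marginal w (e∉Y ∘ X⊆Y))))

module Guarantees (R : EuclideanField) {k : ℕ} (P : Problem k) (f : Subset (Problem.m P) → EuclideanField.Carrier R) where
  open OrderedField R
  open Powers R
  open Streaming R
  open OutcomeProperties R
  open Problem P using (m; Feasible; IsMaximumBMatching; IsRank)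

  within-constant : ∀ c l → 1 ℕ.≤ l → c ℕ.* l ℕ.≤ constant k c ℕ.* l × 1 ℕ.+ c ℕ.* l ℕ.* k ℕ.≤ constant k c ℕ.* l
  within-constant c l 1≤l =
      ℕₚ.*-monoˡ-≤ l (ℕₚ.≤-trans (ℕₚ.m≤m*n c (suc k)) (ℕₚ.n≤1+n _)) ,
      ℕₚ.+-mono-≤ 1≤l (ℕₚ.≤-trans (ℕₚ.m≤n+m (c ℕ.* l ℕ.* k) (c ℕ.* l)) (ℕₚ.≤-reflexive
        (S.solve 3 (λ c l k → c S.:* l S.:+ c S.:* l S.:* k S.:= c S.:* (S.con 1 S.:+ k) S.:* l) refl c l k)))
    where module S = +-*-Solver

  D : Carrier
  D = fromℕ k + 1#

  0<D : 0# < D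
  0<D = <-≤-trans (+-positive 0<1 (fromℕ-nonNegative k)) (≤-reflexive (+-comm _ _))

  1≤D : 1# ≤ D
  1≤D = x≤y+x (fromℕ-nonNegative k)

  module _ {a : Carrier} (0<a : 0# < a) {μ : Mode} (coin : Outcome Bool μ) where

    open Streamer R a coin
    open Instance R a 0<a coin P f
    open LocalRatio R (1# + a) (suc (Problem.n P))
    open Analysis R a 0<a isActive constraint f
    open Process R a 0<a isActive constraint f coin
    open Procedure oracle

    module SubmodularCase (nonNegative : NonNegative f) (submodular : Submodular f)
      (q : Carrier) (0≤q : 0# ≤ q) (q≤1 : q ≤ 1#)
      (coin-law : ∀ (h : Bool → Carrier) → 𝔼 h coin ≈ q * h true + (1# - q) * h false)
      (skew : 1# - q ≤ q * (α * D))
      {stream : List (Fin m)} (u : Unique stream) (complete : ∀ e → e ∈ˡ stream) {O : Subset m} (feasibleO : Feasible O)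
      where

      open Expectation q 0≤q q≤1 coin-law public

      private
        -- Once `e` is in the stack its presence in `X` adds nothing, so `Q` does not grow when `e`
        -- enters both; hence κ is 0.
        Q : Subset m → List (Fin m) → Carrier
        Q X S = f (X ∪ fromList S) - f (fromList S)

        t = runStack [] stream

        marginal-∪ : ∀ {X e S} → e ∉ X → e ∉ˡ S → marginal f e (X ∪ fromList S) ≤ increment e S
        marginal-∪ {X} {e} {S} e∉X e∉S = submodular (Subsetₚ.q⊆p∪q X (fromList S)) λ e∈ → case Subsetₚ.x∈p∪q⁻ X (fromList S) e∈ of λ
          { (inj₁ e∈X) → e∉X e∈X ; (inj₂ e∈S) → e∉S (∈-fromList⁻ S e∈S) }

        skip-≤ : ∀ {X e S} → e ∉ X → e ∉ˡ S → Q X (e ∷ S) ≤ Q X S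
        skip-≤ {X} {e} {S} e∉X e∉S = ≤-by _ (≤⇒0≤ (marginal-∪ e∉X e∉S)) (≈-trans
          (solve 4 (λ xse xs se s → (se :- s) :- (xse :- xs) := (xs :- s) :- (xse :- se)) ≈-refl _ (f (X ∪ fromList S)) (f (fromList (e ∷ S))) (f (fromList S)))
          (+-cong ≈-refl (-‿cong (+-cong (reflexive (cong f (Subsetₚ.∪-assoc X (fromList S) ⁅ e ⁆))) ≈-refl))))

        only-≤ : ∀ {X e S} → e ∉ X → e ∉ˡ S → Q (X ∪ ⁅ e ⁆) S ≤ Q X S + increment e S
        only-≤ {X} {e} {S} e∉X e∉S = ≤-by _ (≤⇒0≤ (marginal-∪ e∉X e∉S)) (≈-trans
          (solve 4 (λ xse xs s i → i :- (xse :- xs) := ((xs :- s) :+ i) :- (xse :- s)) ≈-refl _ (f (X ∪ fromList S)) (f (fromList S)) (increment e S))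
          (+-cong ≈-refl (-‿cong (+-cong (reflexive (cong f swapped)) ≈-refl))))
          where
          swapped : (X ∪ fromList S) ∪ ⁅ e ⁆ ≡ (X ∪ ⁅ e ⁆) ∪ fromList S
          swapped = ≡.trans (Subsetₚ.∪-assoc X (fromList S) ⁅ e ⁆)
            (≡.trans (cong (X ∪_) (Subsetₚ.∪-comm (fromList S) ⁅ e ⁆)) (≡.sym (Subsetₚ.∪-assoc X ⁅ e ⁆ (fromList S))))

        both-≤ : ∀ {X e S} → e ∉ X → e ∉ˡ S → Q (X ∪ ⁅ e ⁆) (e ∷ S) ≤ Q X S + 0# * increment e S
        both-≤ {X} {e} {S} e∉X e∉S = ≤-trans (≤-reflexive (+-cong (reflexive (cong f absorbed)) ≈-refl))
          (≤-trans (skip-≤ e∉X e∉S) (≤-reflexive (solve 2 (λ q i → q := q :+ con (+ 0) :* i) ≈-refl (Q X S) (increment e S))))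
          where
          absorbed : (X ∪ ⁅ e ⁆) ∪ fromList (e ∷ S) ≡ X ∪ fromList (e ∷ S)
          absorbed = ≡.trans (Subsetₚ.∪-assoc X ⁅ e ⁆ _) (cong (X ∪_)
            (≡.trans (Subsetₚ.∪-comm ⁅ e ⁆ _) (≡.trans (Subsetₚ.∪-assoc (fromList S) ⁅ e ⁆ ⁅ e ⁆) (cong (fromList S ∪_) (Subsetₚ.∪-idem ⁅ e ⁆)))))

        0*-≤ : ∀ {x} → 1# - q ≤ x → q * 0# + (1# - q) ≤ x
        0*-≤ = ≤-trans (≤-reflexive (solve 1 (λ q → q :* con (+ 0) :+ (con (+ 1) :- q) := con (+ 1) :- q) ≈-refl q))

        1-q≤α : 1# - q ≤ α
        1-q≤α = ≤-trans (≤-by q 0≤q (solve 1 (λ q → q := con (+ 1) :- (con (+ 1) :- q)) ≈-refl q)) 1≤α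

        open Charging D degree Q 0# skip-≤ both-≤ only-≤ (0*-≤ 1-q≤α) (0*-≤ skew) O (feasible⇒independent feasibleO)

        ρ : Carrier
        ρ = α * (1# + a * D)

        0≤aD = *-nonNegative (proj₁ 0<a) (proj₁ 0<D)

        a≤ρ : a ≤ ρ
        a≤ρ = ≤-by (1# + α * (a * D)) (+-nonNegative 0≤1 (*-nonNegative (proj₁ α-positive) 0≤aD))
          (solve 2 (λ a d → con (+ 1) :+ (con (+ 1) :+ a) :* (a :* d) := (con (+ 1) :+ a) :* (con (+ 1) :+ a :* d) :- a) ≈-refl a D)

      -- `f (O ∪ S)` splits into the marginal value of `O`, in expectation at most `α * D` times the
      -- gains, and the value of the stack, at most `f ⊥` plus `α / a` times the gains. The factor
      -- `θ` is the part of the optimum that survives the union with the stack.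
      ratio-bound : ∀ {θ} → θ * f O ≤ 𝔼 (λ S → f (O ∪ fromList S)) t →
                    a * (θ * f O) ≤ α * (1# + a * D) * 𝔼 (value ∘ choose) t
      ratio-bound {θ} survived = begin
        a * (θ * f O)                                                 ≤⟨ *-monoˡ-≤ (proj₁ 0<a) survived ⟩
        a * 𝔼 (λ S → f (O ∪ fromList S)) t                            ≤⟨ *-monoˡ-≤ (proj₁ 0<a) (𝔼-mono t (Always-const t λ S →
                                                                           ≤-reflexive (solve 2 (λ x y → x := (x :- y) :+ y) ≈-refl (f (O ∪ fromList S)) (f (fromList S))))) ⟩
        a * 𝔼 (λ S → Q O S + f (fromList S)) t                        ≈⟨ *-cong ≈-refl (𝔼-+ (Q O) (f ∘ fromList) t) ⟩
        a * (𝔼 (Q O) t + 𝔼 (f ∘ fromList) t)                          ≈⟨ distribˡ a _ _ ⟩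
        a * 𝔼 (Q O) t + a * 𝔼 (f ∘ fromList) t                        ≤⟨ +-mono-≤ (*-monoˡ-≤ (proj₁ 0<a) (≤-trans (expected-bound u (λ {e} _ → complete e)) (+-monoˡ-≤ _ initial≤0)))
                                                                           (≤-trans (≤-reflexive (≈-sym (𝔼-* a (f ∘ fromList) t)))
                                                                             (𝔼-mono t (always-good u λ {S} good → subst (λ T → a * f (fromList T) ≤ a * f ⊥ + α * gains S) (edges-annotate S) (stack-value good)))) ⟩
        a * (0# + α * D * 𝔼 gains t) + 𝔼 (λ S → a * f ⊥ + α * gains S) t
          ≈⟨ +-cong (≈-trans (solve 4 (λ a c d g → a :* (con (+ 0) :+ c :* d :* g) := a :* c :* d :* g) ≈-refl a α D (𝔼 gains t)) (≈-sym (𝔼-* (a * α * D) gains t))) ≈-refl ⟩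
        𝔼 (λ S → a * α * D * gains S) t + 𝔼 (λ S → a * f ⊥ + α * gains S) t   ≈⟨ 𝔼-+ _ _ t ⟨
        𝔼 (λ S → a * α * D * gains S + (a * f ⊥ + α * gains S)) t     ≤⟨ 𝔼-mono t (always-good u pointwise) ⟩
        𝔼 (λ S → ρ * value (choose S)) t                              ≈⟨ 𝔼-* ρ (value ∘ choose) t ⟩
        ρ * 𝔼 (value ∘ choose) t                                      ∎
        where
        open ≤-Reasoning
        initial≤0 : Q ⊥ [] ≤ 0#
        initial≤0 = ≤-reflexive (≈-trans (+-cong (reflexive (cong f (Subsetₚ.∪-identityʳ ⊥))) ≈-refl) (-‿inverseʳ (f ⊥)))
        pointwise : ∀ {S} → Good (annotate S) →
                    a * α * D * gains S + (a * f ⊥ + α * gains S) ≤ ρ * value (choose S)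
        pointwise {S} good = begin
          a * α * D * gains S + (a * f ⊥ + α * gains S)
            ≈⟨ solve 5 (λ a c d g b → a :* c :* d :* g :+ (a :* b :+ c :* g) := a :* b :+ c :* (con (+ 1) :+ a :* d) :* g) ≈-refl a α D (gains S) (f ⊥) ⟩
          a * f ⊥ + ρ * gains S
            -- The coefficient of `f ⊥` is raised from `a` to `ρ` so that the sum `f ⊥ + gains`,
            -- guaranteed to the answer, can be factored out.
            ≤⟨ +-monoˡ-≤ _ (*-mono-≤ (nonNegative ⊥) (≤-trans (proj₁ 0<a) a≤ρ) a≤ρ ≤-refl) ⟩
          ρ * f ⊥ + ρ * gains S             ≈⟨ distribˡ ρ _ _ ⟨
          ρ * (f ⊥ + gains S)               ≤⟨ *-monoˡ-≤ (≤-trans (proj₁ 0<a) a≤ρ) (choose-value submodular good) ⟩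
          ρ * value (choose S)              ∎

    submodular-memory : MemoryBound P algorithm f (IsMaxMarginalRatio f) a (constant k 3)
    submodular-memory {W} {L} {M} {r} (_ , greatest) (W≤ , _) maximum isRank =
        usesAtMost W (3 ℕ.* (1 ℕ.⊔ L)) ratio (chain-short {L = L} 0<a W≤) {M} {r} maximum isRank (proj₁ enough) (proj₂ enough)
      where
      open ≤-Reasoning
      enough = within-constant 3 (1 ℕ.⊔ L) (ℕₚ.m≤m⊔n 1 L)
      ratio : ∀ {X Y e e′} → X ⊆ˡ Y → e ∉ˡ Y → e′ ∉ˡ X → 0# < increment e′ X → increment e Y ≤ W * increment e′ X
      ratio {X} {Y} {e} {e′} X⊆Y _ _ 0<inc = begin
        increment e Y                                       ≈⟨ quotient-cancel 0<inc ⟨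
        increment e Y / increment e′ X * increment e′ X     ≈⟨ *-comm _ _ ⟩
        increment e′ X * (increment e Y / increment e′ X)   ≤⟨ *-monoˡ-≤ (proj₁ 0<inc) (greatest _
                                                                 (fromList X , fromList Y , e , e′ , fromList-⊆ {xs = X} {Y} X⊆Y , 0<inc , ≈-refl)) ⟩
        increment e′ X * W                                  ≈⟨ *-comm _ _ ⟩
        W * increment e′ X                                  ∎

-- The linear case.

module LinearCase (R : EuclideanField) {k : ℕ} (P : Problem k)
  (w : Fin (Problem.m P) → EuclideanField.Carrier R) (0≤w : ∀ e → EuclideanField._≤_ R (EuclideanField.0# R) (w e))
  {ε : EuclideanField.Carrier R} (0<ε : EuclideanField._<_ R (EuclideanField.0# R) ε) where

  open OrderedField R
  open Powers R
  open LinearFunctions R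
  open Streaming R
  open Guarantees R P (linear w)
  open Problem P using (m)

  -- This makes the charging factor `α * D` equal to `k + 1 + ε`. Chains then grow only by `1 + a`
  -- instead of `1 + ε`, which is why the memory bound uses `refined-chain-short`.
  a : Carrier
  a = ε / (fromℕ k + 1#)

  0<a : 0# < a
  0<a = /-positive 0<ε 0<D

  coin : Outcome Bool deterministic
  coin = pure true

  open Streamer R a coin
  open Instance R a 0<a coin P (linear w)
  open LocalRatio R (1# + a) (suc (Problem.n P))
  open Analysis R a 0<a isActive constraint (linear w)
  open Process R a 0<a isActive constraint (linear w) coin
  open Procedure oracle

  coin-law : ∀ (h : Bool → Carrier) → 𝔼 h coin ≈ 1# * h true + (1# - 1#) * h false
  coin-law h = solve 2 (λ x y → x := con (+ 1) :* x :+ (con (+ 1) :- con (+ 1)) :* y) ≈-refl (h true) (h false)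

  open Expectation 1# 0≤1 ≤-refl coin-law

  αD≈ : α * D ≈ fromℕ k + 1# + ε
  αD≈ = ≈-trans (solve 2 (λ a d → (con (+ 1) :+ a) :* d := d :+ a :* d) ≈-refl a D) (+-cong ≈-refl (quotient-cancel 0<D))

  0≤αD : 0# ≤ α * D
  0≤αD = *-nonNegative (proj₁ α-positive) (proj₁ 0<D)

  increment≈ : ∀ {e S} → e ∉ˡ S → increment e S ≈ w e
  increment≈ {e} {S} e∉S = linear-marginal w (e∉S ∘ ∈-fromList⁻ S)

  linear-approximates : Approximates P algorithm (linear w) (fromℕ k + 1# + ε)
  linear-approximates = approximates (≤-trans 0≤αD (≤-reflexive αD≈)) λ {stream} {O} u complete feasibleO →
    let open Charging D degree (λ X _ → linear w X) 1# (λ _ _ → ≤-refl)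
          (λ {X} {e} {S} e∉X e∉S → ≤-trans (extended {X} {e} {S} e∉X e∉S) (≤-reflexive (+-cong ≈-refl (≈-sym (*-identityˡ (increment e S))))))
          (λ {X} {e} {S} e∉X e∉S → extended {X} {e} {S} e∉X e∉S)
          (≤-trans (≤-reflexive one) 1≤α)
          (≤-trans (≤-reflexive one) (≤-trans 1≤αD (≤-reflexive (≈-sym (*-identityˡ _)))))
          O (feasible⇒independent feasibleO)
        t = runStack [] stream
        open ≤-Reasoning
    in begin
      linear w O                                        ≈⟨ constant-𝔼 (linear w O) t ⟨
      𝔼 (λ _ → linear w O) t                            ≤⟨ expected-bound u (λ {e} _ → complete e) ⟩
      linear w ⊥ + α * D * 𝔼 gains t                    ≈⟨ ≈-trans (+-cong (linear-⊥ w) ≈-refl) (+-identityˡ _) ⟩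
      α * D * 𝔼 gains t                                 ≤⟨ *-monoˡ-≤ 0≤αD (𝔼-mono t (always-good u λ {S} good →
                                                             ≤-trans (≤-reflexive (≈-sym (≈-trans (+-cong (linear-⊥ w) ≈-refl) (+-identityˡ (gains S)))))
                                                               (choose-value (linear-submodular w) good))) ⟩
      α * D * 𝔼 (value ∘ choose) t                      ≈⟨ *-cong αD≈ ≈-refl ⟩
      (fromℕ k + 1# + ε) * 𝔼 (value ∘ choose) t         ∎
    where
    open OutcomeProperties R
    one : 1# * 1# + (1# - 1#) ≈ 1#
    one = solve 0 (con (+ 1) :* con (+ 1) :+ (con (+ 1) :- con (+ 1)) := con (+ 1)) ≈-refl
    1≤αD : 1# ≤ α * D
    1≤αD = ≤-trans (≤-reflexive (≈-sym (*-identityˡ 1#))) (*-mono-≤ 0≤1 (proj₁ α-positive) 1≤α 1≤D)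
    extended : ∀ {X : Subset m} {e S} → e ∉ X → e ∉ˡ S → linear w (X ∪ ⁅ e ⁆) ≤ linear w X + increment e S
    extended {X} {e} {S} e∉X e∉S = ≤-reflexive (≈-trans (linear-∪ w e∉X) (+-cong ≈-refl (≈-sym (increment≈ {e} {S} e∉S))))
    constant-𝔼 : ∀ c {A : Set} (t : Outcome A deterministic) → 𝔼 (λ _ → c) t ≈ c
    constant-𝔼 c (pure _) = ≈-refl

  linear-memory : MemoryBound P algorithm (linear w) (IsMaxWeightRatio w) ε (constant k (linear-constant (suc k)))
  linear-memory {W} {L} {M} {r} ((_ , e₀ , _ , we₀≉0 , _) , greatest) (W≤ , _) maximum isRank =
      usesAtMost W (linear-constant (suc k) ℕ.* (1 ℕ.⊔ L)) ratio
        (refined-chain-short {L = L} (suc k) 0<ε 0<a ka≈ε 1≤W W≤) {M} {r} maximum isRank (proj₁ enough) (proj₂ enough)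
    where
    open ≤-Reasoning
    enough = within-constant (linear-constant (suc k)) (1 ℕ.⊔ L) (ℕₚ.m≤m⊔n 1 L)
    ka≈ε : fromℕ (suc k) * a ≈ ε
    ka≈ε = ≈-trans (*-cong (+-comm _ _) ≈-refl) (≈-trans (*-comm _ _) (quotient-cancel 0<D))
    1≤W : 1# ≤ W
    -- The maximum `W` is attained, so some edge has nonzero weight, and its ratio to itself is 1.
    1≤W = ≤-trans (≤-reflexive (≈-sym (*-inverseʳ (w e₀) we₀≉0))) (greatest _ (e₀ , e₀ , we₀≉0 , we₀≉0 , ≈-refl))
    ratio : ∀ {X Y e e′} → X ⊆ˡ Y → e ∉ˡ Y → e′ ∉ˡ X → 0# < increment e′ X → increment e Y ≤ W * increment e′ X
    ratio {X} {Y} {e} {e′} _ e∉Y e′∉X 0<inc with w e ≟ 0#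
    ... | yes we≈0 = begin
      increment e Y           ≈⟨ ≈-trans (increment≈ {e} {Y} e∉Y) we≈0 ⟩
      0#                      ≤⟨ *-nonNegative (≤-trans 0≤1 1≤W) (proj₁ 0<inc) ⟩
      W * increment e′ X      ∎
    ... | no we≉0 = begin
      increment e Y           ≈⟨ increment≈ {e} {Y} e∉Y ⟩
      w e                     ≈⟨ quotient-cancel 0<we′ ⟨
      w e / w e′ * w e′       ≤⟨ *-mono-≤ (0≤w e′) (≤-trans 0≤1 1≤W) (greatest _ (e , e′ , we≉0 , proj₂ 0<we′ ∘ ≈-sym , ≈-refl)) ≤-refl ⟩
      W * w e′                ≈⟨ *-cong ≈-refl (increment≈ {e′} {X} e′∉X) ⟨
      W * increment e′ X      ∎
      where
      0<we′ : 0# < w e′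
      0<we′ = <-≤-trans 0<inc (≤-reflexive (increment≈ {e′} {X} e′∉X))

-- The submodular cases: choice of parameters.

module SubmodularCases (R : EuclideanField) (k : ℕ) where
  open OrderedField R
  open Powers R
  open Streaming R

  K D 2# 3# : Carrier
  K = fromℕ k
  D = K + 1#
  2# = fromℕ 2
  3# = fromℕ 3

  0<D : 0# < D
  0<D = <-≤-trans (+-positive 0<1 (fromℕ-nonNegative k)) (≤-reflexive (+-comm _ _))

  module MonotoneCase where

    -- The ratio (1 + a)(1 + a D) / a equals D + 1 + a D + 1 / a, which is least at a = 1 / √D with
    -- value D + 1 + 2 √D.
    s a : Carrier
    s = √ D
    a = 1# / s

    0<s : 0# < s
    0<s = √-positive 0<D

    0<a : 0# < a
    0<a = /-positive 0<1 0<s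

    coin : Outcome Bool deterministic
    coin = pure true

    open Streamer R a coin public

    module _ (P : Problem k) (f : Subset (Problem.m P) → Carrier)
      (nonNegative : NonNegative f) (submodular : Submodular f) (monotone : Monotone f) where

      open Guarantees R P f hiding (D; 0<D)
      open Instance R a 0<a coin P f
      open LocalRatio R (1# + a) (suc (Problem.n P))
      open Analysis R a 0<a isActive constraint f
      open Process R a 0<a isActive constraint f coin
      open Procedure oracle
      open OutcomeProperties R

      monotone-approximates : Approximates P algorithm f (K + 2# * s + 2#)
      monotone-approximates = approximates
          (+-nonNegative (+-nonNegative (fromℕ-nonNegative k) (*-nonNegative (fromℕ-nonNegative 2) (proj₁ 0<s))) (fromℕ-nonNegative 2))
          λ {stream} {O} u complete feasibleO →
        let t = runStack [] stream
            E = 𝔼 (value ∘ choose) t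
            open SubmodularCase 0<a coin nonNegative submodular 1# 0≤1 ≤-refl
              (λ h → solve 2 (λ x y → x := con (+ 1) :* x :+ (con (+ 1) :- con (+ 1)) :* y) ≈-refl (h true) (h false))
              (≤-trans (≤-reflexive (-‿inverseʳ 1#)) (*-nonNegative 0≤1 (*-nonNegative (proj₁ α-positive) (proj₁ 0<D))))
              u complete feasibleO
            survived : 1# * f O ≤ 𝔼 (λ S → f (O ∪ fromList S)) t
            survived = ≤-trans (≤-reflexive (≈-trans (*-identityˡ _) (≈-sym (constant-𝔼 (f O) t))))
              (𝔼-mono t (Always-const t λ S → monotone (Subsetₚ.p⊆p∪q (fromList S))))
            open ≤-Reasoning
        in begin
          f O                               ≈⟨ ≈-trans (*-cong as≈1 ≈-refl) (*-identityˡ _) ⟨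
          a * s * f O                       ≈⟨ solve 3 (λ a s x → a :* s :* x := s :* (a :* (con (+ 1) :* x))) ≈-refl a s (f O) ⟩
          s * (a * (1# * f O))              ≤⟨ *-monoˡ-≤ (proj₁ 0<s) (ratio-bound survived) ⟩
          s * ((1# + a) * (1# + a * D) * E) ≈⟨ *-cong ≈-refl (*-cong (*-cong ≈-refl (+-cong ≈-refl (*-cong ≈-refl ss≈D))) ≈-refl) ⟨
          s * ((1# + a) * (1# + a * (s * s)) * E)
            ≈⟨ solve 3 (λ s a e → s :* ((con (+ 1) :+ a) :* (con (+ 1) :+ a :* (s :* s)) :* e) :=
                 (s :+ a :* s) :* (con (+ 1) :+ a :* s :* s) :* e) ≈-refl s a E ⟩
          (s + a * s) * (1# + a * s * s) * E
            ≈⟨ *-cong (*-cong (+-cong ≈-refl as≈1) (+-cong ≈-refl (*-cong as≈1 ≈-refl))) ≈-refl ⟩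
          (s + 1#) * (1# + 1# * s) * E
            ≈⟨ solve 2 (λ s e → (s :+ con (+ 1)) :* (con (+ 1) :+ con (+ 1) :* s) :* e := (s :* s :+ con (+ 2) :* s :+ con (+ 1)) :* e) ≈-refl s E ⟩
          (s * s + (1# + 1#) * s + 1#) * E  ≈⟨ *-cong (+-cong (+-cong ss≈D ≈-refl) ≈-refl) ≈-refl ⟩
          (K + 1# + (1# + 1#) * s + 1#) * E
            ≈⟨ solve 3 (λ k s e → (k :+ con (+ 1) :+ con (+ 2) :* s :+ con (+ 1)) :* e :=
                 (k :+ (con (+ 1) :+ (con (+ 1) :+ con (+ 0))) :* s :+ (con (+ 1) :+ (con (+ 1) :+ con (+ 0)))) :* e) ≈-refl K s E ⟩
          (K + 2# * s + 2#) * E             ∎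
        where
        as≈1 : a * s ≈ 1#
        as≈1 = quotient-cancel 0<s
        ss≈D : s * s ≈ D
        ss≈D = √-square D (proj₁ 0<D)
        constant-𝔼 : ∀ c {A : Set} (t : Outcome A deterministic) → 𝔼 (λ _ → c) t ≈ c
        constant-𝔼 c (pure _) = ≈-refl

  module NonMonotoneCase where

    -- q makes 1 - q = q α D.  Then the expected charge α star + q α D gain of an
    -- edge covers what is lost when the coin refuses it, (1 - q) (star + gain).
    s a c q : Carrier
    s = √ (K + 2#)
    a = s / D
    c = (1# + a) * D + 1#
    q = c ⁻¹

    0<K+2 : 0# < K + 2#
    0<K+2 = <-≤-trans (+-positive 0<D 0≤1) (≤-reflexive
      (solve 1 (λ k → k :+ con (+ 1) :+ con (+ 1) := k :+ (con (+ 1) :+ (con (+ 1) :+ con (+ 0)))) ≈-refl K))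

    0<s : 0# < s
    0<s = √-positive 0<K+2

    0<a : 0# < a
    0<a = /-positive 0<s 0<D

    0<αD : 0# < (1# + a) * D
    0<αD = *-positive (+-positive 0<1 (proj₁ 0<a)) 0<D

    0<c : 0# < c
    0<c = +-positive 0<αD 0≤1

    0≤q : 0# ≤ q
    0≤q = proj₁ (⁻¹-positive 0<c)

    cq≈1 : c * q ≈ 1#
    cq≈1 = ⁻¹-inverse 0<c

    q≤1 : q ≤ 1#
    q≤1 = *-cancelˡ-≤ 0<c (begin
      c * q    ≈⟨ cq≈1 ⟩
      1#       ≤⟨ ≤-by _ (proj₁ 0<αD) (solve 1 (λ x → x := (x :+ con (+ 1)) :* con (+ 1) :- con (+ 1)) ≈-refl ((1# + a) * D)) ⟩
      c * 1#   ∎)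
      where open ≤-Reasoning

    coin : Outcome Bool randomized
    coin = flip q 0≤q q≤1 (pure true) (pure false)

    1-q≈ : 1# - q ≈ q * ((1# + a) * D)
    1-q≈ = ≈-trans (+-cong (≈-sym cq≈1) ≈-refl)
      (solve 2 (λ x q → (x :+ con (+ 1)) :* q :- q := q :* x) ≈-refl ((1# + a) * D) q)

    open Streamer R a coin public

    module _ (P : Problem k) (f : Subset (Problem.m P) → Carrier)
      (nonNegative : NonNegative f) (submodular : Submodular f) where

      open Guarantees R P f hiding (D; 0<D)
      open Instance R a 0<a coin P f
      open LocalRatio R (1# + a) (suc (Problem.n P))
      open Analysis R a 0<a isActive constraint f
      open Process R a 0<a isActive constraint f coin
      open Procedure oracle

      -- Only the share 1 - q of the optimum survives, and 1 - q = α D / (α D + 1). Dividing by it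
      -- turns the ratio into (1 + s)(D + 1 + s) / s with s = a D, least at s = √(D + 1). To avoid
      -- quotients, the inequality is multiplied by `α * s` and cancelled at the end.
      nonMonotone-approximates : Approximates P algorithm f (K + 2# * s + 3#)
      nonMonotone-approximates = approximates
          (+-nonNegative (+-nonNegative (fromℕ-nonNegative k) (*-nonNegative (fromℕ-nonNegative 2) (proj₁ 0<s))) (fromℕ-nonNegative 3))
          λ {stream} {O} u complete feasibleO →
        let t = runStack [] stream
            E = 𝔼 (value ∘ choose) t
            module Case = SubmodularCase 0<a coin nonNegative submodular q 0≤q q≤1 (λ _ → ≈-refl) (≤-reflexive 1-q≈) u complete feasibleO
            open Case.Survival nonNegative submodular O
            open ≤-Reasoning
        in *-cancelˡ-≤ (*-positive α-positive 0<s) (begin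
          α * s * f O                          ≈⟨ *-cong (*-cong ≈-refl aD≈s) ≈-refl ⟨
          α * (a * D) * f O                    ≈⟨ ≈-trans (*-cong cq≈1 ≈-refl) (*-identityˡ _) ⟨
          c * q * (α * (a * D) * f O)          ≈⟨ solve 6 (λ c q α a d x → c :* q :* (α :* (a :* d) :* x) := c :* (a :* (q :* (α :* d) :* x))) ≈-refl c q α a D (f O) ⟩
          c * (a * (q * (α * D) * f O))        ≈⟨ *-cong ≈-refl (*-cong ≈-refl (*-cong 1-q≈ ≈-refl)) ⟨
          c * (a * ((1# - q) * f O))           ≤⟨ *-monoˡ-≤ (proj₁ 0<c) (Case.ratio-bound (survival u)) ⟩
          c * (α * (1# + a * D) * E)           ≈⟨ *-cong c≈ (*-cong (*-cong ≈-refl (+-cong ≈-refl aD≈s)) ≈-refl) ⟩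
          s * (s + 1#) * (α * (1# + s) * E)
            ≈⟨ solve 3 (λ s α e → s :* (s :+ con (+ 1)) :* (α :* (con (+ 1) :+ s) :* e) :=
                 α :* s :* ((s :* s :+ con (+ 2) :* s :+ con (+ 1)) :* e)) ≈-refl s α E ⟩
          α * s * ((s * s + (1# + 1#) * s + 1#) * E)
            ≈⟨ *-cong ≈-refl (*-cong (+-cong (+-cong ss≈ ≈-refl) ≈-refl) ≈-refl) ⟩
          α * s * ((K + 2# + (1# + 1#) * s + 1#) * E)
            ≈⟨ *-cong ≈-refl (solve 3 (λ k s e → (k :+ (con (+ 1) :+ (con (+ 1) :+ con (+ 0))) :+ con (+ 2) :* s :+ con (+ 1)) :* e :=
                 (k :+ (con (+ 1) :+ (con (+ 1) :+ con (+ 0))) :* s :+ (con (+ 1) :+ (con (+ 1) :+ (con (+ 1) :+ con (+ 0))))) :* e) ≈-refl K s E) ⟩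
          α * s * ((K + 2# * s + 3#) * E)      ∎)
        where
        aD≈s : a * D ≈ s
        aD≈s = quotient-cancel 0<D
        ss≈ : s * s ≈ K + 2#
        ss≈ = √-square (K + 2#) (proj₁ 0<K+2)
        c≈ : c ≈ s * (s + 1#)
        c≈ = begin-equality
          (1# + a) * D + 1#    ≈⟨ solve 2 (λ a d → (con (+ 1) :+ a) :* d :+ con (+ 1) := (d :+ con (+ 1)) :+ a :* d) ≈-refl a D ⟩
          D + 1# + a * D       ≈⟨ +-cong (solve 1 (λ k → k :+ con (+ 1) :+ con (+ 1) := k :+ (con (+ 1) :+ (con (+ 1) :+ con (+ 0)))) ≈-refl K) aD≈s ⟩
          K + 2# + s           ≈⟨ +-cong ss≈ ≈-refl ⟨
          s * s + s            ≈⟨ solve 1 (λ s → s :* s :+ s := s :* (s :+ con (+ 1))) ≈-refl s ⟩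
          s * (s + 1#)         ∎
          where open ≤-Reasoning

theorem3 : (R : EuclideanField) (k : ℕ) →
    let open EuclideanField R
        open Streaming R
        K = fromℕ k
        2# = fromℕ 2
        3# = fromℕ 3
        εₘ = 1# / √ (K + 1#)
        εₙ = √ (K + 2#) / (K + 1#)
    in
    (∃[ C ] ∀ ε → 0# < ε →
      Σ[ A ∈ Algorithm deterministic ]
        ∀ (P : Problem k) (w : Fin (Problem.m P) → Carrier) → (∀ e → 0# ≤ w e) →
          Approximates P A (linear w) (K + 1# + ε) ×
          MemoryBound P A (linear w) (IsMaxWeightRatio w) ε C)
    ×
    (∃[ C ]
      Σ[ A ∈ Algorithm deterministic ]
        ∀ (P : Problem k) (f : Subset (Problem.m P) → Carrier) →
          NonNegative f → Submodular f → Monotone f →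
          Approximates P A f (K + 2# * √ (K + 1#) + 2#) ×
          MemoryBound P A f (IsMaxMarginalRatio f) εₘ C)
    ×
    (∃[ C ]
      Σ[ A ∈ Algorithm randomized ]
        ∀ (P : Problem k) (f : Subset (Problem.m P) → Carrier) →
          NonNegative f → Submodular f →
          Approximates P A f (K + 2# * √ (K + 2#) + 3#) ×
          MemoryBound P A f (IsMaxMarginalRatio f) εₙ C)
theorem3 R k =
  (constant k (linear-constant (suc k)) , λ ε 0<ε → Streamer.algorithm R (ε / (fromℕ k + 1#)) (pure true) , λ P w 0≤w →
    LinearCase.linear-approximates R P w 0≤w 0<ε ,
    λ {W} {L} {M} {r} → LinearCase.linear-memory R P w 0≤w 0<ε {W} {L} {M} {r}) ,
  (constant k 3 , MonotoneCase.algorithm , λ P f nonNegative submodular monotone →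
    MonotoneCase.monotone-approximates P f nonNegative submodular monotone ,
    λ {W} {L} {M} {r} → Guarantees.submodular-memory R P f MonotoneCase.0<a MonotoneCase.coin {W} {L} {M} {r}) ,
  (constant k 3 , NonMonotoneCase.algorithm , λ P f nonNegative submodular →
    NonMonotoneCase.nonMonotone-approximates P f nonNegative submodular ,
    λ {W} {L} {M} {r} → Guarantees.submodular-memory R P f NonMonotoneCase.0<a NonMonotoneCase.coin {W} {L} {M} {r})
  where
  open EuclideanField R using (_/_; _+_; 1#; fromℕ)
  open Streaming R using (pure)
  open SubmodularCases R k
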